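{- Let $K$ be an algebraically closed field, $X\subset\mathbb{A}^m_K$ a closed subscheme, and $D\ge0$ an integer. Then there exists $C=C(X,D)>0$ such that for every $N>0$ and all polynomials $F_1,\ldots,F_N\in K[X_1,\ldots,X_m]$ of degree at most $D$, one has $N(X,\mathcal{S})\le C\cdot N^{\dim X}$, where $\mathcal{S}=\{Y_1,\ldots,Y_N\}$ and $Y_i$ is the intersection of $X$ with the hypersurface $F_i=0$.
   Context: For a scheme $X$ of finite type over $K$ and a finite set $\mathcal{S}$ of closed subschemes of $X$, for $\sigma\in\{0,1\}^{\mathcal{S}}$ let $\mathrm{R}(\sigma)=\{x\in X(K)\mid\forall Y\in\mathcal{S},\ x\in Y\Leftrightarrow\sigma(Y)=1\}$, $\Sigma(X,\mathcal{S})=\{\sigma\mid\mathrm{R}(\sigma)\ne\emptyset\}$, and $N(X,\mathcal{S})=\mathrm{card}\,\Sigma(X,\mathcal{S})$ (the number of realizable $0/1$-patterns). -}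

module Defs where

open import Level using (Level; _⊔_) renaming (suc to lsuc)
open import Data.Nat using (ℕ; zero; suc; _≤_)
open import Data.Fin using (Fin)
open import Data.Vec using (Vec; []; _∷_; lookup)
open import Data.List using (List; []; _∷_; foldr)
open import Data.List.Relation.Unary.All using (All)
open import Data.Product using (Σ; ∃; _×_; _,_)
open import Data.Sum using (_⊎_)
open import Data.Bool using (Bool; true)
open import Relation.Nullary using (¬_)
open import Relation.Binary.PropositionalEquality using (_≡_)
open import Algebra.Bundles using (CommutativeRing)

record Field (c ℓ : Level) : Set (lsuc (c ⊔ ℓ)) where
  field
    commutativeRing : CommutativeRing c ℓ
  open CommutativeRing commutativeRing public
  field
    0≉1     : ¬ (0# ≈ 1#)
    inverse : ∀ x → ¬ (x ≈ 0#) → Σ Carrier λ y → (x * y) ≈ 1#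

module _ {c ℓ : Level} (K : Field c ℓ) where
  open Field K

  pow : Carrier → ℕ → Carrier
  pow x zero    = 1#
  pow x (suc n) = x * pow x n

  evalUni : ∀ {n} → Vec Carrier n → Carrier → Carrier
  evalUni []       x = 0#
  evalUni (a ∷ as) x = a + x * evalUni as x

  lastV : ∀ {n} → Vec Carrier (suc n) → Carrier
  lastV (a ∷ [])     = a
  lastV (a ∷ b ∷ as) = lastV (b ∷ as)

  AlgClosed : Set (c ⊔ ℓ)
  AlgClosed = ∀ (n : ℕ) (a : Vec Carrier (suc (suc n))) →
              ¬ (lastV a ≈ 0#) → Σ Carrier λ t → evalUni a t ≈ 0#

  Monomial : ℕ → Set
  Monomial m = Vec ℕ m

  Poly : ℕ → Set c
  Poly m = List (Carrier × Monomial m)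

  totalDeg : ∀ {m} → Monomial m → ℕ
  totalDeg []       = 0
  totalDeg (e ∷ es) = e Data.Nat.+ totalDeg es

  evalMon : ∀ {m} → Monomial m → Vec Carrier m → Carrier
  evalMon []       []       = 1#
  evalMon (e ∷ es) (x ∷ xs) = pow x e * evalMon es xs

  eval : ∀ {m} → Poly m → Vec Carrier m → Carrier
  eval p x = foldr (λ { (a , e) r → a * evalMon e x + r }) 0# p

  DegLe : ∀ {m} → Poly m → ℕ → Set c
  DegLe p D = All (λ t → totalDeg (Data.Product.proj₂ t) ≤ D) p

  -- Zariski closed subsets of K^m = V(G) for a finite list G of polynomials.
  -- (Since K is algebraically closed, a closed subscheme X ⊂ 𝔸^m is given by
  -- finitely many equations and X(K) = V(G).)
  Pt : ℕ → Set c
  Pt m = Vec Carrier m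

  V : ∀ {m} → List (Poly m) → Pt m → Set (c ⊔ ℓ)
  V G x = All (λ g → eval g x ≈ 0#) G

  _⊆V_ : ∀ {m} → List (Poly m) → List (Poly m) → Set (c ⊔ ℓ)
  A ⊆V B = ∀ x → V A x → V B x

  _⊂V_ : ∀ {m} → List (Poly m) → List (Poly m) → Set (c ⊔ ℓ)
  A ⊂V B = (A ⊆V B) × (Σ (Pt _) λ x → V B x × ¬ V A x)

  Irreducible : ∀ {m} → List (Poly m) → Set (c ⊔ ℓ)
  Irreducible {m} Z =
    (Σ (Pt m) λ x → V Z x) ×
    (∀ (A B : List (Poly m)) → (∀ x → V Z x → V A x ⊎ V B x) →
       (Z ⊆V A) ⊎ (Z ⊆V B))

  record Chain {m} (G : List (Poly m)) (e : ℕ) : Set (c ⊔ ℓ) where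
    field
      Z      : Fin (suc e) → List (Poly m)
      irred  : ∀ i → Irreducible (Z i)
      inX    : ∀ i → Z i ⊆V G
      strict : ∀ (i : Fin e) → Z (Data.Fin.inject₁ i) ⊂V Z (Data.Fin.suc i)

  IsDim : ∀ {m} → List (Poly m) → ℕ → Set (c ⊔ ℓ)
  IsDim G d = Chain G d × (∀ e → Chain G e → e ≤ d)

  -- Patterns. For X = V(G) and F₁,…,F_N, with Yᵢ = X ∩ {Fᵢ = 0},
  -- R(σ) = { x ∈ X(K) | ∀ i, x ∈ Yᵢ ⇔ σ i = true }.
  InR : ∀ {m N} → List (Poly m) → (Fin N → Poly m) → (Fin N → Bool) →
        Pt m → Set (c ⊔ ℓ)
  InR G F σ x = V G x × (∀ i → ((V G x × eval (F i) x ≈ 0#) → σ i ≡ true)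
                                × (σ i ≡ true → V G x × eval (F i) x ≈ 0#))

  Realizable : ∀ {m N} → List (Poly m) → (Fin N → Poly m) →
               (Fin N → Bool) → Set (c ⊔ ℓ)
  Realizable {m} G F σ = Σ (Pt m) (InR G F σ)

DistinctPat : ∀ {N} → (Fin N → Bool) → (Fin N → Bool) → Set
DistinctPat σ τ = ¬ (∀ i → σ i ≡ τ i)

data PairwiseDistinct {N : ℕ} : List (Fin N → Bool) → Set where
  []  : PairwiseDistinct []
  _∷_ : ∀ {σ σs} → All (DistinctPat σ) σs → PairwiseDistinct σs →
        PairwiseDistinct (σ ∷ σs)

{-# OPTIONS --safe #-}
module Submission where

-- The bound on the number of patterns is a decidable statement.  Hence, although equality in K is
-- not decidable, excluded middle may be used finitely often under ¬¬; only the constant C and the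
-- irreducibility proofs required by chains have to be constructive.
--
-- X is cut into finitely many towers, in which each coordinate is either free or a root of a
-- polynomial over the preceding ones.  On a tower with r free coordinates the polynomials of
-- degree O(N) span, up to a unit, a space of dimension O(Nʳ), whereas the products of the Fᵢ not
-- vanishing at the realizing points are linearly independent: a tower carries O(Nʳ) patterns.
--
-- A non-empty tower with r free coordinates yields a chain of length r in X, so r ≤ d: factors of
-- minimal degree make the tower irreducible, its Zariski closure is the top of the chain, and the
-- free coordinates are then specialised one after the other.
--
-- The closure Z of an irreducible tower is irreducible in the constructive sense: if A and B cover
-- Z, they colour a finite grid of points of Z algebraic over a subfield with decidable equality.
-- One of the colours contains a grid large enough to detect the non-vanishing of polynomials of
-- the degrees occurring in A and B, and over such points a linear map with trivial kernel up to
-- ¬¬ is injective.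

open import Defs
open import Level using (Level; _⊔_; Lift; lift) renaming (suc to lsuc)
open import Algebra.Bundles using (RawRing)
open import Algebra.Solver.Ring.AlmostCommutativeRing using (fromCommutativeRing; _-Raw-AlmostCommutative⟶_)
open import Data.Bool using (Bool; true; false)
open import Data.Empty using (⊥; ⊥-elim)
open import Data.Empty.Polymorphic using () renaming (⊥ to ⊥ₚ)
open import Data.Fin as Fin using (Fin)
import Data.Fin.Properties as Finₚ
import Data.Integer as ℤ
import Data.Integer.Properties as ℤₚ
open import Data.List as L using (List; []; _∷_; _++_; length)
open import Data.List.Membership.Propositional.Properties using (∈-lookup; ∈-allFin)
open import Data.List.Relation.Binary.Sublist.Propositional using (_⊆_; []; _∷_) renaming (_∷ʳ_ to _∷ʳˢ_)
import Data.List.Relation.Binary.Sublist.Propositional.Properties as Subₚ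
open import Data.List.Relation.Unary.All as All using (All; []; _∷_)
import Data.List.Relation.Unary.All.Properties as Allₚ
open import Data.List.Relation.Unary.AllPairs using (AllPairs; []; _∷_)
open import Data.List.Relation.Unary.Any as Any using (Any; here; there)
import Data.List.Relation.Unary.Any.Properties as Anyₚ
open import Data.Maybe using (Maybe; just; nothing)
open import Data.Nat as ℕ using (ℕ; zero; suc; z≤n; s≤s; _≤_; _<_)
import Data.Nat.DivMod as DivMod
open import Data.Nat.Induction using (<-wellFounded)
import Data.Nat.Properties as ℕₚ
open import Data.Nat.Solver using () renaming (module +-*-Solver to ℕS)
open import Data.Product using (Σ; ∃; _×_; _,_; proj₁; proj₂)
import Data.Sign as Sign
open import Data.Sum as Sum using (_⊎_; inj₁; inj₂)
open import Data.Unit.Polymorphic using (⊤; tt)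
open import Data.Vec as Vec using (Vec; []; _∷_; _∷ʳ_)
open import Data.Vec.Relation.Binary.Pointwise.Inductive as PW using (Pointwise; []; _∷_)
open import Data.Vec.Relation.Unary.All as VAll using ([]; _∷_) renaming (All to VAll)
import Data.Vec.Relation.Unary.All.Properties as VAllₚ
open import Data.Vec.Relation.Unary.Any using (here; there) renaming (Any to VAny)
open import Function using (_∘_)
open import Induction.WellFounded using (Acc; acc; WellFounded)
open import Relation.Binary.Definitions using (tri<; tri≈; tri>)
open import Relation.Binary.PropositionalEquality as ≡ using (_≡_)
open import Relation.Nullary using (¬_; Dec; yes; no)
open import Relation.Nullary.Decidable using (decidable-stable)

-- What has to be constructive is dictated by `Irreducible`: for every cover by `A` and `B` it asks
-- which of the two contains the set. A double negation does not pass through the quantifier over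
-- `A` and `B`, so one list of equations, fixed in advance, must serve all covers. The list is a
-- Gröbner basis of the ideal of the tower: Dickson's lemma yields its finite set of leading
-- exponents once, under `¬¬`, and rewriting to standard exponents is then an algorithm. Whether an
-- equation of `A` holds on the closure becomes the question whether the coefficients of its normal
-- form are zero.
--
-- Pseudo-division takes the place of division, so that quotients and remainders stay polynomial in
-- the parameters. For the count two of its features matter: it enlarges degree bounds by a constant
-- factor depending on the tower alone, and its multiplier is the same for all polynomials within a
-- given bound. The count is made on the towers produced by the decomposition; prime towers serve
-- the comparison of their dimensions with `d`.

private variable
  a b p q : Level
  A : Set a
  B : Set b
  i n m e d N M D κ : ℕ

module Patterns {c ℓ} (K : Field c ℓ) (ac : AlgClosed K) where

  open Field K public
    renaming (zero to *-zero)
  open import Algebra.Properties.Ring ring public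
    using (-‿distribˡ-*; -‿distribʳ-*; -0#≈0#; -‿involutive)
  open import Algebra.Properties.AbelianGroup +-abelianGroup public
    using (⁻¹-∙-comm)
  import Algebra.Properties.Semiring.Mult semiring as SM
  open import Relation.Binary.Reasoning.Setoid setoid public

  -- Ring solver with integer coefficients

  private
    ι : ℕ → Carrier
    ι n = n SM.× 1#

    ⟦_⟧ℤ : ℤ.ℤ → Carrier
    ⟦ ℤ.+ n ⟧ℤ      = ι n
    ⟦ ℤ.-[1+ n ] ⟧ℤ = - ι (suc n)

    x-x : ∀ x → x + - x ≈ 0#
    x-x = -‿inverseʳ

    ⊖-homo : ∀ m n → ⟦ m ℤ.⊖ n ⟧ℤ ≈ ι m + - ι n
    ⊖-homo zero zero = sym (x-x 0#)
    ⊖-homo zero (suc n) = sym (+-identityˡ _)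
    ⊖-homo (suc m) zero = sym (trans (+-congˡ -0#≈0#) (+-identityʳ _))
    ⊖-homo (suc m) (suc n) = begin
      ⟦ suc m ℤ.⊖ suc n ⟧ℤ ≡⟨ ≡.cong ⟦_⟧ℤ (ℤₚ.[1+m]⊖[1+n]≡m⊖n m n) ⟩
      ⟦ m ℤ.⊖ n ⟧ℤ ≈⟨ ⊖-homo m n ⟩
      ι m + - ι n ≈⟨ +-congʳ (sym (+-identityʳ _)) ⟩
      (ι m + 0#) + - ι n ≈⟨ +-congʳ (+-congˡ (sym (x-x 1#))) ⟩
      (ι m + (1# + - 1#)) + - ι n ≈⟨ +-congʳ (sym (+-assoc _ _ _)) ⟩
      ((ι m + 1#) + - 1#) + - ι n ≈⟨ +-assoc _ _ _ ⟩
      (ι m + 1#) + (- 1# + - ι n) ≈⟨ +-cong (+-comm _ _) (⁻¹-∙-comm _ _) ⟩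
      ι (suc m) + - ι (suc n) ∎

    +-homoℤ : ∀ x y → ⟦ x ℤ.+ y ⟧ℤ ≈ ⟦ x ⟧ℤ + ⟦ y ⟧ℤ
    +-homoℤ (ℤ.+ m) (ℤ.+ n) = SM.×-homo-+ 1# m n
    +-homoℤ (ℤ.+ m) ℤ.-[1+ n ] = ⊖-homo m (suc n)
    +-homoℤ ℤ.-[1+ m ] (ℤ.+ n) = trans (⊖-homo n (suc m)) (+-comm _ _)
    +-homoℤ ℤ.-[1+ m ] ℤ.-[1+ n ] = begin
      - ι (suc (suc (m ℕ.+ n))) ≡⟨ ≡.cong (λ z → - ι (suc z)) (≡.sym (ℕₚ.+-suc m n)) ⟩
      - ι (suc m ℕ.+ suc n) ≈⟨ -‿cong (SM.×-homo-+ 1# (suc m) (suc n)) ⟩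
      - (ι (suc m) + ι (suc n)) ≈⟨ sym (⁻¹-∙-comm _ _) ⟩
      - ι (suc m) + - ι (suc n) ∎

    -homoℤ : ∀ x → ⟦ ℤ.- x ⟧ℤ ≈ - ⟦ x ⟧ℤ
    -homoℤ (ℤ.+ zero) = sym -0#≈0#
    -homoℤ (ℤ.+ suc n) = refl
    -homoℤ ℤ.-[1+ n ] = sym (-‿involutive _)

    ◃+ : ∀ n → ⟦ Sign.+ ℤ.◃ n ⟧ℤ ≈ ι n
    ◃+ n = reflexive (≡.cong ⟦_⟧ℤ (ℤₚ.+◃n≡+n n))
    ◃- : ∀ n → ⟦ Sign.- ℤ.◃ n ⟧ℤ ≈ - ι n
    ◃- n = trans (reflexive (≡.cong ⟦_⟧ℤ (ℤₚ.-◃n≡-n n))) (-homoℤ (ℤ.+ n))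

    *-homoℤ : ∀ x y → ⟦ x ℤ.* y ⟧ℤ ≈ ⟦ x ⟧ℤ * ⟦ y ⟧ℤ
    *-homoℤ (ℤ.+ m) (ℤ.+ n) = trans (◃+ (m ℕ.* n)) (SM.×1-homo-* m n)
    *-homoℤ (ℤ.+ m) ℤ.-[1+ n ] = trans (◃- (m ℕ.* suc n))
      (trans (-‿cong (SM.×1-homo-* m (suc n))) (-‿distribʳ-* _ _))
    *-homoℤ ℤ.-[1+ m ] (ℤ.+ n) = trans (◃- (suc m ℕ.* n))
      (trans (-‿cong (SM.×1-homo-* (suc m) n)) (-‿distribˡ-* _ _))
    *-homoℤ ℤ.-[1+ m ] ℤ.-[1+ n ] = trans (◃+ (suc m ℕ.* suc n)) (trans (SM.×1-homo-* (suc m) (suc n))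
      (sym (trans (sym (-‿distribˡ-* _ _)) (trans (-‿cong (sym (-‿distribʳ-* _ _))) (-‿involutive _)))))

    ℤ-raw : RawRing _ _
    ℤ-raw = record { Carrier = ℤ.ℤ ; _≈_ = _≡_ ; _+_ = ℤ._+_ ; _*_ = ℤ._*_ ; -_ = ℤ.-_
                   ; 0# = ℤ.0ℤ ; 1# = ℤ.1ℤ }

    morph : ℤ-raw -Raw-AlmostCommutative⟶ fromCommutativeRing commutativeRing
    morph = record { ⟦_⟧ = ⟦_⟧ℤ ; +-homo = +-homoℤ ; *-homo = *-homoℤ ; -‿homo = -homoℤ
                   ; 0-homo = refl ; 1-homo = +-identityʳ 1# }

    ℤ-dec : ∀ x y → Maybe (⟦ x ⟧ℤ ≈ ⟦ y ⟧ℤ)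
    ℤ-dec x y with x ℤₚ.≟ y
    ... | yes e = just (reflexive (≡.cong ⟦_⟧ℤ e))
    ... | no _ = nothing

  -- Coefficients in ℤ let the solver cancel x - x, which needs a decidable coefficient ring.
  import Algebra.Solver.Ring ℤ-raw (fromCommutativeRing commutativeRing) morph ℤ-dec as RingSolver
  open RingSolver public using (solve; _:=_; _:+_; _:*_; :-_; _:-_; con)

  -- The double-negation monad and field arithmetic

  infixl 1 _>>=_
  _>>=_ : ¬ ¬ A → (A → ¬ ¬ B) → ¬ ¬ B
  (m >>= f) k = m (λ x → f x k)

  return : A → ¬ ¬ A
  return x k = k x

  em : (A : Set a) → ¬ ¬ (A ⊎ ¬ A)
  em A k = k (inj₂ (λ x → k (inj₁ x)))

  -- Excluded middle is used once per descent, hence finitely often.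
  least : ∀ {p} (P : ℕ → Set p) → ∃ P → ¬ ¬ (∃ λ n → P n × (∀ m → m < n → ¬ P m))
  least P (n , h) = go n (<-wellFounded n) h
    where
    go : ∀ n → Acc _<_ n → P n → ¬ ¬ (∃ λ n → P n × (∀ m → m < n → ¬ P m))
    go n (acc rs) h = do
      inj₁ (m , m<n , h′) ← em (∃ λ m → m < n × P m)
        where inj₂ nope → return (n , h , λ m m<n h′ → nope (m , m<n , h′))
      go m (rs m<n) h′

  1≉0 : ¬ (1# ≈ 0#)
  1≉0 e = 0≉1 (sym e)

  x*0≈0 : ∀ {x y} → y ≈ 0# → x * y ≈ 0#
  x*0≈0 e = trans (*-congˡ e) (zeroʳ _)

  0*x≈0 : ∀ {x y} → x ≈ 0# → x * y ≈ 0#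
  0*x≈0 e = trans (*-congʳ e) (zeroˡ _)

  0+0≈0 : ∀ {x y} → x ≈ 0# → y ≈ 0# → x + y ≈ 0#
  0+0≈0 e f = trans (+-cong e f) (+-identityˡ _)

  ≉-resp : ∀ {x y} → x ≈ y → ¬ x ≈ 0# → ¬ y ≈ 0#
  ≉-resp e n f = n (trans e f)

  cancel≉ : ∀ {x y} → ¬ x ≈ 0# → x * y ≈ 0# → y ≈ 0#
  cancel≉ {x} {y} nx e with inverse x nx
  ... | z , xz = begin
    y            ≈⟨ sym (*-identityˡ y) ⟩
    1# * y       ≈⟨ *-congʳ (sym xz) ⟩
    (x * z) * y  ≈⟨ solve 3 (λ x y z → (x :* z) :* y := z :* (x :* y)) refl x y z ⟩
    z * (x * y)  ≈⟨ x*0≈0 e ⟩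
    0# ∎

  *≉0 : ∀ {x y} → ¬ x ≈ 0# → ¬ y ≈ 0# → ¬ x * y ≈ 0#
  *≉0 nx ny e = ny (cancel≉ nx e)

  ≉0-*ˡ : ∀ {x y} → ¬ x * y ≈ 0# → ¬ x ≈ 0#
  ≉0-*ˡ n e = n (0*x≈0 e)

  ≉0-*ʳ : ∀ {x y} → ¬ x * y ≈ 0# → ¬ y ≈ 0#
  ≉0-*ʳ n e = n (x*0≈0 e)

  integral : ∀ {x y} → x * y ≈ 0# → ¬ ¬ (x ≈ 0# ⊎ y ≈ 0#)
  integral {x} {y} e = do
    inj₁ z ← em (x ≈ 0#)
      where inj₂ n → return (inj₂ (cancel≉ n e))
    return (inj₁ z)

  infixr 8 _^_
  _^_ : Carrier → ℕ → Carrier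
  _^_ = pow K

  ^-≉0 : ∀ {x} n → ¬ x ≈ 0# → ¬ x ^ n ≈ 0#
  ^-≉0 zero nx = 1≉0
  ^-≉0 (suc n) nx = *≉0 nx (^-≉0 n nx)

  ^-cong : ∀ {x y} n → x ≈ y → x ^ n ≈ y ^ n
  ^-cong zero e = refl
  ^-cong (suc n) e = *-cong e (^-cong n e)

  ^-+ : ∀ x m n → x ^ (m ℕ.+ n) ≈ x ^ m * x ^ n
  ^-+ x zero n = sym (*-identityˡ _)
  ^-+ x (suc m) n = trans (*-congˡ (^-+ x m n)) (sym (*-assoc _ _ _))

  ^-* : ∀ x y n → (x * y) ^ n ≈ x ^ n * y ^ n
  ^-* x y zero = sym (*-identityˡ _)
  ^-* x y (suc n) = trans (*-congˡ (^-* x y n))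
    (solve 4 (λ x y p q → (x :* y) :* (p :* q) := (x :* p) :* (y :* q)) refl x y (x ^ n) (y ^ n))

  x-y≈0 : ∀ {x y} → x + - y ≈ 0# → x ≈ y
  x-y≈0 {x} {y} e = trans (solve 2 (λ x y → x := (x :- y) :+ y) refl x y) (trans (+-congʳ e) (+-identityˡ y))

  -- Polynomials in i + 1 variables are coefficient vectors, constant term first, over
  -- polynomials in i variables; the main variable is the head of the point.
  data NP : ℕ → Set c where
    con₀ : Carrier → NP 0
    poly : Vec (NP i) n → NP (suc i)

  Point : ℕ → Set c
  Point = Vec Carrier

  ev  : NP i → Point i → Carrier
  evV : Vec (NP i) n → Carrier → Point i → Carrier
  ev (con₀ a) _ = a
  ev (poly as) (t ∷ x) = evV as t x
  evV [] t x = 0#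
  evV (a ∷ as) t x = ev a x + t * evV as t x

  -- (as , l) stands for a₀ + a₁ t + … + l tᵉ; the leading coefficient l may vanish at some points.
  MP : ℕ → ℕ → Set c
  MP i e = Vec (NP i) e × NP i

  evM' : Vec (NP i) e → NP i → Carrier → Point i → Carrier
  evM' [] l t x = ev l x
  evM' (a ∷ as) l t x = ev a x + t * evM' as l t x

  evM : MP i e → Carrier → Point i → Carrier
  evM (as , l) = evM' as l

  lead : MP i e → NP i
  lead = proj₂

  zer : NP i
  zer {zero} = con₀ 0#
  zer {suc i} = poly []

  cst : Carrier → NP i
  cst {zero} a = con₀ a
  cst {suc i} a = poly (cst a ∷ [])

  liftP : NP i → NP (suc i)
  liftP p = poly (p ∷ [])

  add  : NP i → NP i → NP i
  addV : Vec (NP i) n → Vec (NP i) m → Vec (NP i) (n ℕ.⊔ m)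
  add (con₀ a) (con₀ b) = con₀ (a + b)
  add (poly as) (poly bs) = poly (addV as bs)
  addV [] bs = bs
  addV (a ∷ as) [] = a ∷ as
  addV (a ∷ as) (b ∷ bs) = add a b ∷ addV as bs

  shift : NP (suc i) → NP (suc i)
  shift (poly as) = poly (zer ∷ as)

  mul    : NP i → NP i → NP i
  mulP   : Vec (NP i) n → NP (suc i) → NP (suc i)
  scaleV : NP i → Vec (NP i) n → Vec (NP i) n
  mul (con₀ a) (con₀ b) = con₀ (a * b)
  mul (poly as) q = mulP as q
  mulP [] q = zer
  mulP (a ∷ as) (poly bs) = add (poly (scaleV a bs)) (shift (mulP as (poly bs)))
  scaleV a [] = []
  scaleV a (b ∷ bs) = mul a b ∷ scaleV a bs

  neg : NP i → NP i
  neg p = mul (cst (- 1#)) p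

  powP : NP i → ℕ → NP i
  powP p zero = cst 1#
  powP p (suc n) = mul p (powP p n)

  ev-zer : (x : Point i) → ev zer x ≈ 0#
  ev-zer {zero} x = refl
  ev-zer {suc i} (t ∷ x) = refl

  ev-cst : ∀ a (x : Point i) → ev (cst a) x ≈ a
  ev-cst {zero} a x = refl
  ev-cst {suc i} a (t ∷ x) = trans (+-cong (ev-cst a x) (zeroʳ t)) (+-identityʳ a)

  ev-liftP : ∀ (p : NP i) t x → ev (liftP p) (t ∷ x) ≈ ev p x
  ev-liftP p t x = trans (+-congˡ (zeroʳ t)) (+-identityʳ _)

  ev-add  : ∀ (p q : NP i) x → ev (add p q) x ≈ ev p x + ev q x
  ev-addV : ∀ (as : Vec (NP i) n) (bs : Vec (NP i) m) t x → evV (addV as bs) t x ≈ evV as t x + evV bs t x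
  ev-add (con₀ a) (con₀ b) x = refl
  ev-add (poly as) (poly bs) (t ∷ x) = ev-addV as bs t x
  ev-addV [] bs t x = sym (+-identityˡ _)
  ev-addV (a ∷ as) [] t x = sym (+-identityʳ _)
  ev-addV (a ∷ as) (b ∷ bs) t x = trans (+-cong (ev-add a b x) (*-congˡ (ev-addV as bs t x)))
    (solve 5 (λ a b t p q → (a :+ b) :+ t :* (p :+ q) := (a :+ t :* p) :+ (b :+ t :* q)) refl
       (ev a x) (ev b x) t (evV as t x) (evV bs t x))

  ev-shift : ∀ (p : NP (suc i)) t x → ev (shift p) (t ∷ x) ≈ t * ev p (t ∷ x)
  ev-shift (poly as) t x = trans (+-congʳ (ev-zer x)) (+-identityˡ _)

  ev-mul    : ∀ (p q : NP i) x → ev (mul p q) x ≈ ev p x * ev q x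
  ev-mulP   : ∀ (as : Vec (NP i) n) q t x → ev (mulP as q) (t ∷ x) ≈ evV as t x * ev q (t ∷ x)
  ev-scaleV : ∀ a (bs : Vec (NP i) n) t x → evV (scaleV a bs) t x ≈ ev a x * evV bs t x
  ev-mul (con₀ a) (con₀ b) x = refl
  ev-mul (poly as) q (t ∷ x) = ev-mulP as q t x
  ev-mulP [] q t x = sym (zeroˡ _)
  ev-mulP (a ∷ as) (poly bs) t x = begin
    ev (add (poly (scaleV a bs)) (shift (mulP as (poly bs)))) (t ∷ x)
      ≈⟨ ev-add (poly (scaleV a bs)) (shift (mulP as (poly bs))) (t ∷ x) ⟩
    evV (scaleV a bs) t x + ev (shift (mulP as (poly bs))) (t ∷ x)
      ≈⟨ +-cong (ev-scaleV a bs t x) (trans (ev-shift (mulP as (poly bs)) t x) (*-congˡ (ev-mulP as (poly bs) t x))) ⟩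
    ev a x * evV bs t x + t * (evV as t x * evV bs t x)
      ≈⟨ solve 4 (λ a b t p → a :* b :+ t :* (p :* b) := (a :+ t :* p) :* b) refl (ev a x) (evV bs t x) t (evV as t x) ⟩
    (ev a x + t * evV as t x) * evV bs t x ∎
  ev-scaleV a [] t x = sym (zeroʳ _)
  ev-scaleV a (b ∷ bs) t x = trans (+-cong (ev-mul a b x) (*-congˡ (ev-scaleV a bs t x)))
    (solve 4 (λ a b t p → a :* b :+ t :* (a :* p) := a :* (b :+ t :* p)) refl (ev a x) (ev b x) t (evV bs t x))

  ev-neg : ∀ (p : NP i) x → ev (neg p) x ≈ - ev p x
  ev-neg p x = trans (ev-mul (cst (- 1#)) p x) (trans (*-congʳ (ev-cst (- 1#) x))
    (trans (sym (-‿distribˡ-* 1# _)) (-‿cong (*-identityˡ _))))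

  ev-powP : ∀ (p : NP i) n x → ev (powP p n) x ≈ ev p x ^ n
  ev-powP p zero x = ev-cst 1# x
  ev-powP p (suc n) x = trans (ev-mul p (powP p n) x) (*-congˡ (ev-powP p n x))

  evV-zeros : ∀ n t (x : Point i) → evV (Vec.replicate n zer) t x ≈ 0#
  evV-zeros zero t x = refl
  evV-zeros (suc n) t x = 0+0≈0 (ev-zer x) (x*0≈0 (evV-zeros n t x))

  infix 4 _≋_
  data _≋_ : ∀ {i} → Point i → Point i → Set (c ⊔ ℓ) where
    []  : [] ≋ []
    _∷_ : ∀ {i s t} {x y : Point i} → s ≈ t → x ≋ y → (s ∷ x) ≋ (t ∷ y)

  ≋-refl : (x : Point i) → x ≋ x
  ≋-refl [] = []
  ≋-refl (t ∷ x) = refl ∷ ≋-refl x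

  ev-cong  : ∀ (p : NP i) {x y} → x ≋ y → ev p x ≈ ev p y
  evV-cong : ∀ (as : Vec (NP i) n) {s t x y} → s ≈ t → x ≋ y → evV as s x ≈ evV as t y
  ev-cong (con₀ a) e = refl
  ev-cong (poly as) (s ∷ e) = evV-cong as s e
  evV-cong [] s e = refl
  evV-cong (a ∷ as) s e = +-cong (ev-cong a e) (*-cong s (evV-cong as s e))

  mpV : MP i e → Vec (NP i) (suc e)
  mpV (as , l) = as ∷ʳ l

  ev-mpV : ∀ (as : Vec (NP i) e) l t x → evV (as ∷ʳ l) t x ≈ evM' as l t x
  ev-mpV [] l t x = trans (+-congˡ (zeroʳ t)) (+-identityʳ _)
  ev-mpV (a ∷ as) l t x = +-congˡ (*-congˡ (ev-mpV as l t x))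

  ev-mp : ∀ (g : MP i e) t x → evV (mpV g) t x ≈ evM g t x
  ev-mp (as , l) = ev-mpV as l

  evM'-0 : ∀ (as : Vec (NP i) e) l t x → ev l x ≈ 0# → evM' as l t x ≈ evV as t x
  evM'-0 [] l t x z = z
  evM'-0 (a ∷ as) l t x z = +-congˡ (*-congˡ (evM'-0 as l t x z))

  addLow : n ≤ m → Vec (NP i) n → Vec (NP i) m → Vec (NP i) m
  addLow z≤n [] bs = bs
  addLow (s≤s le) (a ∷ as) (b ∷ bs) = add a b ∷ addLow le as bs

  ev-addLow : (le : n ≤ m) (as : Vec (NP i) n) (bs : Vec (NP i) m) → ∀ l t x →
    evM' (addLow le as bs) l t x ≈ evV as t x + evM' bs l t x
  ev-addLow z≤n [] bs l t x = sym (+-identityˡ _)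
  ev-addLow (s≤s le) (a ∷ as) (b ∷ bs) l t x = trans (+-cong (ev-add a b x) (*-congˡ (ev-addLow le as bs l t x)))
    (solve 5 (λ a b t p q → (a :+ b) :+ t :* (p :+ q) := (a :+ t :* p) :+ (b :+ t :* q)) refl
       (ev a x) (ev b x) t (evV as t x) (evM' bs l t x))

  ev-scaleM : ∀ a (bs : Vec (NP i) n) l t x → evM' (scaleV a bs) (mul a l) t x ≈ ev a x * evM' bs l t x
  ev-scaleM a [] l t x = ev-mul a l x
  ev-scaleM a (b ∷ bs) l t x = trans (+-cong (ev-mul a b x) (*-congˡ (ev-scaleM a bs l t x)))
    (solve 4 (λ a b t p → a :* b :+ t :* (a :* p) := a :* (b :+ t :* p)) refl (ev a x) (ev b x) t (evM' bs l t x))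

  mulM' : Vec (NP i) n → NP i → Vec (NP i) m → NP i → Vec (NP i) (n ℕ.+ m)
  mulM' [] l bs k = scaleV l bs
  mulM' {m = m} (a ∷ as) l bs k = addLow (s≤s (ℕₚ.m≤n+m m _)) (scaleV a (bs ∷ʳ k)) (zer ∷ mulM' as l bs k)

  -- Degrees add and the leading coefficient is literally `mul l k`, so its non-vanishing follows
  -- from that of the factors without inspecting coefficients.
  mulM : MP i n → MP i m → MP i (n ℕ.+ m)
  mulM (as , l) (bs , k) = mulM' as l bs k , mul l k

  ev-mulM' : ∀ (as : Vec (NP i) n) l (bs : Vec (NP i) m) k t x →
    evM' (mulM' as l bs k) (mul l k) t x ≈ evM' as l t x * evM' bs k t x
  ev-mulM' [] l bs k t x = ev-scaleM l bs k t x
  ev-mulM' {m = m} (a ∷ as) l bs k t x = begin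
    evM' (addLow (s≤s (ℕₚ.m≤n+m m _)) (scaleV a (bs ∷ʳ k)) (zer ∷ mulM' as l bs k)) (mul l k) t x
      ≈⟨ ev-addLow (s≤s (ℕₚ.m≤n+m m _)) (scaleV a (bs ∷ʳ k)) (zer ∷ mulM' as l bs k) (mul l k) t x ⟩
    evV (scaleV a (bs ∷ʳ k)) t x + (ev zer x + t * evM' (mulM' as l bs k) (mul l k) t x)
      ≈⟨ +-cong (trans (ev-scaleV a (bs ∷ʳ k) t x) (*-congˡ (ev-mpV bs k t x)))
          (trans (+-congʳ (ev-zer x)) (trans (+-identityˡ _) (*-congˡ (ev-mulM' as l bs k t x)))) ⟩
    ev a x * evM' bs k t x + t * (evM' as l t x * evM' bs k t x)
      ≈⟨ solve 4 (λ a b t p → a :* b :+ t :* (p :* b) := (a :+ t :* p) :* b) refl (ev a x) (evM' bs k t x) t (evM' as l t x) ⟩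
    (ev a x + t * evM' as l t x) * evM' bs k t x ∎

  ev-mulM : ∀ (p : MP i n) (q : MP i m) t x → evM (mulM p q) t x ≈ evM p t x * evM q t x
  ev-mulM (as , l) (bs , k) = ev-mulM' as l bs k

  -- Pseudo-division

  subV : NP i → Vec (NP i) n → NP i → Vec (NP i) n → Vec (NP i) n
  subV l [] r [] = []
  subV l (a ∷ as) r (b ∷ bs) = add (mul l a) (neg (mul r b)) ∷ subV l as r bs

  ev-sub1 : ∀ l (a : NP i) r b x → ev (add (mul l a) (neg (mul r b))) x ≈ ev l x * ev a x + - (ev r x * ev b x)
  ev-sub1 l a r b x = trans (ev-add (mul l a) (neg (mul r b)) x)
    (+-cong (ev-mul l a x) (trans (ev-neg (mul r b) x) (-‿cong (ev-mul r b x))))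

  -- Cross-multiplied by the leading coefficients, the two polynomials of degree `n` have the same
  -- top term; `subV` is the difference of the remaining ones.
  cancel-top : ∀ (as : Vec (NP i) n) r (bs : Vec (NP i) n) l t x →
    ev l x * evM' as r t x ≈ ev r x * evM' bs l t x + evV (subV l as r bs) t x
  cancel-top [] r [] l t x = trans (*-comm _ _) (sym (+-identityʳ _))
  cancel-top (a ∷ as) r (b ∷ bs) l t x = begin
    L * (α + t * evM' as r t x)  ≈⟨ solve 4 (λ l a t p → l :* (a :+ t :* p) := l :* a :+ t :* (l :* p)) refl L α t _ ⟩
    L * α + t * (L * evM' as r t x) ≈⟨ +-congˡ (*-congˡ (cancel-top as r bs l t x)) ⟩
    L * α + t * (R * Q + S) ≈⟨ solve 7 (λ l a t r q s b → l :* a :+ t :* (r :* q :+ s) :=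
         r :* (b :+ t :* q) :+ ((l :* a :- r :* b) :+ t :* s)) refl L α t R Q S β ⟩
    R * (β + t * Q) + ((L * α + - (R * β)) + t * S) ≈⟨ +-congˡ (+-congʳ (sym (ev-sub1 l a r b x))) ⟩
    R * (β + t * Q) + (ev (add (mul l a) (neg (mul r b))) x + t * S) ∎
    where L = ev l x
          α = ev a x
          R = ev r x
          β = ev b x
          Q = evM' bs l t x
          S = evV (subV l as r bs) t x

  unsnoc : Vec (NP i) (suc n) → Vec (NP i) n × NP i
  unsnoc (a ∷ []) = [] , a
  unsnoc (a ∷ b ∷ as) with unsnoc (b ∷ as)
  ... | cs , l = a ∷ cs , l

  ev-unsnoc : ∀ (as : Vec (NP i) (suc n)) t x → evM (unsnoc as) t x ≈ evV as t x
  ev-unsnoc (a ∷ []) t x = sym (trans (+-congˡ (zeroʳ t)) (+-identityʳ _))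
  ev-unsnoc (a ∷ b ∷ as) t x = +-congˡ (*-congˡ (ev-unsnoc (b ∷ as) t x))

  -- Coefficients start with the constant term, so the recursion follows Horner's scheme: if
  -- `l^n p = Q g + r`, then `l^n (a + t p)` is a multiple of `g` plus `l^n a + t r`. The latter has
  -- degree at most `e`; removing its top term costs one more factor `l`.
  prem : ∀ n → Vec (NP i) (n ℕ.+ e) → MP i e → Vec (NP i) n × Vec (NP i) e
  premStep : ∀ n → NP i → MP i e → Vec (NP i) n × Vec (NP i) e → Vec (NP i) (suc n) × Vec (NP i) e
  prem zero p g = [] , p
  prem (suc n) (a ∷ p) g = premStep n a g (prem n p g)
  premStep n a g (Q , r) =
    let top = unsnoc (mul (powP (lead g) n) a ∷ r) in
    proj₂ top ∷ scaleV (lead g) Q , subV (lead g) (proj₁ top) (proj₂ top) (proj₁ g)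

  ev-prem : ∀ n (p : Vec (NP i) (n ℕ.+ e)) (g : MP i e) t x →
    ev (lead g) x ^ n * evV p t x ≈ evV (proj₁ (prem n p g)) t x * evM g t x + evV (proj₂ (prem n p g)) t x
  ev-prem zero p g t x = trans (*-identityˡ _) (sym (trans (+-congʳ (zeroˡ _)) (+-identityˡ _)))
  ev-prem (suc n) (a ∷ p) g t x = begin
    (L * L ^ n) * (α + t * P)
      ≈⟨ solve 5 (λ l ln a t p → (l :* ln) :* (a :+ t :* p) := l :* (ln :* a :+ t :* (ln :* p))) refl L (L ^ n) α t P ⟩
    L * (L ^ n * α + t * (L ^ n * P)) ≈⟨ *-congˡ (+-congˡ (*-congˡ (ev-prem n p g t x))) ⟩
    L * (L ^ n * α + t * (Q * G + R))
      ≈⟨ solve 6 (λ l b t q g r → l :* (b :+ t :* (q :* g :+ r)) := t :* (l :* q) :* g :+ l :* (b :+ t :* r)) refl L (L ^ n * α) t Q G R ⟩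
    t * (L * Q) * G + L * (L ^ n * α + t * R)
      ≈⟨ +-congˡ (*-congˡ (+-congʳ (sym (trans (ev-mul (powP (lead g) n) a x) (*-congʳ (ev-powP (lead g) n x)))))) ⟩
    t * (L * Q) * G + L * evV v t x ≈⟨ +-congˡ (*-congˡ (sym (ev-unsnoc v t x))) ⟩
    t * (L * Q) * G + L * evM (unsnoc v) t x ≈⟨ +-congˡ (cancel-top (proj₁ (unsnoc v)) _ (proj₁ g) (proj₂ g) t x) ⟩
    t * (L * Q) * G + (T * G + S) ≈⟨ solve 5 (λ t lq g r s → t :* lq :* g :+ (r :* g :+ s) := (r :+ t :* lq) :* g :+ s)
                                        refl t (L * Q) G T S ⟩
    (T + t * (L * Q)) * G + S ≈⟨ +-congʳ (*-congʳ (+-congˡ (*-congˡ (sym (ev-scaleV (lead g) (proj₁ (prem n p g)) t x))))) ⟩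
    (T + t * evV (scaleV (lead g) (proj₁ (prem n p g))) t x) * G + S ∎
    where
    L = ev (lead g) x
    α = ev a x
    P = evV p t x
    G = evM g t x
    Q = evV (proj₁ (prem n p g)) t x
    R = evV (proj₂ (prem n p g)) t x
    v = mul (powP (lead g) n) a ∷ proj₂ (prem n p g)
    T = ev (proj₂ (unsnoc v)) x
    S = evV (subV (lead g) (proj₁ (unsnoc v)) (proj₂ (unsnoc v)) (proj₁ g)) t x

  infix 3 _⇔_
  _⇔_ : Set a → Set b → Set (a ⊔ b)
  A ⇔ B = (A → B) × (B → A)

  Van : Vec (NP i) n → Carrier → Point i → Set ℓ
  Van as t x = evV as t x ≈ 0#

  VanM : MP i e → Carrier → Point i → Set ℓ
  VanM g t x = evM g t x ≈ 0#

  -- Decomposition into cells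

  -- Euclid's algorithm over polynomials in x, run without deciding equality in K: a node asks
  -- whether a polynomial vanishes at the parameter x.

  data DT (i : ℕ) (A : Set a) : Set (a ⊔ c) where
    ret  : A → DT i A
    test : NP i → DT i A → DT i A → DT i A

  Sound : DT i A → Point i → (A → Set p) → Set (ℓ ⊔ p)
  Sound {p = p} (ret a) x P = Lift ℓ (P a)
  Sound (test f y n) x P = (ev f x ≈ 0# → Sound y x P) × (¬ ev f x ≈ 0# → Sound n x P)

  bind : DT i A → (A → DT i B) → DT i B
  bind (ret a) k = k a
  bind (test f y n) k = test f (bind y k) (bind n k)

  sound-bind : ∀ (d : DT i A) {k : A → DT i B} {x} {P : A → Set p} {Q : B → Set q} →
    Sound d x P → (∀ a → P a → Sound (k a) x Q) → Sound (bind d k) x Q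
  sound-bind (ret a) (lift s) h = h a s
  sound-bind (test f y n) (s , s') h = (λ z → sound-bind y (s z) h) , (λ z → sound-bind n (s' z) h)

  data Stripped (i n : ℕ) : Set c where
    zeroP : Stripped i n
    mp    : ∀ {e} → e < n → MP i e → Stripped i n

  StripSpec : Vec (NP i) n → Point i → Stripped i n → Set (c ⊔ ℓ)
  StripSpec as x zeroP = ∀ t → Van as t x
  StripSpec as x (mp _ g) = ¬ ev (lead g) x ≈ 0# × (∀ t → evM g t x ≈ evV as t x)

  weaken : Stripped i n → Stripped i (suc n)
  weaken zeroP = zeroP
  weaken (mp le g) = mp (ℕₚ.m<n⇒m<1+n le) g

  strip : ∀ n → Vec (NP i) n → DT i (Stripped i n)
  strip zero as = ret zeroP
  strip (suc n) as = test (lead (unsnoc as)) (bind (strip n (proj₁ (unsnoc as))) (ret ∘ weaken))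
                          (ret (mp ℕₚ.≤-refl (unsnoc as)))

  strip-sound : ∀ n (as : Vec (NP i) n) x → Sound (strip n as) x (StripSpec as x)
  strip-sound zero [] x = lift λ t → refl
  strip-sound (suc n) as x =
    (λ z → sound-bind (strip n bs) (strip-sound n bs x) λ
       { zeroP s → lift λ t → trans (same z t) (s t)
       ; (mp le g) (nz , s) → lift (nz , λ t → trans (s t) (sym (same z t))) })
    , λ z → lift (z , λ t → ev-unsnoc as t x)
    where
    bs = proj₁ (unsnoc as)
    same : ev (lead (unsnoc as)) x ≈ 0# → ∀ t → evV as t x ≈ evV bs t x
    same z t = trans (sym (ev-unsnoc as t x)) (evM'-0 bs _ t x z)

  padR : ∀ e → Vec (NP i) n → Vec (NP i) (n ℕ.+ e)
  padR e as = as Vec.++ Vec.replicate e zer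

  ev-padR : ∀ e (as : Vec (NP i) n) t x → evV (padR e as) t x ≈ evV as t x
  ev-padR e [] t x = evV-zeros e t x
  ev-padR e (a ∷ as) t x = +-congˡ (*-congˡ (ev-padR e as t x))

  GcdOf : ℕ → ℕ → Set c
  GcdOf i e = ∃ λ e' → e' ≤ e × MP i e'

  -- The gcd is characterised by its zeros instead of by divisibility. Fibres are described as point
  -- sets, and zero sets are preserved by pseudo-division with invertible leading coefficient.
  GcdSpec : MP i e → Vec (NP i) n → Point i → GcdOf i e → Set (c ⊔ ℓ)
  GcdSpec g as x (_ , _ , h) = ¬ ev (lead h) x ≈ 0# × (∀ t → VanM h t x ⇔ (VanM g t x × Van as t x))

  enlarge : e ≤ m → GcdOf i e → GcdOf i m
  enlarge le (_ , le′ , h) = _ , ℕₚ.≤-trans le′ le , h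

  euclid : ∀ f → e < f → MP i e → Vec (NP i) n → DT i (GcdOf i e)
  euclid′ : ∀ f → e ≤ f → MP i e → Stripped i e → DT i (GcdOf i e)
  euclid {e} {n = n} (suc f) (s≤s le) g as = bind (strip e (proj₂ (prem n (padR e as) g))) (euclid′ f le g)
  euclid′ f le g zeroP = ret (_ , ℕₚ.≤-refl , g)
  euclid′ f le g (mp lt h) = bind (euclid f (ℕₚ.<-≤-trans lt le) h (mpV g)) (ret ∘ enlarge (ℕₚ.<⇒≤ lt))

  euclid-sound : ∀ f (lt : e < f) (g : MP i e) (as : Vec (NP i) n) x → ¬ ev (lead g) x ≈ 0# →
    Sound (euclid f lt g as) x (GcdSpec g as x)
  euclid-sound {e} {n = n} (suc f) (s≤s le) g as x ng =
    sound-bind (strip e r) (strip-sound e r x) λ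
      { zeroP s → lift (ng , λ t → (λ z → z , back t z (s t)) , proj₁)
      ; (mp {e'} lt h) (nh , s) → sound-bind (euclid f _ h (mpV g)) (euclid-sound f _ h (mpV g) x nh) λ
          { (e'' , le' , k) (nk , w) → lift (nk , λ t →
               (λ z → let (zh , zg) = proj₁ (w t) z
                          zg' = trans (sym (ev-mp g t x)) zg in
                      zg' , back t zg' (trans (sym (s t)) zh))
             , (λ { (zg , za) → proj₂ (w t) (trans (s t) (forth t zg za) , trans (ev-mp g t x) zg) })) } }
    where
    Qr = prem n (padR e as) g
    r = proj₂ Qr
    eq : ∀ t → ev (lead g) x ^ n * evV as t x ≈ evV (proj₁ Qr) t x * evM g t x + evV r t x
    eq t = trans (*-congˡ (sym (ev-padR e as t x))) (ev-prem n (padR e as) g t x)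
    back : ∀ t → VanM g t x → Van r t x → Van as t x
    back t zg zr = cancel≉ (^-≉0 n ng) (trans (eq t) (0+0≈0 (x*0≈0 zg) zr))
    forth : ∀ t → VanM g t x → Van as t x → Van r t x
    forth t zg za = trans (sym (trans (+-congʳ (x*0≈0 zg)) (+-identityˡ _))) (trans (sym (eq t)) (x*0≈0 za))

  Sound-map : ∀ (d : DT i A) {x} {P : A → Set p} {Q : A → Set q} → Sound d x P → (∀ a → P a → Q a) → Sound d x Q
  Sound-map (ret a) (lift s) h = lift (h a s)
  Sound-map (test f y n) (s , s') h = (λ z → Sound-map y (s z) h) , (λ z → Sound-map n (s' z) h)

  gcd : MP i e → Vec (NP i) n → DT i (GcdOf i e)
  gcd g as = euclid _ ℕₚ.≤-refl g as

  gcd-sound : (g : MP i e) (as : Vec (NP i) n) → ∀ x → ¬ ev (lead g) x ≈ 0# → Sound (gcd g as) x (GcdSpec g as x)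
  gcd-sound g as x = euclid-sound _ ℕₚ.≤-refl g as x

  data Gcd (i : ℕ) : Set c where
    zeroG : Gcd i
    gcdG  : MP i e → Gcd i

  AllVan : List (NP (suc i)) → Carrier → Point i → Set (c ⊔ ℓ)
  AllVan E t x = All (λ p → ev p (t ∷ x) ≈ 0#) E

  GcdAllSpec : List (NP (suc i)) → Point i → Gcd i → Set (c ⊔ ℓ)
  GcdAllSpec E x zeroG = ∀ t → AllVan E t x
  GcdAllSpec E x (gcdG g) = ¬ ev (lead g) x ≈ 0# × (∀ t → VanM g t x ⇔ AllVan E t x)

  fromStrip : Stripped i n → Gcd i
  fromStrip zeroP = zeroG
  fromStrip (mp _ g) = gcdG g

  gcdAll : List (NP (suc i)) → DT i (Gcd i)
  gcdStep : Vec (NP i) n → Gcd i → DT i (Gcd i)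
  gcdAll [] = ret zeroG
  gcdAll (poly as ∷ E) = bind (gcdAll E) (gcdStep as)
  gcdStep as zeroG = bind (strip _ as) (ret ∘ fromStrip)
  gcdStep as (gcdG g) = bind (gcd g as) (λ (_ , _ , h) → ret (gcdG h))

  gcdAll-sound : ∀ (E : List (NP (suc i))) x → Sound (gcdAll E) x (GcdAllSpec E x)
  gcdAll-sound [] x = lift λ t → []
  gcdAll-sound (poly as ∷ E) x = sound-bind (gcdAll E) (gcdAll-sound E x) λ
    { zeroG s → sound-bind (strip _ as) (strip-sound _ as x) λ
        { zeroP s' → lift λ t → s' t ∷ s t
        ; (mp _ g) (ng , w) → lift (ng , λ t → (λ z → trans (sym (w t)) z ∷ s t) , (λ { (z ∷ _) → trans (w t) z })) }
    ; (gcdG g) (ng , w) → sound-bind (gcd g as) (gcd-sound g as x ng) λ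
        { (_ , _ , h) (nh , w') → lift (nh , λ t → (λ z → let (zg , za) = proj₁ (w' t) z in za ∷ proj₁ (w t) zg)
                                              , (λ { (za ∷ zE) → proj₂ (w' t) (proj₂ (w t) zE , za) })) } }

  -- The constructible subsets of a line: empty, cofinite or finite. For a finite one the inequation
  -- has been absorbed into `g`, and the degree `suc e` guarantees a root.
  data Fibre (i : ℕ) : Set c where
    none : Fibre i
    free : MP i e → Fibre i
    alg  : MP i (suc e) → Fibre i

  InFibre : Fibre i → Carrier → Point i → Set ℓ
  InFibre none t x = ⊥ₚ
  InFibre (free g) t x = ¬ VanM g t x
  InFibre (alg g) t x = VanM g t x

  FibreOK : Fibre i → Point i → Set ℓ
  FibreOK none x = ⊤
  FibreOK (free g) x = ¬ ev (lead g) x ≈ 0#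
  FibreOK (alg g) x = ¬ ev (lead g) x ≈ 0#

  FibreSpec : (Carrier → Set p) → Point i → Fibre i → Set (c ⊔ p ⊔ ℓ)
  FibreSpec S x f = FibreOK f x × (∀ t → InFibre f t x ⇔ S t)

  freeF : Stripped i n → Fibre i
  freeF zeroP = none
  freeF (mp _ g) = free g

  avoid : Vec (NP i) n → DT i (Fibre i)
  avoid as = bind (strip _ as) (ret ∘ freeF)

  avoid-sound : ∀ (as : Vec (NP i) n) x → Sound (avoid as) x (FibreSpec (λ t → ¬ Van as t x) x)
  avoid-sound as x = sound-bind (strip _ as) (strip-sound _ as x) λ
    { zeroP s → lift (tt , λ t → (λ ()) , (λ n → ⊥-elim (n (s t))))
    ; (mp _ g) (ng , w) → lift (ng , λ t → (λ n z → n (trans (w t) z)) , (λ n z → n (trans (sym (w t)) z))) }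

  castV : n ≡ m → Vec (NP i) n → Vec (NP i) m
  castV ≡.refl as = as

  ev-castV : (eq : n ≡ m) (as : Vec (NP i) n) → ∀ t x → evV (castV eq as) t x ≈ evV as t x
  ev-castV ≡.refl as t x = refl

  divide-length : ∀ {h} → h ≤ e → suc (suc e) ≡ (suc e ℕ.∸ h) ℕ.+ suc h
  divide-length {e} {h} le = ≡.sym (≡.trans (ℕₚ.+-suc _ h) (≡.cong suc (ℕₚ.m∸n+n≡m (ℕₚ.m≤n⇒m≤1+n le))))

  -- {g = 0, q ≠ 0} for g with invertible leading coefficient: divide g by its gcd h with q
  -- until the gcd is constant.  The division of g by h leaves no remainder when h is the gcd;
  -- should it leave one, that remainder yields a gcd of smaller degree.
  saturate : ∀ f → e < f → MP i e → Vec (NP i) n → DT i (Fibre i)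
  reduce : ∀ f f′ → suc e ≤ f → MP i (suc e) → Vec (NP i) n → (k : GcdOf i (suc e)) → proj₁ k < f′ → DT i (Fibre i)
  quotient : ∀ f → m ≤ f → Vec (NP i) n → Stripped i m → DT i (Fibre i)
  remainder : ∀ {h} f f′ → suc e ≤ f → h < f′ → h ≤ e → MP i (suc e) → MP i (suc h) → Vec (NP i) n →
    Vec (NP i) (suc e ℕ.∸ h) × Vec (NP i) (suc h) → Stripped i (suc h) → DT i (Fibre i)
  divide : ∀ {h} → h ≤ e → MP i (suc e) → MP i (suc h) → Vec (NP i) (suc e ℕ.∸ h) × Vec (NP i) (suc h)

  divide {e = e} {h = h} le g k = prem (suc e ℕ.∸ h) (castV (divide-length le) (mpV g)) k

  saturate {zero} (suc f) lt g as = ret none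
  saturate {suc e} (suc f) (s≤s lt) g as = bind (gcd g as) λ k → reduce f _ lt g as k ℕₚ.≤-refl
  reduce f f′ le g as (zero , _ , k) lt′ = ret (alg g)
  reduce f (suc f′) le g as (suc h , s≤s le′ , k) (s≤s lt′) =
    bind (strip _ (proj₂ (divide le′ g k))) (remainder f f′ le lt′ le′ g k as (divide le′ g k))
  remainder {e = e} {h = h} f f′ le lt′ le′ g k as (Q , _) zeroP =
    bind (strip _ Q) (quotient f (ℕₚ.≤-trans (ℕₚ.m∸n≤m (suc e) h) le) as)
  remainder f f′ le lt′ le′ g k as _ (mp (s≤s l) s) = bind (gcd s (mpV k)) λ (h″ , le″ , k″) →
    reduce f f′ le g as (h″ , ℕₚ.≤-trans le″ (ℕₚ.≤-trans l (ℕₚ.m≤n⇒m≤1+n le′)) , k″) (ℕₚ.≤-<-trans (ℕₚ.≤-trans le″ l) lt′)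
  quotient f le as zeroP = avoid as
  quotient f le as (mp lt g) = saturate f (ℕₚ.<-≤-trans lt le) g as

  SatSpec : (Carrier → Set ℓ) → Vec (NP i) n → Point i → Fibre i → Set (c ⊔ ℓ)
  SatSpec Z as x = FibreSpec (λ t → Z t × ¬ Van as t x) x

  divide-eq : ∀ {h} (le : h ≤ e) (g : MP i (suc e)) (k : MP i (suc h)) x t →
    ev (lead k) x ^ (suc e ℕ.∸ h) * evM g t x ≈ evV (proj₁ (divide le g k)) t x * evM k t x + evV (proj₂ (divide le g k)) t x
  divide-eq {e = e} {h = h} le g k x t =
    trans (*-congˡ (sym (trans (ev-castV (divide-length le) (mpV g) t x) (ev-mp g t x))))
      (ev-prem (suc e ℕ.∸ h) (castV (divide-length le) (mpV g)) k t x)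

  FibreSpec-resp : ∀ {S : Carrier → Set p} {T : Carrier → Set q} (f : Fibre i) {x} → (∀ t → S t ⇔ T t) → FibreSpec S x f → FibreSpec T x f
  FibreSpec-resp f e (ok , w) = ok , λ t → proj₁ (e t) ∘ proj₁ (w t) , proj₂ (w t) ∘ proj₂ (e t)

  saturate-sound : ∀ f (lt : e < f) (g : MP i e) (as : Vec (NP i) n) x → ¬ ev (lead g) x ≈ 0# →
    Sound (saturate f lt g as) x (SatSpec (λ t → VanM g t x) as x)
  reduce-sound : ∀ f f′ (le : suc e ≤ f) (g : MP i (suc e)) (as : Vec (NP i) n) (k : GcdOf i (suc e)) (lt : proj₁ k < f′) x →
    ¬ ev (lead g) x ≈ 0# → GcdSpec g as x k →
    Sound (reduce f f′ le g as k lt) x (SatSpec (λ t → VanM g t x) as x)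
  quotient-sound : ∀ f (le : m ≤ f) (as : Vec (NP i) n) x {Q : Vec (NP i) m} (s : Stripped i m) → StripSpec Q x s →
    Sound (quotient f le as s) x (SatSpec (λ t → Van Q t x) as x)

  saturate-sound {zero} (suc f) lt ([] , l) as x ng = lift (tt , λ t → (λ ()) , λ (z , _) → ⊥-elim (ng z))
  saturate-sound {suc e} (suc f) (s≤s lt) g as x ng = sound-bind (gcd g as) (gcd-sound g as x ng) λ
    k s → reduce-sound f _ lt g as k ℕₚ.≤-refl x ng s
  -- A constant gcd means that `g` and `as` have no common zero: the inequation holds at every root
  -- of `g`.
  reduce-sound f f′ le g as (zero , _ , ([] , l)) lt x ng (nk , w) =
    lift (ng , λ t → (λ z → z , λ za → nk (proj₂ (w t) (z , za))) , proj₁)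
  reduce-sound {e = e} f (suc f′) le g as (suc h , s≤s le′ , k) (s≤s lt) x ng (nk , w) =
    sound-bind (strip _ r) (strip-sound _ r x) λ
      { zeroP s → sound-bind (strip _ Q) (strip-sound _ Q x) λ st sp →
          Sound-map (quotient f _ as st) (quotient-sound f _ as x st sp) λ fib → FibreSpec-resp fib λ t →
            (λ (zQ , na) → cancel≉ (^-≉0 (suc e ℕ.∸ h) nk) (trans (divide-eq le′ g k x t) (0+0≈0 (0*x≈0 zQ) (s t))) , na)
          -- Where `as` does not vanish, neither does the gcd `k`, so a zero of `g` is a zero of the
          -- quotient.
          , (λ (zg , na) → cancel≉ (λ zk → na (proj₂ (proj₁ (w t) zk)))
               (trans (*-comm _ _) (trans (sym (trans (+-congˡ (s t)) (+-identityʳ _)))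
                  (trans (sym (divide-eq le′ g k x t)) (x*0≈0 zg)))) , na)
      ; (mp (s≤s l) s) (ns , v) → sound-bind (gcd s (mpV k)) (gcd-sound s (mpV k) x ns) λ
          { (h″ , le″ , k″) (nk″ , w″) → reduce-sound f f′ le g as (h″ , _ , k″) _ x ng (nk″ , λ t →
              (λ z → proj₁ (w t) (trans (sym (ev-mp k t x)) (proj₂ (proj₁ (w″ t) z))))
            , (λ z → let zk = proj₂ (w t) z in proj₂ (w″ t) (trans (v t)
                 (trans (sym (trans (+-congʳ (x*0≈0 zk)) (+-identityˡ _))) (trans (sym (divide-eq le′ g k x t)) (x*0≈0 (proj₁ z))))
                 , trans (ev-mp k t x) zk))) } }
    where
    Q = proj₁ (divide le′ g k)
    r = proj₂ (divide le′ g k)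
  quotient-sound f le as x zeroP s = Sound-map (avoid as) (avoid-sound as x) λ fib → FibreSpec-resp fib λ t →
    (λ na → s t , na) , proj₂
  quotient-sound f le as x (mp lt g) (ng , v) = Sound-map (saturate f _ g as) (saturate-sound f _ g as x ng) λ fib →
    FibreSpec-resp fib λ t → (λ (z , na) → trans (sym (v t)) z , na) , (λ (z , na) → trans (v t) z , na)

  fibre : List (NP (suc i)) → NP (suc i) → DT i (Fibre i)
  fibre′ : Vec (NP i) n → Gcd i → DT i (Fibre i)
  fibre E (poly as) = bind (gcdAll E) (fibre′ as)
  fibre′ as zeroG = avoid as
  fibre′ as (gcdG g) = saturate _ ℕₚ.≤-refl g as

  Holds : List (NP i) → NP i → Point i → Set (c ⊔ ℓ)
  Holds E q x = All (λ p → ev p x ≈ 0#) E × ¬ ev q x ≈ 0#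

  fibre-sound : ∀ (E : List (NP (suc i))) q x → Sound (fibre E q) x (FibreSpec (λ t → Holds E q (t ∷ x)) x)
  fibre-sound E (poly as) x = sound-bind (gcdAll E) (gcdAll-sound E x) λ
    { zeroG s → Sound-map (avoid as) (avoid-sound as x) λ fib → FibreSpec-resp fib λ t → (λ na → s t , na) , proj₂
    ; (gcdG g) (ng , w) → Sound-map (saturate _ _ g as) (saturate-sound _ ℕₚ.≤-refl g as x ng) λ fib →
        FibreSpec-resp fib λ t → (λ (z , na) → proj₁ (w t) z , na) , (λ (z , na) → proj₂ (w t) z , na) }

  Leaf : ℕ → Set a → Set (a ⊔ c)
  Leaf i A = (List (NP i) × NP i) × A

  -- A leaf carries the conditions of its path. Multiplying the inequations into a single one keeps
  -- them in the form `Holds`, to which the decomposition applies again.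
  leaves : DT i A → List (NP i) → NP i → List (Leaf i A)
  leaves (ret a) E q = ((E , q) , a) ∷ []
  leaves (test f y n) E q = leaves y (f ∷ E) q L.++ leaves n E (mul f q)

  LeafSpec : Point i → (A → Set p) → Leaf i A → Set (c ⊔ ℓ ⊔ p)
  LeafSpec x P ((E , q) , a) = Holds E q x → P a

  leaves-sound : ∀ (d : DT i A) E q {x} {P : A → Set p} → (Holds E q x → Sound d x P) → All (LeafSpec x P) (leaves d E q)
  leaves-sound (ret a) E q s = (λ h → Level.lower (s h)) ∷ []
  leaves-sound (test f y n) E q {x} s = Allₚ.++⁺
    (leaves-sound y (f ∷ E) q λ { (z ∷ zs , nq) → proj₁ (s (zs , nq)) z })
    (leaves-sound n E (mul f q) λ { (zs , nq) → let nfq = ≉-resp (ev-mul f q x) nq in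
       proj₂ (s (zs , ≉0-*ʳ nfq)) (≉0-*ˡ nfq) })

  HoldsAt : Point i → Leaf i A → Set (c ⊔ ℓ)
  HoldsAt x ((E , q) , _) = Holds E q x

  leaves-complete : ∀ (d : DT i A) E q {x} → Holds E q x → ¬ ¬ Any (HoldsAt x) (leaves d E q)
  leaves-complete (ret a) E q h = return (here h)
  leaves-complete (test f y n) E q {x} (zs , nq) = do
    inj₂ nf ← em (ev f x ≈ 0#)
      where inj₁ z → do
              r ← leaves-complete y (f ∷ E) q (z ∷ zs , nq)
              return (Anyₚ.++⁺ˡ r)
    r ← leaves-complete n E (mul f q) (zs , ≉-resp (sym (ev-mul f q x)) (*≉0 nf nq))
    return (Anyₚ.++⁺ʳ (leaves y (f ∷ E) q) r)

  -- Towers and cells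

  data Tower : ℕ → Set c where
    base  : List (NP 0) → NP 0 → Tower 0
    _▹≠_ : Tower i → MP i e → Tower (suc i)
    _▹≈_ : Tower i → MP i (suc e) → Tower (suc i)

  infixl 5 _▹≠_ _▹≈_

  pts : Tower i → Point i → Set (c ⊔ ℓ)
  pts (base E q) x = Holds E q x
  pts (τ ▹≠ g) (t ∷ x) = pts τ x × ¬ VanM g t x
  pts (τ ▹≈ g) (t ∷ x) = pts τ x × VanM g t x

  -- Non-vanishing leading coefficients keep the degree constant along the fibres; over an
  -- algebraically closed field no fibre over a point of `τ` is then empty.
  Regular : Tower i → Set (c ⊔ ℓ)
  Regular (base E q) = ⊤
  Regular (τ ▹≠ g) = Regular τ × (∀ x → pts τ x → ¬ ev (lead g) x ≈ 0#)
  Regular (τ ▹≈ g) = Regular τ × (∀ x → pts τ x → ¬ ev (lead g) x ≈ 0#)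

  dim : Tower i → ℕ
  dim (base E q) = 0
  dim (τ ▹≠ g) = suc (dim τ)
  dim (τ ▹≈ g) = dim τ

  extend : Fibre i → List (Tower i) → List (Tower (suc i))
  extend none τs = []
  extend (free g) τs = L.map (_▹≠ g) τs
  extend (alg {e = e} g) τs = L.map (_▹≈ g) τs

  -- Elimination of the main variable: the leaves of the decision tree divide the parameter space
  -- into systems in one variable less, over each of which the fibre has a uniform description.
  cells : ∀ i → List (NP i) → NP i → List (Tower i)
  extendLeaf : Leaf i (Fibre i) → List (Tower (suc i))
  cells zero E q = base E q ∷ []
  cells (suc i) E q = L.concatMap extendLeaf (leaves (fibre E q) [] (cst 1#))
  extendLeaf ((E , q) , f) = extend f (cells _ E q)

  Cell : List (NP i) → NP i → Tower i → Set (c ⊔ ℓ)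
  Cell E q τ = Regular τ × (∀ x → pts τ x → Holds E q x)

  cells-sound : ∀ i (E : List (NP i)) q → All (Cell E q) (cells i E q)
  extend-sound : ∀ {E : List (NP (suc i))} {q} (l : Leaf i (Fibre i)) →
    (∀ x → LeafSpec x (FibreSpec (λ t → Holds E q (t ∷ x)) x) l) → All (Cell E q) (extendLeaf l)
  cells-sound zero E q = (tt , λ x h → h) ∷ []
  cells-sound (suc i) E q = Allₚ.concat⁺ (Allₚ.map⁺ (All.map (λ {l} → extend-sound {q = q} l) swap))
    where
    swap : All (λ l → ∀ x → LeafSpec x (FibreSpec (λ t → Holds E q (t ∷ x)) x) l) (leaves (fibre E q) [] (cst 1#))
    swap = All.tabulate λ {l} l∈ x → All.lookup (leaves-sound (fibre E q) [] (cst 1#) λ _ → fibre-sound E q x) l∈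
  extend-sound ((E′ , q′) , none) s = []
  extend-sound ((E′ , q′) , free g) s = Allₚ.map⁺ (All.map (λ (reg , h) →
    (reg , λ x p → proj₁ (s x (h x p))) , λ { (t ∷ x) (p , v) → proj₁ (proj₂ (s x (h x p)) t) v }) (cells-sound _ E′ q′))
  extend-sound ((E′ , q′) , alg g) s = Allₚ.map⁺ (All.map (λ (reg , h) →
    (reg , λ x p → proj₁ (s x (h x p))) , λ { (t ∷ x) (p , v) → proj₁ (proj₂ (s x (h x p)) t) v }) (cells-sound _ E′ q′))

  cells-complete : ∀ i (E : List (NP i)) q x → Holds E q x → ¬ ¬ Any (λ τ → pts τ x) (cells i E q)
  extend-complete : ∀ (l : Leaf i (Fibre i)) t x → HoldsAt x l → InFibre (proj₂ l) t x →
    ¬ ¬ Any (λ τ → pts τ (t ∷ x)) (extendLeaf l)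
  cells-complete zero E q x h = return (here h)
  cells-complete (suc i) E q (t ∷ x) h = do
    l∈ ← leaves-complete (fibre E q) [] (cst 1#) {x} ([] , ≉-resp (sym (ev-cst 1# x)) 1≉0)
    r ← inLeaf l∈ (leaves-sound (fibre E q) [] (cst 1#) λ _ → fibre-sound E q x)
    return (Anyₚ.concat⁺ (Anyₚ.map⁺ r))
    where
    inLeaf : ∀ {ls} → Any (HoldsAt x) ls → All (LeafSpec x (FibreSpec (λ t → Holds E q (t ∷ x)) x)) ls →
      ¬ ¬ Any (λ l → Any (λ τ → pts τ (t ∷ x)) (extendLeaf l)) ls
    inLeaf {l ∷ ls} (here hl) (s ∷ _) = do
      r ← extend-complete l t x hl (proj₂ (proj₂ (s hl) t) h)
      return (here r)
    inLeaf (there l∈) (_ ∷ ss) = do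
      r ← inLeaf l∈ ss
      return (there r)
  extend-complete (_ , none) t x hl ()
  extend-complete ((E′ , q′) , free g) t x hl v = do
    r ← cells-complete _ E′ q′ x hl
    return (Anyₚ.map⁺ (Any.map (λ p → p , v) r))
  extend-complete ((E′ , q′) , alg g) t x hl v = do
    r ← cells-complete _ E′ q′ x hl
    return (Anyₚ.map⁺ (Any.map (λ p → p , v) r))

  -- Roots and non-roots

  coeffs : MP i e → Point i → Vec Carrier (suc e)
  coeffs ([] , l) x = ev l x ∷ []
  coeffs (a ∷ as , l) x = ev a x ∷ coeffs (as , l) x

  lastV-coeffs : (g : MP i e) (x : Point i) → lastV K (coeffs g x) ≡ ev (lead g) x
  lastV-coeffs ([] , l) x = ≡.refl
  lastV-coeffs (a ∷ [] , l) x = ≡.refl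
  lastV-coeffs (a ∷ b ∷ as , l) x = lastV-coeffs (b ∷ as , l) x

  evalUni-coeffs : (g : MP i e) → ∀ t x → evalUni K (coeffs g x) t ≈ evM g t x
  evalUni-coeffs ([] , l) t x = trans (+-congˡ (zeroʳ t)) (+-identityʳ _)
  evalUni-coeffs (a ∷ as , l) t x = +-congˡ (*-congˡ (evalUni-coeffs (as , l) t x))

  root : (g : MP i (suc e)) (x : Point i) → ¬ ev (lead g) x ≈ 0# → ∃ λ t → VanM g t x
  root {e = e} g x ng with ac e (coeffs g x) (λ z → ng (trans (reflexive (≡.sym (lastV-coeffs g x))) z))
  ... | t , z = t , trans (sym (evalUni-coeffs g t x)) z

  shift1 : MP i (suc e) → MP i (suc e)
  shift1 (a ∷ as , l) = add a (cst (- 1#)) ∷ as , l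

  ev-shift1 : ∀ (g : MP i (suc e)) t x → evM (shift1 g) t x ≈ evM g t x + - 1#
  ev-shift1 (a ∷ as , l) t x = trans (+-congʳ (trans (ev-add a _ x) (+-congˡ (ev-cst _ x))))
    (trans (+-assoc _ _ _) (trans (+-congˡ (+-comm _ _)) (sym (+-assoc _ _ _))))

  lead-shift1 : (g : MP i (suc e)) → lead (shift1 g) ≡ lead g
  lead-shift1 (a ∷ as , l) = ≡.refl

  -- Candidates cannot be tested for being roots; but a root of `g - 1` is a point where `g` takes
  -- the value 1.
  nonroot : (g : MP i e) (x : Point i) → ¬ ev (lead g) x ≈ 0# → ∃ λ t → ¬ VanM g t x
  nonroot {e = zero} ([] , l) x ng = 0# , ng
  nonroot {e = suc e} g x ng =
    let (t , z) = root (shift1 g) x (≡.subst (λ l → ¬ ev l x ≈ 0#) (≡.sym (lead-shift1 g)) ng)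
    in t , λ v → 1≉0 (trans (sym (x-y≈0 (trans (sym (ev-shift1 g t x)) z))) v)

  -- Counts coefficients in each variable separately: the degree in every variable is less than `N`.
  -- Such bounds add up under `mul`.
  Bd  : ℕ → NP i → Set
  BdV : ℕ → Vec (NP i) n → Set
  Bd N (con₀ a) = ⊤
  Bd N (poly {n = n} as) = n ≤ N × BdV N as
  BdV N [] = ⊤
  BdV N (a ∷ as) = Bd N a × BdV N as

  BdM : ℕ → MP i e → Set
  BdM N (as , l) = BdV N as × Bd N l

  Bd-mono  : N ≤ M → (p : NP i) → Bd N p → Bd M p
  BdV-mono : N ≤ M → (as : Vec (NP i) n) → BdV N as → BdV M as
  Bd-mono le (con₀ a) b = tt
  Bd-mono le (poly as) (l , b) = ℕₚ.≤-trans l le , BdV-mono le as b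
  BdV-mono le [] b = tt
  BdV-mono le (a ∷ as) (b , bs) = Bd-mono le a b , BdV-mono le as bs

  bound  : NP i → ℕ
  boundV : Vec (NP i) n → ℕ
  bound (con₀ a) = 0
  bound (poly {n = n} as) = n ℕ.⊔ boundV as
  boundV [] = 0
  boundV (a ∷ as) = bound a ℕ.⊔ boundV as

  Bd-bound  : (p : NP i) → Bd (bound p) p
  BdV-bound : (as : Vec (NP i) n) → BdV (boundV as) as
  Bd-bound (con₀ a) = tt
  Bd-bound (poly {n = n} as) = ℕₚ.m≤m⊔n n _ , BdV-mono (ℕₚ.m≤n⊔m n _) as (BdV-bound as)
  BdV-bound [] = tt
  BdV-bound (a ∷ as) = Bd-mono (ℕₚ.m≤m⊔n (bound a) _) a (Bd-bound a) , BdV-mono (ℕₚ.m≤n⊔m (bound a) _) as (BdV-bound as)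

  Bd-zer : Bd {i} N zer
  Bd-zer {zero} = tt
  Bd-zer {suc i} = z≤n , tt

  Bd-cst : ∀ a → 1 ≤ N → Bd {i} N (cst a)
  Bd-cst {i = zero} a le = tt
  Bd-cst {i = suc i} a le = le , Bd-cst a le , tt

  Bd-add  : (p q : NP i) → Bd N p → Bd N q → Bd N (add p q)
  BdV-add : (as : Vec (NP i) n) (bs : Vec (NP i) m) → BdV N as → BdV N bs → BdV N (addV as bs)
  Bd-add (con₀ a) (con₀ b) _ _ = tt
  Bd-add (poly as) (poly bs) (l , b) (l′ , b′) = ℕₚ.⊔-lub l l′ , BdV-add as bs b b′
  BdV-add [] bs b b′ = b′
  BdV-add (a ∷ as) [] b b′ = b
  BdV-add (a ∷ as) (b ∷ bs) (x , xs) (y , ys) = Bd-add a b x y , BdV-add as bs xs ys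

  -- In the recursion of `mulP` the length in the main variable shrinks with the vector while the
  -- bound for the coefficients stays, so the two are tracked apart.
  Bd₂ : ℕ → ℕ → NP (suc i) → Set
  Bd₂ L N (poly {n = n} as) = n ≤ L × BdV N as

  Bd₂-add : ∀ {L} (p q : NP (suc i)) → Bd₂ L N p → Bd₂ L N q → Bd₂ L N (add p q)
  Bd₂-add (poly as) (poly bs) (l , b) (l′ , b′) = ℕₚ.⊔-lub l l′ , BdV-add as bs b b′

  Bd₂-shift : ∀ {L} (p : NP (suc i)) → Bd₂ L N p → Bd₂ (suc L) N (shift p)
  Bd₂-shift (poly as) (l , b) = s≤s l , Bd-zer , b

  Bd-mul    : (p q : NP i) → Bd N p → Bd M q → Bd (N ℕ.+ M) (mul p q)
  BdV-scale : (a : NP i) (bs : Vec (NP i) n) → Bd N a → BdV M bs → BdV (N ℕ.+ M) (scaleV a bs)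
  Bd₂-mulP  : (as : Vec (NP i) n) (bs : Vec (NP i) m) → BdV N as → BdV M bs → Bd₂ (n ℕ.+ m) (N ℕ.+ M) (mulP as (poly bs))
  Bd-mul (con₀ a) (con₀ b) _ _ = tt
  Bd-mul (poly as) (poly bs) (l , b) (l′ , b′) with mulP as (poly bs) | Bd₂-mulP as bs b b′
  ... | poly cs | l″ , b″ = ℕₚ.≤-trans l″ (ℕₚ.+-mono-≤ l l′) , b″
  BdV-scale a [] b b′ = tt
  BdV-scale a (x ∷ bs) b (b′ , bs′) = Bd-mul a x b b′ , BdV-scale a bs b bs′
  Bd₂-mulP [] bs b b′ = z≤n , tt
  Bd₂-mulP {n = suc n} {m = m} (a ∷ as) bs (b , bs′) b′ = Bd₂-add (poly (scaleV a bs)) (shift (mulP as (poly bs)))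
    (ℕₚ.≤-trans (ℕₚ.m≤n+m m n) (ℕₚ.n≤1+n _) , BdV-scale a bs b b′)
    (Bd₂-shift (mulP as (poly bs)) (Bd₂-mulP as bs bs′ b′))

  Bd-powP : (p : NP i) → 1 ≤ N → Bd N p → ∀ n → Bd (suc n ℕ.* N) (powP p n)
  Bd-powP p le b zero = Bd-cst 1# (ℕₚ.≤-trans le (ℕₚ.m≤m+n _ 0))
  Bd-powP p le b (suc n) = Bd-mul p (powP p n) b (Bd-powP p le b n)

  Bd-neg : (p : NP i) → Bd N p → Bd (suc N) (neg p)
  Bd-neg p b = Bd-mul (cst (- 1#)) p (Bd-cst (- 1#) ℕₚ.≤-refl) b

  BdV-sub : ∀ l (as : Vec (NP i) n) r bs → Bd N l → BdV M as → Bd M r → BdV N bs → BdV (suc (N ℕ.+ M)) (subV l as r bs)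
  BdV-sub l [] r [] _ _ _ _ = tt
  BdV-sub {N = N} {M} l (a ∷ as) r (b ∷ bs) bl (ba , bas) br (bb , bbs) =
    Bd-add (mul l a) (neg (mul r b)) (Bd-mono (ℕₚ.n≤1+n _) (mul l a) (Bd-mul l a bl ba))
      (Bd-neg (mul r b) (≡.subst (λ z → Bd z (mul r b)) (ℕₚ.+-comm M N) (Bd-mul r b br bb)))
    , BdV-sub l as r bs bl bas br bbs

  BdM-unsnoc : (as : Vec (NP i) (suc n)) → BdV N as → BdM N (unsnoc as)
  BdM-unsnoc (a ∷ []) (b , _) = tt , b
  BdM-unsnoc (a ∷ a′ ∷ as) (b , bs) with unsnoc (a′ ∷ as) | BdM-unsnoc (a′ ∷ as) bs
  ... | cs , l | bcs , bl = (b , bcs) , bl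

  -- Linearity in N is what keeps the exponent of N in the final count equal to the dimension.
  premBd : ℕ → ℕ → ℕ → ℕ
  premBd B N n = N ℕ.+ suc n ℕ.* (2 ℕ.+ B)

  Bd-prem : ∀ n (p : Vec (NP i) (n ℕ.+ e)) (g : MP i e) {B} → BdV N p → BdM B g →
    BdV (premBd B N n) (proj₂ (prem n p g))
  Bd-prem zero p g b bg = BdV-mono (ℕₚ.m≤m+n _ _) p b
  Bd-prem {N = N} (suc n) (a ∷ p) g {B} (ba , bp) (bas , bl) =
    BdV-mono bigger _ (BdV-sub (lead g) (proj₁ top) (proj₂ top) (proj₁ g) bl (proj₁ btop) (proj₂ btop) bas)
    where
    v = mul (powP (lead g) n) a ∷ proj₂ (prem n p g)
    top = unsnoc v
    le′ : suc n ℕ.* suc B ℕ.+ N ≤ premBd B N n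
    le′ = ≡.subst (_≤ premBd B N n) (ℕₚ.+-comm N _) (ℕₚ.+-monoʳ-≤ N (ℕₚ.*-monoʳ-≤ (suc n) (ℕₚ.n≤1+n (suc B))))
    btop : BdM (premBd B N n) top
    btop = BdM-unsnoc v
      ( Bd-mono le′ _ (Bd-mul (powP (lead g) n) a (Bd-powP (lead g) (s≤s z≤n) (Bd-mono (ℕₚ.n≤1+n B) (lead g) bl) n) ba)
      , Bd-prem n p g bp (bas , bl))
    bigger : suc (B ℕ.+ premBd B N n) ≤ premBd B N (suc n)
    bigger = ℕₚ.≤-trans (ℕₚ.n≤1+n _) (ℕₚ.≤-reflexive (≡.trans (ℕₚ.+-comm (2 ℕ.+ B) _)
      (≡.trans (ℕₚ.+-assoc N _ _) (≡.cong (N ℕ.+_) (ℕₚ.+-comm (suc n ℕ.* (2 ℕ.+ B)) _)))))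

  BdV-pad : ∀ e (as : Vec (NP i) n) → BdV N as → BdV N (padR e as)
  BdV-pad zero [] b = tt
  BdV-pad (suc e) [] b = Bd-zer , BdV-pad e [] b
  BdV-pad e (a ∷ as) (b , bs) = b , BdV-pad e as bs

  BdV-snoc : (as : Vec (NP i) n) (l : NP i) → BdV N as → Bd N l → BdV N (as ∷ʳ l)
  BdV-snoc [] l b b′ = b′ , tt
  BdV-snoc (a ∷ as) l (b , bs) b′ = b , BdV-snoc as l bs b′

  -- Prime towers

  infix 4 _∈I_
  _∈I_ : NP i → Tower i → Set (c ⊔ ℓ)
  p ∈I τ = ∀ x → pts τ x → ev p x ≈ 0#

  -- A quantitative form of "g is irreducible over the function field of τ".
  Separating : Tower i → MP i (suc e) → (ℕ → ℕ) → Set (c ⊔ ℓ)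
  Separating τ g β = ∀ n a → Bd n a → ¬ ¬ (a ∈I (τ ▹≈ g) ⊎ ∃ λ μ → Bd (β n) μ × ¬ μ ∈I τ ×
    (∀ t x → pts τ x → VanM g t x → ev a (t ∷ x) ≈ 0# → ev μ x ≈ 0#))

  Prime : Tower i → Set (c ⊔ ℓ)
  Prime (base E q) = Holds E q []
  Prime (τ ▹≠ g) = Prime τ × (∀ x → pts τ x → ¬ ev (lead g) x ≈ 0#)
  Prime (τ ▹≈ g) = Prime τ × (∀ x → pts τ x → ¬ ev (lead g) x ≈ 0#) × ∃ (Separating τ g)

  point : (τ : Tower i) → Prime τ → ∃ (pts τ)
  point (base E q) h = [] , h
  point (τ ▹≠ g) (pr , nl) = let (x , px) = point τ pr
                                 (t , nt) = nonroot g x (nl x px) in t ∷ x , px , nt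
  point (τ ▹≈ g) (pr , nl , _) = let (x , px) = point τ pr
                                     (t , nt) = root g x (nl x px) in t ∷ x , px , nt

  -- The analogue of `Stripped` over the function field of `τ`: a coefficient counts as zero if it
  -- vanishes on all of `τ`, and excluded middle replaces the decision tree.
  data StripI (τ : Tower i) (N n : ℕ) (as : Vec (NP i) n) : Set (c ⊔ ℓ) where
    vanishing : (∀ x → pts τ x → ∀ t → Van as t x) → StripI τ N n as
    leading   : e < n → (g : MP i e) → BdM N g → ¬ lead g ∈I τ →
                (∀ x → pts τ x → ∀ t → evM g t x ≈ evV as t x) → StripI τ N n as

  stripI : ∀ (τ : Tower i) n (as : Vec (NP i) n) → BdV N as → ¬ ¬ StripI τ N n as
  stripI τ zero [] b = return (vanishing λ x px t → refl)
  stripI τ (suc n) as b = do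
    inj₁ z ← em (lead (unsnoc as) ∈I τ)
      where inj₂ nz → return (leading ℕₚ.≤-refl (unsnoc as) (BdM-unsnoc as b) nz λ x px t → ev-unsnoc as t x)
    let same : ∀ x → pts τ x → ∀ t → evV (proj₁ (unsnoc as)) t x ≈ evV as t x
        same x px t = trans (sym (evM'-0 (proj₁ (unsnoc as)) _ t x (z x px))) (ev-unsnoc as t x)
    leading lt g bg nl w ← stripI τ n (proj₁ (unsnoc as)) (proj₁ (BdM-unsnoc as b))
      where vanishing w → return (vanishing λ x px t → trans (sym (same x px t)) (w x px t))
    return (leading (ℕₚ.m<n⇒m<1+n lt) g bg nl λ x px t → trans (w x px t) (same x px t))

  -- Over a free coordinate, if neither leading coefficient vanished at a point, some `t` would
  -- avoid the zeros of `g` and of both polynomials. Over an algebraic one, `p` and `q` are replaced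
  -- by their separating polynomials `μ` and `ν`, whose product vanishes on `τ` because every point
  -- lifts to a root of `g`.
  prime : (τ : Tower i) → Prime τ → ∀ p q → (∀ x → pts τ x → ¬ ¬ (ev p x * ev q x ≈ 0#)) →
    ¬ ¬ (p ∈I τ ⊎ q ∈I τ)
  prime (base E d) pr (con₀ a) (con₀ b) z = do
    ab ← z [] pr
    inj₁ az ← integral ab
      where inj₂ bz → return (inj₂ λ _ _ → bz)
    return (inj₁ λ _ _ → az)
  prime (τ ▹≠ g) (pr , nl) (poly as) (poly bs) z = do
    leading _ f _ nf wf ← stripI τ _ as (BdV-bound as)
      where vanishing w → return (inj₁ λ { (t ∷ x) (px , _) → w x px t })
    leading _ h _ nh wh ← stripI τ _ bs (BdV-bound bs)
      where vanishing w → return (inj₂ λ { (t ∷ x) (px , _) → w x px t })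
    let gfh = mulM g (mulM f h)
        vanish : ∀ x → pts τ x → ¬ ¬ (ev (lead f) x * ev (lead h) x ≈ 0#)
        vanish x px k =
          let (t , nv) = nonroot gfh x (≉-resp (sym (trans (ev-mul (lead g) _ x) (*-congˡ (ev-mul (lead f) (lead h) x))))
                                          (*≉0 (nl x px) k))
              nv′ = ≉-resp (trans (ev-mulM g (mulM f h) t x) (*-congˡ (trans (ev-mulM f h t x) (*-cong (wf x px t) (wh x px t))))) nv
          in z (t ∷ x) (px , ≉0-*ˡ nv′) (≉0-*ʳ nv′)
    inj₁ fz ← prime τ pr (lead f) (lead h) vanish
      where inj₂ hz → ⊥-elim (nh hz)
    ⊥-elim (nf fz)
  prime (τ ▹≈ g) (pr , nl , β , sep) p q z = do
    inj₂ (μ , _ , nμ , wμ) ← sep _ p (Bd-bound p)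
      where inj₁ pz → return (inj₁ pz)
    inj₂ (ν , _ , nν , wν) ← sep _ q (Bd-bound q)
      where inj₁ qz → return (inj₂ qz)
    let vanish : ∀ x → pts τ x → ¬ ¬ (ev μ x * ev ν x ≈ 0#)
        vanish x px = let (t , v) = root g x (nl x px) in do
          pq ← z (t ∷ x) (px , v)
          inj₁ pz ← integral pq
            where inj₂ qz → return (x*0≈0 (wν t x px v qz))
          return (0*x≈0 (wμ t x px v pz))
    inj₁ μz ← prime τ pr μ ν vanish
      where inj₂ νz → ⊥-elim (nν νz)
    ⊥-elim (nμ μz)

  ∉I-mul : (τ : Tower i) → Prime τ → ∀ p q → ¬ p ∈I τ → ¬ q ∈I τ → ¬ mul p q ∈I τ
  ∉I-mul τ pr p q np nq z = prime τ pr p q (λ x px → return (trans (sym (ev-mul p q x)) (z x px)))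
    λ { (inj₁ h) → np h ; (inj₂ h) → nq h }

  lift∉≠ : (τ : Tower i) (g : MP i e) → (∀ x → pts τ x → ¬ ev (lead g) x ≈ 0#) →
    ∀ p → ¬ p ∈I τ → ¬ liftP p ∈I (τ ▹≠ g)
  lift∉≠ τ g nl p np z = np λ x px → let (t , nv) = nonroot g x (nl x px) in
    trans (sym (ev-liftP p t x)) (z (t ∷ x) (px , nv))

  lift∉≈ : (τ : Tower i) (g : MP i (suc e)) → (∀ x → pts τ x → ¬ ev (lead g) x ≈ 0#) →
    ∀ p → ¬ p ∈I τ → ¬ liftP p ∈I (τ ▹≈ g)
  lift∉≈ τ g nl p np z = np λ x px → let (t , v) = root g x (nl x px) in
    trans (sym (ev-liftP p t x)) (z (t ∷ x) (px , v))

  -- Every fibre of σ must be non-empty, so lower steps have to shrink too and σ is in general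
  -- smaller than τ ∩ {μ ≠ 0}; it still contains the open part ν ≠ 0 of τ.
  record Shrunk (τ : Tower i) (μ : NP i) : Set (c ⊔ ℓ) where
    constructor shrunk
    field
      σ    : Tower i
      isPr : Prime σ
      dim≡ : dim σ ≡ dim τ
      sub  : ∀ x → pts σ x → pts τ x × ¬ ev μ x ≈ 0#
      ν    : NP i
      ν∉   : ¬ ν ∈I τ
      sup  : ∀ x → pts τ x → ¬ ev ν x ≈ 0# → pts σ x

  -- The product of `p` and `ν` vanishes on `τ`, since points with `ν ≠ 0` belong to `σ`; primality
  -- removes `ν`.
  ∈I-shrunk : (τ : Tower i) → Prime τ → ∀ {μ} (s : Shrunk τ μ) → ∀ p → p ∈I Shrunk.σ s → ¬ ¬ p ∈I τ
  ∈I-shrunk τ pr s p z = do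
    let open Shrunk s
    inj₁ h ← prime τ pr p ν (λ x px → do
        inj₁ e ← em (ev ν x ≈ 0#)
          where inj₂ n → return (0*x≈0 (z x (sup x px n)))
        return (x*0≈0 e))
      where inj₂ h → ⊥-elim (Shrunk.ν∉ s h)
    return h

  -- The inequation is pushed down the tower. At a free coordinate it is multiplied into the
  -- excluded polynomial, and its leading coefficient is excluded below; at an algebraic one it is
  -- replaced by `μ′ ≠ 0` with the separating polynomial `μ′`.
  shrink : (τ : Tower i) → Prime τ → ∀ μ → ¬ μ ∈I τ → ¬ ¬ Shrunk τ μ
  shrink (base E q) (hE , hq) (con₀ a) na = return record
    { σ = base E (mul q (con₀ a)) ; dim≡ = ≡.refl ; ν = con₀ a ; ν∉ = na
    ; isPr = hE , ≉-resp (sym (ev-mul q (con₀ a) [])) (*≉0 hq (λ z → na λ _ _ → z))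
    ; sub = λ { [] (hE′ , h) → let h′ = ≉-resp (ev-mul q (con₀ a) []) h in (hE′ , ≉0-*ˡ h′) , ≉0-*ʳ h′ }
    ; sup = λ x (hE′ , hq′) na′ → hE′ , ≉-resp (sym (ev-mul q (con₀ a) x)) (*≉0 hq′ na′) }
  shrink (τ ▹≠ g) pr@(prτ , nl) (poly as) nμ = do
    leading _ f _ nf wf ← stripI τ _ as (BdV-bound as)
      where vanishing w → ⊥-elim (nμ λ { (t ∷ x) (px , _) → w x px t })
    s ← shrink τ prτ (lead f) nf
    let open Shrunk s
    return record
      { σ = σ ▹≠ mulM g f ; dim≡ = ≡.cong suc dim≡ ; ν = mul (liftP ν) (poly as)
      ; isPr = isPr , λ x px → let (pτ , nx) = sub x px in
                 ≉-resp (sym (ev-mul (lead g) (lead f) x)) (*≉0 (nl x pτ) nx)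
      ; sub = λ { (t ∷ x) (px , nv) → let (pτ , nx) = sub x px ; nv′ = ≉-resp (ev-mulM g f t x) nv in
                 (pτ , ≉0-*ˡ nv′) , ≉-resp (wf x pτ t) (≉0-*ʳ nv′) }
      ; ν∉ = ∉I-mul (τ ▹≠ g) pr (liftP ν) (poly as) (lift∉≠ τ g nl ν ν∉) nμ
      ; sup = λ { (t ∷ x) (px , nv) nν → let nν′ = ≉-resp (ev-mul (liftP ν) (poly as) (t ∷ x)) nν in
                 sup x px (≉-resp (ev-liftP ν t x) (≉0-*ˡ nν′))
               , ≉-resp (sym (ev-mulM g f t x)) (*≉0 nv (≉-resp (sym (wf x px t)) (≉0-*ʳ nν′))) } }
  shrink (τ ▹≈ g) pr@(prτ , nl , β , sep) μ nμ = do
    inj₂ (μ′ , _ , nμ′ , w) ← sep _ μ (Bd-bound μ)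
      where inj₁ z → ⊥-elim (nμ z)
    s ← shrink τ prτ μ′ nμ′
    let open Shrunk s
    return record
      { σ = σ ▹≈ g ; dim≡ = dim≡ ; ν = liftP ν
      -- Separation passes to `σ` with the same `β`: a polynomial outside the ideal of `τ` stays
      -- outside that of `σ`.
      ; isPr = isPr , (λ x px → nl x (proj₁ (sub x px))) , β , λ n a b → do
          inj₂ (κ , bκ , nκ , wκ) ← sep n a b
            where inj₁ z → return (inj₁ λ { (t ∷ x) (px , v) → z (t ∷ x) (proj₁ (sub x px) , v) })
          return (inj₂ (κ , bκ , (λ z → ∈I-shrunk τ prτ s κ z nκ) , λ t x px → wκ t x (proj₁ (sub x px))))
      ; sub = λ { (t ∷ x) (px , v) → let (pτ , nx) = sub x px in (pτ , v) , λ z → nx (w t x pτ v z) }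
      ; ν∉ = lift∉≈ τ g nl ν ν∉
      ; sup = λ { (t ∷ x) (px , v) nν → sup x px (≉-resp (ev-liftP ν t x) nν) , v } }

  -- Zariski density in `τ` of the points of `τ` that lie in `S`.
  Dense : (Point i → Set (c ⊔ ℓ)) → Tower i → Set (c ⊔ ℓ)
  Dense S τ = ∀ p → (∀ x → S x → pts τ x → ¬ ¬ ev p x ≈ 0#) → ¬ ¬ p ∈I τ

  Dense-inhabited : ∀ {S} (τ : Tower i) → Prime τ → Dense S τ → ¬ (∀ x → S x → ¬ pts τ x)
  Dense-inhabited τ pr dense empty = dense (cst 1#) (λ x s px → ⊥-elim (empty x s px)) λ z →
    let (x , px) = point τ pr in 1≉0 (trans (sym (ev-cst 1# x)) (z x px))

  boundM : MP i e → ℕ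
  boundM (as , l) = boundV as ℕ.⊔ bound l

  BdM-bound : (g : MP i e) → BdM (boundM g) g
  BdM-bound (as , l) = BdV-mono (ℕₚ.m≤m⊔n _ (bound l)) as (BdV-bound as) , Bd-mono (ℕₚ.m≤n⊔m (boundV as) _) l (Bd-bound l)

  castV-Bd : (eq : n ≡ m) (as : Vec (NP i) n) → BdV N as → BdV N (castV eq as)
  castV-Bd ≡.refl as b = b

  premBd-mono : ∀ B N {n m} → n ≤ m → premBd B N n ≤ premBd B N m
  premBd-mono B N le = ℕₚ.+-monoʳ-≤ N (ℕₚ.*-monoˡ-≤ (2 ℕ.+ B) (s≤s le))

  -- Among the polynomials h such that {g = h = 0} over S dominates τ, one of minimal degree is
  -- irreducible over the function field of τ.
  module Component (τ : Tower i) (pr : Prime τ) (S : Point i → Set (c ⊔ ℓ)) (dense : Dense S τ)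
                   (g : MP i (suc e)) (nl : ∀ x → S x → ¬ ev (lead g) x ≈ 0#) where

    -- Membership in the elimination ideal of the common zeros of `g` and `h` over the part of `τ`
    -- in `S`. `Dominant` then says that these zeros project densely to `τ`.
    Kills : MP i d → NP i → Set (c ⊔ ℓ)
    Kills h p = ∀ t x → S x → pts τ x → VanM g t x → VanM h t x → ¬ ¬ ev p x ≈ 0#

    Dominant : MP i d → Set (c ⊔ ℓ)
    Dominant h = ∀ p → Kills h p → ¬ ¬ p ∈I τ

    Good : MP i d → Set (c ⊔ ℓ)
    Good h = ¬ lead h ∈I τ × Dominant h

    Minimal : ℕ → Set (c ⊔ ℓ)
    Minimal d = ∀ d′ → d′ < d → ¬ Σ (MP i d′) Good

    g-good : Good g
    g-good = (λ z → Dense-inhabited τ pr dense λ x s px → nl x s (z x px))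
           , λ p k → dense p λ x s px → let (t , v) = root g x (nl x s) in k t x s px v v

    module Minimal-degree {d} (h : MP i (suc d)) (good : Good h) (minimal : Minimal (suc d)) where

      killer : ∀ {d′} (r : MP i d′) → d′ < suc d → ¬ lead r ∈I τ → ¬ ¬ (∃ λ p → ¬ p ∈I τ × Kills r p)
      killer r lt nr k = minimal _ lt (r , nr , λ p kp np → k (p , np , kp))

      -- degree bound for the outcome of f steps of Euclid's algorithm
      E : ℕ → ℕ → ℕ
      E zero N = N
      E (suc f) N = N ℕ.⊔ E f (premBd N (boundM h) (suc d))

      Meets : ∀ {d′} → MP i d′ → NP i → Set (c ⊔ ℓ)
      Meets r μ = ∀ t x → pts τ x → VanM h t x → VanM r t x → ev μ x ≈ 0#

      -- If the remainder vanishes, `h` is up to a power of `lead r` a product of `Q` and `r`. Both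
      -- have smaller degree, so minimality gives each a killer outside the ideal; the product of
      -- the killers kills `h`, against dominance. Should `Q` vanish too, `h` would vanish
      -- identically over a point where its leading coefficient does not.
      noFactor : ∀ {d′} (le : d′ ≤ d) (r : MP i (suc d′)) → suc d′ < suc d → ¬ lead r ∈I τ →
        (∀ x → pts τ x → ∀ t → Van (proj₂ (divide le h r)) t x) → ⊥
      noFactor {d′} le r lt nr vs = stripI τ _ (proj₁ (divide le h r)) (BdV-bound (proj₁ (divide le h r))) λ
        { (vanishing vQ) → shrink τ pr (mul (lead r) (lead h)) (∉I-mul τ pr (lead r) (lead h) nr (proj₁ good)) λ s →
            let open Shrunk s
                (x , px) = point σ isPr
                (pτ , nn) = sub x px
                nn′ = ≉-resp (ev-mul (lead r) (lead h) x) nn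
                (t , nv) = nonroot h x (≉0-*ʳ nn′)
            in nv (cancel≉ (^-≉0 (suc d ℕ.∸ d′) (≉0-*ˡ nn′))
                     (trans (divide-eq le h r x t) (0+0≈0 (0*x≈0 (vQ x pτ t)) (vs x pτ t))))
        ; (leading ltQ Q _ nQ wQ) → killer r lt nr λ (p , np , kp) →
            killer Q (ℕₚ.<-≤-trans ltQ (ℕₚ.m∸n≤m (suc d) d′)) nQ λ (q , nq , kq) →
            proj₂ good (mul p q) (λ t x s px vg vh → do
              inj₁ z ← integral (trans (*-congʳ (wQ x px t)) (trans (sym (trans (+-congˡ (vs x px t)) (+-identityʳ _)))
                         (trans (sym (divide-eq le h r x t)) (x*0≈0 vh))))
                where inj₂ z → do
                        pz ← kp t x s px vg z
                        return (trans (ev-mul p q x) (0*x≈0 pz))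
              qz ← kq t x s px vg z
              return (trans (ev-mul p q x) (x*0≈0 qz)))
            (∉I-mul τ pr p q np nq) }

      -- At each step `h` itself is divided by the current `r`, so `noFactor` rules out a vanishing
      -- remainder and the degree falls to 0. The last remainder plays the part of a resultant of
      -- `h` and `r`.
      meet : ∀ f {d′} (r : MP i d′) → d′ ≤ f → d′ < suc d → BdM N r → ¬ lead r ∈I τ →
        ¬ ¬ (∃ λ μ → Bd (E f N) μ × ¬ μ ∈I τ × Meets r μ)
      meet zero {zero} ([] , l) _ lt (_ , bl) nr = return (l , bl , nr , λ t x px _ z → z)
      meet (suc f) {zero} ([] , l) _ lt (_ , bl) nr =
        return (l , Bd-mono (ℕₚ.m≤m⊔n _ _) l bl , nr , λ t x px _ z → z)
      meet {N} (suc f) {suc d′} r (s≤s le) lt@(s≤s lt′) br nr = do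
        let le′ = ℕₚ.≤-trans (ℕₚ.n≤1+n d′) lt′
            bh = BdM-bound h
            bs = Bd-prem (suc d ℕ.∸ d′) (castV (divide-length le′) (mpV h)) r
                   (castV-Bd (divide-length le′) (mpV h) (BdV-snoc (proj₁ h) (proj₂ h) (proj₁ bh) (proj₂ bh))) br
            bs′ = BdV-mono (premBd-mono N (boundM h) (ℕₚ.m∸n≤m (suc d) d′)) _ bs
        leading ltS s bS nS wS ← stripI τ _ (proj₂ (divide le′ h r)) bs′
          where vanishing vs → ⊥-elim (noFactor le′ r lt nr vs)
        (μ , bμ , nμ , wμ) ← meet f s (ℕₚ.≤-trans (ℕₚ.≤-pred ltS) le) (ℕₚ.<-trans ltS lt) bS nS
        return (μ , Bd-mono (ℕₚ.m≤n⊔m N _) μ bμ , nμ , λ t x px vh vr → wμ t x px vh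
          (trans (wS x px t) (trans (sym (trans (+-congʳ (x*0≈0 vr)) (+-identityˡ _)))
            (trans (sym (divide-eq le′ h r x t)) (x*0≈0 vh)))))

      module _ (s : Shrunk τ (lead h)) where
        open Shrunk s

        separating : Separating σ h (λ n → E d (premBd (boundM h) n n))
        separating n (poly {n = l} as) (le , b) = do
          let br = Bd-prem l (padR (suc d) as) h (BdV-pad (suc d) as b) (BdM-bound h)
              eq : ∀ t x → _
              eq t x = trans (*-congˡ (sym (ev-padR (suc d) as t x))) (ev-prem l (padR (suc d) as) h t x)
          leading ltR r bR nR wR ← stripI τ _ (proj₂ (prem l (padR (suc d) as) h))
              (BdV-mono (premBd-mono (boundM h) n le) _ br)
            where vanishing vr → return (inj₁ λ { (t ∷ x) (px , vh) → let (pτ , nx) = sub x px in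
                    cancel≉ (^-≉0 l nx) (trans (eq t x) (0+0≈0 (x*0≈0 vh) (vr x pτ t))) })
          (μ , bμ , nμ , wμ) ← meet d r (ℕₚ.≤-pred ltR) ltR bR nR
          return (inj₂ (μ , bμ , (λ z → ∈I-shrunk τ pr s μ z nμ) , λ t x px vh va → let (pτ , nx) = sub x px in
            wμ t x pτ vh (trans (wR x pτ t) (trans (sym (trans (+-congʳ (x*0≈0 vh)) (+-identityˡ _)))
              (trans (sym (eq t x)) (x*0≈0 va))))))

        component-prime : Prime (σ ▹≈ h)
        component-prime = isPr , (λ x px → proj₂ (sub x px)) , _ , separating

        -- For `p` outside the ideal, its separating polynomial `μ` vanishes under the common zeros
        -- of `g` and `h` where `ν ≠ 0`. By dominance `μ ν` lies in the prime ideal of `τ`, although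
        -- neither factor does.
        component-dense : ∀ {S⁺ : Point (suc i) → Set (c ⊔ ℓ)} → (∀ t x → S x → VanM g t x → S⁺ (t ∷ x)) →
          Dense S⁺ (σ ▹≈ h)
        component-dense S⁺ p z = do
          inj₂ (μ , _ , nμ , wμ) ← separating _ p (Bd-bound p)
            where inj₁ pz → return pz
          μν∈ ← proj₂ good (mul μ ν) λ t x s px vg vh → do
            inj₂ n ← em (ev ν x ≈ 0#)
              where inj₁ νz → return (trans (ev-mul μ ν x) (x*0≈0 νz))
            pz ← z (t ∷ x) (S⁺ t x s vg) (sup x px n , vh)
            return (trans (ev-mul μ ν x) (0*x≈0 (wμ t x (sup x px n) vh pz)))
          inj₁ μz ← prime τ pr μ ν (λ x px → return (trans (sym (ev-mul μ ν x)) (μν∈ x px)))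
            where inj₂ νz → ⊥-elim (ν∉ νz)
          ⊥-elim (nμ λ x px → μz x (proj₁ (sub x px)))

  record DenseIn (S : Point i → Set (c ⊔ ℓ)) (r : ℕ) : Set (c ⊔ ℓ) where
    constructor denseIn
    field
      σ     : Tower i
      isPr  : Prime σ
      dim≡  : dim σ ≡ r
      dense : Dense S σ

  algStep : (τ : Tower i) → Prime τ → (S : Point i → Set (c ⊔ ℓ)) → Dense S τ → (g : MP i (suc e)) →
    (∀ x → S x → ¬ ev (lead g) x ≈ 0#) → (S⁺ : Point (suc i) → Set (c ⊔ ℓ)) →
    (∀ t x → S x → VanM g t x → S⁺ (t ∷ x)) →
    ¬ ¬ (Σ (DenseIn S⁺ (dim τ)) λ D → ∀ t x → pts (DenseIn.σ D) (t ∷ x) → pts τ x)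
  algStep {i} τ pr S dense g nl S⁺ inS = do
    (suc d , (h , good) , minimal) ← least (λ d → Σ (MP i d) Good) (_ , g , g-good)
      -- Degree 0 cannot occur: such a polynomial kills its own leading coefficient, which is
      -- outside the ideal.
      where (zero , (([] , l) , nl , dom) , _) → ⊥-elim (dom l (λ t x _ _ _ z → return z) nl)
    s ← shrink τ pr (lead h) (proj₁ good)
    let open Minimal-degree h good minimal
        open Shrunk s
    return (denseIn (σ ▹≈ h) (component-prime s) dim≡ (component-dense s inS) , λ t x (px , _) → proj₁ (sub x px))
    where open Component τ pr S dense g nl

  one : MP i 0
  one = [] , cst 1#

  cst1≉0 : (x : Point i) → ¬ ev (cst 1#) x ≈ 0#
  cst1≉0 x = ≉-resp (sym (ev-cst 1# x)) 1≉0

  component : (τ : Tower i) → Regular τ → ∀ {x} → pts τ x → ¬ ¬ DenseIn (pts τ) (dim τ)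
  component (base E q) reg {[]} h = return (denseIn (base E q) h ≡.refl λ p z → do
    e ← z [] h h
    return λ { [] _ → e })
  component (τ ▹≠ g) (reg , nl) {t ∷ x} (px , _) = do
    denseIn σ pr d≡ dense ← component τ reg px
    -- The leading coefficient of `g` may vanish at points of `σ` outside `τ`. Hence the whole line
    -- is taken as fibre, in which the points with `g ≠ 0` are dense.
    return (denseIn (σ ▹≠ one) (pr , λ x _ → cst1≉0 x) (≡.cong suc d≡) λ { (poly as) z → do
      leading _ f _ nf wf ← stripI σ _ as (BdV-bound as)
        where vanishing w → return λ { (t ∷ x) (px , _) → w x px t }
      fz ← dense (lead f) λ x px pσ k →
        let (t , nv) = nonroot (mulM g f) x (≉-resp (sym (ev-mul (lead g) (lead f) x)) (*≉0 (nl x px) k))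
            nv′ = ≉-resp (ev-mulM g f t x) nv
        in z (t ∷ x) (px , ≉0-*ˡ nv′) (pσ , cst1≉0 x) (≉-resp (wf x pσ t) (≉0-*ʳ nv′))
      ⊥-elim (nf fz) })
  component (τ ▹≈ g) (reg , nl) {t ∷ x} (px , _) = do
    denseIn σ pr d≡ dense ← component τ reg px
    (denseIn σ⁺ pr⁺ d⁺ dense⁺ , _) ← algStep σ pr (pts τ) dense g nl (pts (τ ▹≈ g)) (λ t x px v → px , v)
    return (denseIn σ⁺ pr⁺ (≡.trans d⁺ d≡) dense⁺)

  -- Sections of prime towers

  substV : Carrier → Vec (NP i) n → NP i
  substV a [] = zer
  substV a (b ∷ bs) = add b (mul (cst a) (substV a bs))

  ev-substV : ∀ a (bs : Vec (NP i) n) x → ev (substV a bs) x ≈ evV bs a x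
  ev-substV a [] x = ev-zer x
  ev-substV a (b ∷ bs) x = trans (ev-add b _ x) (+-congˡ (trans (ev-mul (cst a) (substV a bs) x)
    (*-cong (ev-cst a x) (ev-substV a bs x))))

  Bd-substV : ∀ a (bs : Vec (NP i) n) → BdV N bs → Bd (n ℕ.+ N) (substV a bs)
  Bd-substV a [] b = Bd-zer
  Bd-substV {N = N} a (c ∷ bs) (b , bs′) = Bd-add c (mul (cst a) (substV a bs)) (Bd-mono (ℕₚ.m≤n+m N _) c b)
    (Bd-mul (cst a) (substV a bs) (Bd-cst a ℕₚ.≤-refl) (Bd-substV a bs bs′))

  linear : Carrier → MP i 1
  linear a = cst (- a) ∷ [] , cst 1#

  ev-linear : ∀ a t (x : Point i) → evM (linear a) t x ≈ t + - a
  ev-linear a t x = trans (+-cong (ev-cst (- a) x) (trans (*-congˡ (ev-cst 1# x)) (*-identityʳ t))) (+-comm _ _)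

  linear-root : ∀ {a t} (x : Point i) → VanM (linear a) t x → t ≈ a
  linear-root {a = a} {t} x v = x-y≈0 (trans (sym (ev-linear a t x)) v)

  linear-van : ∀ a (x : Point i) → VanM (linear a) a x
  linear-van a x = trans (ev-linear a a x) (-‿inverseʳ a)

  -- Modulo `t - a` a polynomial equals its value at `t = a`, which serves as separating polynomial.
  slice-prime : (τ : Tower i) → Prime τ → ∀ a → Prime (τ ▹≈ linear a)
  slice-prime τ pr a = pr , (λ x _ → cst1≉0 x) , (λ n → n ℕ.+ n) , λ { n (poly as) (le , b) → do
    inj₂ nz ← em (substV a as ∈I τ)
      where inj₁ z → return (inj₁ λ { (t ∷ x) (px , v) →
              trans (evV-cong as (linear-root x v) (≋-refl x)) (trans (sym (ev-substV a as x)) (z x px)) })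
    return (inj₂ (substV a as , Bd-mono (ℕₚ.+-monoˡ-≤ n le) (substV a as) (Bd-substV a as b) , nz , λ t x px v z →
      trans (ev-substV a as x) (trans (evV-cong as (sym (linear-root x v)) (≋-refl x)) z))) }

  PolyIn : Tower i → Poly K i → Set (c ⊔ ℓ)
  PolyIn τ p = ∀ x → pts τ x → eval K p x ≈ 0#

  weakenP : Poly K i → Poly K (suc i)
  weakenP = L.map λ (a , α) → a , 0 ∷ α

  eval-weakenP : ∀ (p : Poly K i) t x → eval K (weakenP p) (t ∷ x) ≈ eval K p x
  eval-weakenP [] t x = refl
  eval-weakenP ((a , α) ∷ p) t x = +-cong (*-congˡ (*-identityˡ _)) (eval-weakenP p t x)

  evalMon-0 : (x : Point i) → evalMon K (Vec.replicate i 0) x ≈ 1#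
  evalMon-0 [] = refl
  evalMon-0 (t ∷ x) = trans (*-identityˡ _) (evalMon-0 x)

  linearP : Carrier → Poly K (suc i)
  linearP {i} a = (1# , 1 ∷ Vec.replicate i 0) ∷ (- a , 0 ∷ Vec.replicate i 0) ∷ []

  eval-linearP : ∀ a t (x : Point i) → eval K (linearP a) (t ∷ x) ≈ t + - a
  eval-linearP a t x = +-cong (trans (*-identityˡ _) (trans (*-cong (*-identityʳ t) (evalMon-0 x)) (*-identityʳ t)))
    (trans (+-identityʳ _) (trans (*-congˡ (trans (*-identityˡ _) (evalMon-0 x))) (*-identityʳ _)))

  -- `eqn` certifies that the section lies in a proper closed subset of `τ`; it makes the inclusion
  -- in the chain strict.
  record Slice (τ : Tower i) (r : ℕ) : Set (c ⊔ ℓ) where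
    constructor slice
    field
      dense : DenseIn (pts τ) r
      eqn   : Poly K i
      eqn∈  : PolyIn (DenseIn.σ dense) eqn
      eqn∉  : ¬ PolyIn τ eqn

  -- A free top coordinate is set to `a₀`, a non-root of `g` over one point, so that the section
  -- meets the tower densely. Under an algebraic coordinate the cut is made further down; what lies
  -- above it may split, and a component is chosen by `algStep`.
  cut : (τ : Tower i) → Prime τ → ∀ {r} → dim τ ≡ suc r → ¬ ¬ Slice τ r
  cut (τ ▹≠ g) (pr , nl) ≡.refl = return (slice
    (denseIn (τ ▹≈ linear a₀) (slice-prime τ pr a₀) ≡.refl λ { (poly as) z → do
      inj₁ az ← prime τ pr (substV a₀ as) (substV a₀ (mpV g)) (λ x px → do
          inj₂ n ← em (VanM g a₀ x)
            where inj₁ v → return (x*0≈0 (trans (at-a x) v))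
          pz ← z (a₀ ∷ x) (px , n) (px , linear-van a₀ x)
          return (0*x≈0 (trans (ev-substV a₀ as x) pz)))
        where inj₂ gz → ⊥-elim (nv (trans (sym (at-a x₀)) (gz x₀ px₀)))
      return λ { (t ∷ x) (px , v) → trans (evV-cong as (linear-root x v) (≋-refl x)) (trans (sym (ev-substV a₀ as x)) (az x px)) } })
    (linearP a₀)
    (λ { (t ∷ x) (px , v) → trans (eval-linearP a₀ t x) (trans (sym (ev-linear a₀ t x)) v) })
    λ z → let (t , nt) = nonroot (mulM g (linear a₀)) x₀ (≉-resp (sym (ev-mul (lead g) (cst 1#) x₀)) (*≉0 (nl x₀ px₀) (cst1≉0 x₀)))
              nt′ = ≉-resp (ev-mulM g (linear a₀) t x₀) nt
          in ≉0-*ʳ nt′ (trans (ev-linear a₀ t x₀) (trans (sym (eval-linearP a₀ t x₀)) (z (t ∷ x₀) (px₀ , ≉0-*ˡ nt′)))))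
    where
    x₀ = proj₁ (point τ pr)
    px₀ = proj₂ (point τ pr)
    a₀ = proj₁ (nonroot g x₀ (nl x₀ px₀))
    nv = proj₂ (nonroot g x₀ (nl x₀ px₀))
    at-a : ∀ x → ev (substV a₀ (mpV g)) x ≈ evM g a₀ x
    at-a x = trans (ev-substV a₀ (mpV g) x) (ev-mp g a₀ x)
  cut (τ ▹≈ g) (pr , nl , _) d≡ = do
    slice (denseIn σ prσ d≡σ dense) p p∈ p∉ ← cut τ pr d≡
    (denseIn σ⁺ pr⁺ d⁺ dense⁺ , over) ← algStep σ prσ (pts τ) dense g nl (pts (τ ▹≈ g)) (λ t x px v → px , v)
    return (slice (denseIn σ⁺ pr⁺ (≡.trans d⁺ d≡σ) dense⁺) (weakenP p)
      (λ { (t ∷ x) px → trans (eval-weakenP p t x) (p∈ x (over t x px)) })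
      λ z → p∉ λ x px → let (t , v) = root g x (nl x px) in
        trans (sym (eval-weakenP p t x)) (z (t ∷ x) (px , v)))

  -- Subfields with decidable equality

  record Subring : Set (lsuc (c ⊔ ℓ)) where
    field
      In   : Carrier → Set (c ⊔ ℓ)
      resp : ∀ {x y} → x ≈ y → In x → In y
      In-1 : In 1#
      In-+ : ∀ {x y} → In x → In y → In (x + y)
      In-* : ∀ {x y} → In x → In y → In (x * y)
      In-neg : ∀ {x} → In x → In (- x)

    In-0 : In 0#
    In-0 = resp (-‿inverseʳ 1#) (In-+ In-1 (In-neg In-1))

  Decides : (Carrier → Set (c ⊔ ℓ)) → Set (c ⊔ ℓ)
  Decides P = ∀ {x} → P x → Dec (x ≈ 0#)

  record Subfield : Set (lsuc (c ⊔ ℓ)) where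
    field
      subring : Subring
    open Subring subring public
    field
      In-inv : ∀ {x y} → In x → x * y ≈ 1# → In y
      dec    : Decides In

  unit≉0 : ∀ {x y} → x * y ≈ 1# → ¬ x ≈ 0#
  unit≉0 xy e = 1≉0 (trans (sym xy) (0*x≈0 e))

  fractions : (R : Subring) → Decides (Subring.In R) → Subfield
  fractions R decR = record
    { subring = record
      { In = Fr
      ; resp = λ e (p , q , Ip , Iq , nq , eq) → p , q , Ip , Iq , nq , trans (*-congʳ (sym e)) eq
      ; In-1 = 1# , 1# , In-1 , In-1 , 1≉0 , *-identityˡ 1#
      ; In-+ = λ { {x} {y} (p , q , Ip , Iq , nq , eq) (p′ , q′ , Ip′ , Iq′ , nq′ , eq′) →
          p * q′ + p′ * q , q * q′ , In-+ (In-* Ip Iq′) (In-* Ip′ Iq) , In-* Iq Iq′ , *≉0 nq nq′ ,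
          trans (solve 4 (λ x y q q′ → (x :+ y) :* (q :* q′) := (x :* q) :* q′ :+ (y :* q′) :* q) refl x y q q′)
                (+-cong (*-congʳ eq) (*-congʳ eq′)) }
      ; In-* = λ { {x} {y} (p , q , Ip , Iq , nq , eq) (p′ , q′ , Ip′ , Iq′ , nq′ , eq′) →
          p * p′ , q * q′ , In-* Ip Ip′ , In-* Iq Iq′ , *≉0 nq nq′ ,
          trans (solve 4 (λ x y q q′ → (x :* y) :* (q :* q′) := (x :* q) :* (y :* q′)) refl x y q q′) (*-cong eq eq′) }
      ; In-neg = λ { (p , q , Ip , Iq , nq , eq) → - p , q , In-neg Ip , Iq , nq , trans (sym (-‿distribˡ-* _ _)) (-‿cong eq) }
      }
    ; In-inv = λ { {x} {y} (p , q , Ip , Iq , nq , eq) xy → q , p , Iq , Ip , ≉-resp eq (*≉0 (unit≉0 xy) nq) ,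
        trans (*-congˡ (sym eq)) (trans (solve 3 (λ x y q → y :* (x :* q) := (x :* y) :* q) refl x y q)
          (trans (*-congʳ xy) (*-identityˡ q))) }
    ; dec = λ { {x} (p , q , Ip , Iq , nq , eq) → decide eq nq (decR Ip) }
    }
    where
    open Subring R
    Fr : Carrier → Set _
    Fr z = ∃ λ p → ∃ λ q → In p × In q × ¬ q ≈ 0# × z * q ≈ p
    decide : ∀ {x p q} → x * q ≈ p → ¬ q ≈ 0# → Dec (p ≈ 0#) → Dec (x ≈ 0#)
    decide eq nq (yes z) = yes (cancel≉ nq (trans (*-comm _ _) (trans eq z)))
    decide eq nq (no n) = no λ z → n (trans (sym eq) (0*x≈0 z))

  private
    ι-+ : ∀ m n → ι (m ℕ.+ n) ≈ ι m + ι n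
    ι-+ = SM.×-homo-+ 1#

    ι-* : ∀ m n → ι (m ℕ.* n) ≈ ι m * ι n
    ι-* = SM.×1-homo-*

    -- Excluded middle settles whether the characteristic is positive and what it is; zero is then
    -- recognised by the remainder modulo `suc p`.
    ι-dec : ¬ ¬ (∀ n → Dec (ι n ≈ 0#))
    ι-dec = do
      inj₁ (n , z) ← em (∃ λ n → ι (suc n) ≈ 0#)
        where inj₂ nope → return λ { zero → yes refl ; (suc n) → no λ z → nope (n , z) }
      (p , zp , below) ← least (λ n → ι (suc n) ≈ 0#) (n , z)
      return λ n → let r = n DivMod.% suc p ; q = n DivMod./ suc p
                       eq : ι n ≈ ι r
                       eq = trans (reflexive (≡.cong ι (DivMod.m≡m%n+[m/n]*n n (suc p))))
                              (trans (ι-+ r (q ℕ.* suc p)) (trans (+-congˡ (trans (ι-* q (suc p)) (x*0≈0 zp))) (+-identityʳ _)))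
                   in decide n r eq (DivMod.m%n<n n (suc p)) below
      where
      decide : ∀ n r {p} → ι n ≈ ι r → r < suc p → (∀ n → n < p → ¬ ι (suc n) ≈ 0#) → Dec (ι n ≈ 0#)
      decide n zero eq lt below = yes eq
      decide n (suc r) eq (s≤s lt) below = no λ z → below r lt (trans (sym eq) z)

  integers : Subring
  integers = record
    { In = λ z → Level.Lift c (∃ λ a → ∃ λ b → z + ι b ≈ ι a)
    ; resp = λ { e (Level.lift (a , b , eq)) → Level.lift (a , b , trans (+-congʳ (sym e)) eq) }
    ; In-1 = Level.lift (1 , 0 , refl)
    ; In-+ = λ { {x} {y} (Level.lift (a , b , eq)) (Level.lift (a′ , b′ , eq′)) → Level.lift (a ℕ.+ a′ , b ℕ.+ b′ ,
        trans (+-congˡ (ι-+ b b′)) (trans (solve 4 (λ x y b b′ → (x :+ y) :+ (b :+ b′) := (x :+ b) :+ (y :+ b′)) refl x y (ι b) (ι b′))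
          (trans (+-cong eq eq′) (sym (ι-+ a a′))))) }
    ; In-* = λ { {x} {y} (Level.lift (a , b , eq)) (Level.lift (a′ , b′ , eq′)) →
        Level.lift (a ℕ.* a′ ℕ.+ b ℕ.* b′ , a ℕ.* b′ ℕ.+ b ℕ.* a′ , (begin
          x * y + ι (a ℕ.* b′ ℕ.+ b ℕ.* a′)
            ≈⟨ +-congˡ (trans (ι-+ (a ℕ.* b′) _) (+-cong (trans (ι-* a b′) (*-congʳ (sym eq))) (trans (ι-* b a′) (*-congˡ (sym eq′))))) ⟩
          x * y + ((x + ι b) * ι b′ + ι b * (y + ι b′))
            ≈⟨ solve 4 (λ x y b b′ → x :* y :+ ((x :+ b) :* b′ :+ b :* (y :+ b′)) := (x :+ b) :* (y :+ b′) :+ b :* b′) refl x y (ι b) (ι b′) ⟩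
          (x + ι b) * (y + ι b′) + ι b * ι b′
            ≈⟨ +-cong (trans (*-cong eq eq′) (sym (ι-* a a′))) (sym (ι-* b b′)) ⟩
          ι (a ℕ.* a′) + ι (b ℕ.* b′) ≈⟨ sym (ι-+ (a ℕ.* a′) (b ℕ.* b′)) ⟩
          ι (a ℕ.* a′ ℕ.+ b ℕ.* b′) ∎)) }
    ; In-neg = λ { {x} (Level.lift (a , b , eq)) → Level.lift (b , a ,
        trans (+-congˡ (sym eq)) (solve 2 (λ x b → :- x :+ (x :+ b) := b) refl x (ι b))) }
    }

  private
    difference-dec : (∀ n → Dec (ι n ≈ 0#)) → ∀ a b {z} → z + ι b ≈ ι a → Dec (z ≈ 0#)
    difference-dec d a b {z} eq with ℕₚ.≤-total b a
    ... | inj₁ le = transfer (d (a ℕ.∸ b))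
      where
      same : z ≈ ι (a ℕ.∸ b)
      same = trans (solve 2 (λ z b → z := (z :+ b) :- b) refl z (ι b)) (trans (+-congʳ (trans eq
               (trans (reflexive (≡.cong ι (≡.sym (ℕₚ.m∸n+n≡m le)))) (ι-+ (a ℕ.∸ b) b))))
               (solve 2 (λ z b → (z :+ b) :- b := z) refl _ (ι b)))
      transfer : Dec (ι (a ℕ.∸ b) ≈ 0#) → Dec (z ≈ 0#)
      transfer (yes e) = yes (trans same e)
      transfer (no n) = no λ e → n (trans (sym same) e)
    ... | inj₂ le = transfer (d (b ℕ.∸ a))
      where
      same : z ≈ - ι (b ℕ.∸ a)
      same = trans (solve 2 (λ z b → z := (z :+ b) :- b) refl z (ι b)) (trans (+-cong eq (-‿cong
               (trans (reflexive (≡.cong ι (≡.sym (ℕₚ.m∸n+n≡m le)))) (ι-+ (b ℕ.∸ a) a))))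
               (solve 2 (λ z a → a :- (z :+ a) := :- z) refl _ (ι a)))
      transfer : Dec (ι (b ℕ.∸ a) ≈ 0#) → Dec (z ≈ 0#)
      transfer (yes e) = yes (trans same (trans (-‿cong e) -0#≈0#))
      transfer (no n) = no λ e → n (trans (sym (-‿involutive _)) (trans (-‿cong (trans (sym same) e)) -0#≈0#))

  primeField : ¬ ¬ Subfield
  primeField = do
    d ← ι-dec
    return (fractions integers λ { (Level.lift (a , b , eq)) → difference-dec d a b eq })

  module Coefficients (R : Subring) where
    open Subring R

    Coef  : NP i → Set (c ⊔ ℓ)
    CoefV : Vec (NP i) n → Set (c ⊔ ℓ)
    Coef (con₀ a) = In a
    Coef (poly as) = CoefV as
    CoefV [] = ⊤
    CoefV (a ∷ as) = Coef a × CoefV as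

    CoefM : MP i e → Set (c ⊔ ℓ)
    CoefM (as , l) = CoefV as × Coef l

    Coef-zer : Coef {i} zer
    Coef-zer {zero} = In-0
    Coef-zer {suc i} = tt

    Coef-cst : ∀ {a} → In a → Coef {i} (cst a)
    Coef-cst {zero} h = h
    Coef-cst {suc i} h = Coef-cst {i} h , tt

    Coef-add  : (p q : NP i) → Coef p → Coef q → Coef (add p q)
    CoefV-add : (as : Vec (NP i) n) (bs : Vec (NP i) m) → CoefV as → CoefV bs → CoefV (addV as bs)
    Coef-add (con₀ a) (con₀ b) h h′ = In-+ h h′
    Coef-add (poly as) (poly bs) h h′ = CoefV-add as bs h h′
    CoefV-add [] bs h h′ = h′
    CoefV-add (a ∷ as) [] h h′ = h
    CoefV-add (a ∷ as) (b ∷ bs) (x , xs) (y , ys) = Coef-add a b x y , CoefV-add as bs xs ys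

    Coef-mul    : (p q : NP i) → Coef p → Coef q → Coef (mul p q)
    Coef-mulP   : (as : Vec (NP i) n) (q : NP (suc i)) → CoefV as → Coef q → Coef (mulP as q)
    CoefV-scale : (a : NP i) (bs : Vec (NP i) n) → Coef a → CoefV bs → CoefV (scaleV a bs)
    Coef-mul (con₀ a) (con₀ b) h h′ = In-* h h′
    Coef-mul (poly as) q h h′ = Coef-mulP as q h h′
    Coef-mulP [] q h h′ = tt
    Coef-mulP {i = i} (a ∷ as) (poly bs) (h , hs) h′ = Coef-add (poly (scaleV a bs)) (shift (mulP as (poly bs)))
      (CoefV-scale a bs h h′) (Coef-shift (mulP as (poly bs)) (Coef-mulP as (poly bs) hs h′))
      where
      Coef-shift : (p : NP (suc i)) → Coef p → Coef (shift p)
      Coef-shift (poly cs) h = Coef-zer {i} , h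
    CoefV-scale a [] h h′ = tt
    CoefV-scale a (b ∷ bs) h (h′ , hs) = Coef-mul a b h h′ , CoefV-scale a bs h hs

    Coef-neg : (p : NP i) → Coef p → Coef (neg p)
    Coef-neg {i} p h = Coef-mul (cst (- 1#)) p (Coef-cst {i} (In-neg In-1)) h

    Coef-powP : (p : NP i) → Coef p → ∀ n → Coef (powP p n)
    Coef-powP {i} p h zero = Coef-cst {i} In-1
    Coef-powP p h (suc n) = Coef-mul p (powP p n) h (Coef-powP p h n)

    CoefV-sub : ∀ l (as : Vec (NP i) n) r bs → Coef l → CoefV as → Coef r → CoefV bs → CoefV (subV l as r bs)
    CoefV-sub l [] r [] _ _ _ _ = tt
    CoefV-sub l (a ∷ as) r (b ∷ bs) hl (ha , has) hr (hb , hbs) =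
      Coef-add (mul l a) (neg (mul r b)) (Coef-mul l a hl ha) (Coef-neg (mul r b) (Coef-mul r b hr hb))
      , CoefV-sub l as r bs hl has hr hbs

    CoefM-unsnoc : (as : Vec (NP i) (suc n)) → CoefV as → CoefM (unsnoc as)
    CoefM-unsnoc (a ∷ []) (h , _) = tt , h
    CoefM-unsnoc (a ∷ a′ ∷ as) (h , hs) with unsnoc (a′ ∷ as) | CoefM-unsnoc (a′ ∷ as) hs
    ... | cs , l | hcs , hl = (h , hcs) , hl

    CoefV-pad : ∀ e (as : Vec (NP i) n) → CoefV as → CoefV (padR e as)
    CoefV-pad zero [] h = tt
    CoefV-pad {i} (suc e) [] h = Coef-zer {i} , CoefV-pad {i} e [] h
    CoefV-pad e (a ∷ as) (h , hs) = h , CoefV-pad e as hs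

    Coef-prem : ∀ n (p : Vec (NP i) (n ℕ.+ e)) (g : MP i e) → CoefV p → CoefM g → CoefV (proj₂ (prem n p g))
    Coef-prem zero p g h hg = h
    Coef-prem (suc n) (a ∷ p) g (ha , hp) (has , hl) =
      CoefV-sub (lead g) (proj₁ top) (proj₂ top) (proj₁ g) hl (proj₁ htop) (proj₂ htop) has
      where
      v = mul (powP (lead g) n) a ∷ proj₂ (prem n p g)
      top = unsnoc v
      htop = CoefM-unsnoc v (Coef-mul (powP (lead g) n) a (Coef-powP (lead g) hl n) ha , Coef-prem n p g hp (has , hl))

    CoefP : Point i → Set (c ⊔ ℓ)
    CoefP [] = ⊤
    CoefP (t ∷ x) = In t × CoefP x

    Coef-ev  : (p : NP i) → Coef p → (x : Point i) → CoefP x → In (ev p x)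
    Coef-evV : (as : Vec (NP i) n) → CoefV as → ∀ t (x : Point i) → In t → CoefP x → In (evV as t x)
    Coef-ev (con₀ a) h x hx = h
    Coef-ev (poly as) h (t ∷ x) (ht , hx) = Coef-evV as h t x ht hx
    Coef-evV [] h t x ht hx = In-0
    Coef-evV (a ∷ as) (h , hs) t x ht hx = In-+ (Coef-ev a h x hx) (In-* ht (Coef-evV as hs t x ht hx))

  module Adjoin (k : Subfield) (a : Carrier) where
    open Subfield k
    open Coefficients subring

    polynomials : Subring
    polynomials = record
      { In = λ z → Σ (NP 1) λ p → Coef p × z ≈ ev p (a ∷ [])
      ; resp = λ e (p , h , eq) → p , h , trans (sym e) eq
      ; In-1 = cst 1# , Coef-cst {1} In-1 , sym (ev-cst 1# (a ∷ []))
      ; In-+ = λ (p , h , eq) (q , h′ , eq′) → add p q , Coef-add p q h h′ , trans (+-cong eq eq′) (sym (ev-add p q (a ∷ [])))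
      ; In-* = λ (p , h , eq) (q , h′ , eq′) → mul p q , Coef-mul p q h h′ , trans (*-cong eq eq′) (sym (ev-mul p q (a ∷ [])))
      ; In-neg = λ (p , h , eq) → neg p , Coef-neg p h , trans (-‿cong eq) (sym (ev-neg p (a ∷ [])))
      }

    Annihilator : ℕ → Set (c ⊔ ℓ)
    Annihilator e = Σ (MP 0 e) λ g → CoefM g × ¬ ev (lead g) [] ≈ 0# × VanM g a []

    stripK : ∀ n (as : Vec (NP 0) n) → CoefV as → Van as a [] ⊎
      (∃ λ e → e < n × Σ (MP 0 e) λ g → CoefM g × ¬ ev (lead g) [] ≈ 0# × evM g a [] ≈ evV as a [])
    stripK zero [] h = inj₁ refl
    stripK (suc n) as h with unsnoc as | CoefM-unsnoc as h | ev-unsnoc as a []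
    ... | cs , con₀ l | hcs , hl | eq with dec hl
    ...   | no nl = inj₂ (n , ℕₚ.≤-refl , (cs , con₀ l) , (hcs , hl) , nl , eq)
    ...   | yes z with stripK n cs hcs
    ...     | inj₁ v = inj₁ (trans (sym eq) (trans (evM'-0 cs _ a [] z) v))
    ...     | inj₂ (e , lt , g , hg , ng , eq′) = inj₂ (e , ℕₚ.m<n⇒m<1+n lt , g , hg , ng ,
                trans eq′ (trans (sym (evM'-0 cs _ a [] z)) eq))

    -- The only open question is whether `a` is algebraic, and of which degree. Without annihilator,
    -- a polynomial with a non-zero coefficient does not vanish at `a`; with one of least degree,
    -- the remainder modulo it decides.
    decides : ¬ ¬ (∀ n (as : Vec (NP 0) n) → CoefV as → Dec (Van as a []))
    decides = do
      inj₁ g₀ ← em (∃ Annihilator)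
        where inj₂ nope → return λ n as h → transcendental nope n as h
      (e , (g , hg , ng , vg) , min) ← least Annihilator g₀
      return λ n as h → algebraic e g hg ng vg min n as h
      where
      transcendental : ¬ ∃ Annihilator → ∀ n (as : Vec (NP 0) n) → CoefV as → Dec (Van as a [])
      transcendental nope n as h with stripK n as h
      ... | inj₁ v = yes v
      ... | inj₂ (e , _ , g , hg , ng , eq) = no λ v → nope (e , g , hg , ng , trans eq v)
      algebraic : ∀ e (g : MP 0 e) → CoefM g → ¬ ev (lead g) [] ≈ 0# → VanM g a [] → (∀ d → d < e → ¬ Annihilator d) →
        ∀ n (as : Vec (NP 0) n) → CoefV as → Dec (Van as a [])
      algebraic e g hg ng vg min n as h
        with stripK e (proj₂ (prem n (padR e as) g)) (Coef-prem n (padR e as) g (CoefV-pad e as h) hg)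
      ... | inj₁ v = yes (cancel≉ (^-≉0 n ng) (trans (*-congˡ (sym (ev-padR e as a [])))
              (trans (ev-prem n (padR e as) g a []) (0+0≈0 (x*0≈0 vg) v))))
      ... | inj₂ (d , lt , r , hr , nr , eq) = no λ v → min d lt (r , hr , nr , trans eq
              (trans (sym (trans (+-congʳ (x*0≈0 vg)) (+-identityˡ _))) (trans (sym (ev-prem n (padR e as) g a []))
                (x*0≈0 (trans (ev-padR e as a []) v)))))

    adjoin : ¬ ¬ (Σ Subfield λ k′ → (∀ {x} → In x → Subfield.In k′ x) × Subfield.In k′ a)
    adjoin = do
      d ← decides
      return (fractions polynomials (λ { (poly as , h , eq) → decide eq (d _ as h) })
        , (λ {x} h → x , 1# , (cst x , Coef-cst {1} h , sym (ev-cst x (a ∷ []))) , Subring.In-1 polynomials , 1≉0 , *-identityʳ x)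
        , a , 1# , (poly (con₀ 0# ∷ con₀ 1# ∷ []) , (In-0 , In-1 , tt) ,
             sym (trans (+-identityˡ _) (trans (*-congˡ (trans (+-congˡ (zeroʳ a)) (+-identityʳ 1#))) (*-identityʳ a))))
            , Subring.In-1 polynomials , 1≉0 , *-identityʳ a)
      where
      decide : ∀ {x y} → x ≈ y → Dec (y ≈ 0#) → Dec (x ≈ 0#)
      decide eq (yes z) = yes (trans eq z)
      decide eq (no n) = no λ z → n (trans (sym eq) z)

  -- Each adjunction costs one double negation, so any finite amount of data lies in a subfield with
  -- decidable equality.
  subfieldOver : (xs : List Carrier) → ¬ ¬ (Σ Subfield λ k → All (Subfield.In k) xs)
  subfieldOver [] = do
    k ← primeField
    return (k , [])
  subfieldOver (a ∷ xs) = do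
    (k , h) ← subfieldOver xs
    (k′ , up , ha) ← Adjoin.adjoin k a
    return (k′ , ha ∷ All.map up h)

  -- Linear algebra over a decidable subfield

  comb : Vec Carrier n → (A → Carrier) → Vec A n → Carrier
  comb [] f [] = 0#
  comb (d ∷ ds) f (v ∷ vs) = d * f v + comb ds f vs

  comb-cong : ∀ (ds : Vec Carrier n) {f g : A → Carrier} → (∀ v → f v ≈ g v) → ∀ vs → comb ds f vs ≈ comb ds g vs
  comb-cong [] e [] = refl
  comb-cong (d ∷ ds) e (v ∷ vs) = +-cong (*-congˡ (e v)) (comb-cong ds e vs)

  comb-linear : ∀ (ds : Vec Carrier n) (f g : A → Carrier) s vs →
    comb ds (λ v → f v + g v * s) vs ≈ comb ds f vs + comb ds g vs * s
  comb-linear [] f g s [] = sym (trans (+-congˡ (zeroˡ s)) (+-identityʳ 0#))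
  comb-linear (d ∷ ds) f g s (v ∷ vs) = trans (+-congˡ (comb-linear ds f g s vs))
    (solve 6 (λ d f g s p q → d :* (f :+ g :* s) :+ (p :+ q :* s) := (d :* f :+ p) :+ (d :* g :+ q) :* s) refl
       d (f v) (g v) s (comb ds f vs) (comb ds g vs))

  comb-map : ∀ (ds : Vec Carrier n) (f : B → Carrier) (g : A → B) vs → comb ds f (Vec.map g vs) ≈ comb ds (λ v → f (g v)) vs
  comb-map [] f g [] = refl
  comb-map (d ∷ ds) f g (v ∷ vs) = +-congˡ (comb-map ds f g vs)

  comb-zero : ∀ (ds : Vec Carrier n) {f : A → Carrier} vs → VAll (λ v → f v ≈ 0#) vs → comb ds f vs ≈ 0#
  comb-zero [] [] [] = refl
  comb-zero (d ∷ ds) (v ∷ vs) (z ∷ zs) = 0+0≈0 (x*0≈0 z) (comb-zero ds vs zs)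

  comb-zeros : ∀ (f : A → Carrier) (vs : Vec A n) → comb (Vec.replicate n 0#) f vs ≈ 0#
  comb-zeros f [] = refl
  comb-zeros f (v ∷ vs) = 0+0≈0 (zeroˡ _) (comb-zeros f vs)

  dot : Vec Carrier n → Vec Carrier n → Carrier
  dot b = comb b (λ x → x)

  dot-sub : ∀ (b u v : Vec Carrier n) s → dot b (Vec.zipWith (λ x y → x + y * s) u v) ≈ dot b u + dot b v * s
  dot-sub [] [] [] s = sym (trans (+-congˡ (zeroˡ s)) (+-identityʳ 0#))
  dot-sub (d ∷ b) (x ∷ u) (y ∷ v) s = trans (+-congˡ (dot-sub b u v s))
    (solve 6 (λ d f g s p q → d :* (f :+ g :* s) :+ (p :+ q :* s) := (d :* f :+ p) :+ (d :* g :+ q) :* s) refl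
       d x y s (dot b u) (dot b v))

  dot-zero : ∀ (a u : Vec Carrier n) → VAll (_≈ 0#) u → dot a u ≈ 0#
  dot-zero a u zs = comb-zero a u zs

  insert : A → ℕ → Vec A n → Vec A (suc n)
  insert a zero as = a ∷ as
  insert a (suc j) [] = a ∷ []
  insert a (suc j) (b ∷ bs) = b ∷ insert a j bs

  insert-all : ∀ {p} {P : A → Set p} {x} j (as : Vec A n) → P x → VAll P as → VAll P (insert x j as)
  insert-all zero as h hs = h ∷ hs
  insert-all (suc j) [] h hs = h ∷ []
  insert-all (suc j) (b ∷ bs) h (h′ ∷ hs) = h′ ∷ insert-all j bs h hs

  insert-any : ∀ {p} {P : A → Set p} {x} j {as : Vec A n} → VAny P as → VAny P (insert x j as)
  insert-any zero h = there h
  insert-any (suc j) (here h) = here h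
  insert-any (suc j) (there h) = there (insert-any j h)

  comb-insert : ∀ d (ds : Vec Carrier n) (f : A → Carrier) j v vs →
    comb (insert d j ds) f (insert v j vs) ≈ d * f v + comb ds f vs
  comb-insert d ds f zero v vs = refl
  comb-insert d [] f (suc j) v [] = refl
  comb-insert d (x ∷ ds) f (suc j) v (w ∷ vs) = trans (+-congˡ (comb-insert d ds f j v vs))
    (solve 3 (λ a b c → a :+ (b :+ c) := b :+ (a :+ c)) refl (x * f w) (d * f v) (comb ds f vs))

  module LinearAlgebra (k : Subfield) where
    open Subfield k

    InV : Vec Carrier n → Set (c ⊔ ℓ)
    InV = VAll In

    In-comb : {ds : Vec Carrier n} {f : A → Carrier} {vs : Vec A n} → InV ds → VAll (λ v → In (f v)) vs → In (comb ds f vs)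
    In-comb [] [] = In-0
    In-comb (h ∷ hs) (h′ ∷ hs′) = In-+ (In-* h h′) (In-comb hs hs′)

    data Pivot : Vec (Vec Carrier (suc κ)) n → Set (c ⊔ ℓ) where
      none : {vs : Vec (Vec Carrier (suc κ)) n} → VAll (λ v → Vec.head v ≈ 0#) vs → Pivot vs
      at   : ∀ {v} (j : ℕ) (vs : Vec (Vec Carrier (suc κ)) n) → ¬ Vec.head v ≈ 0# → InV v → VAll InV vs → Pivot (insert v j vs)

    pivot : (vs : Vec (Vec Carrier (suc κ)) n) → VAll InV vs → Pivot vs
    pivot [] [] = none []
    pivot ((x ∷ v) ∷ vs) ((h ∷ hv) ∷ hs) with dec h
    ... | no nx = at 0 vs nx (h ∷ hv) hs
    ... | yes zx with pivot vs hs
    ...   | none zs = none (zx ∷ zs)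
    ...   | at j ws nv hw hws = at (suc j) ((x ∷ v) ∷ ws) nv hw ((h ∷ hv) ∷ hws)

    -- The coefficients `ds` lie in the decidable subfield, while the relation may be paired with
    -- any vector `b` over `K`.
    Dependent : Vec (Vec Carrier κ) n → Set (c ⊔ ℓ)
    Dependent {κ} {n} vs = ∃ λ (ds : Vec Carrier n) → InV ds × VAny (λ d → ¬ d ≈ 0#) ds × (∀ b → comb ds (dot b) vs ≈ 0#)

    dependent : ∀ κ {n} → κ < n → (vs : Vec (Vec Carrier κ) n) → VAll InV vs → Dependent vs
    dependent zero (s≤s _) (v ∷ vs) hs = 1# ∷ Vec.map (λ _ → 0#) vs , In-1 ∷ zeros vs , here 1≉0 , λ { [] →
        comb-zero (1# ∷ Vec.map (λ _ → 0#) vs) (v ∷ vs) (all (v ∷ vs)) }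
      where
      zeros : (vs : Vec A n) → InV (Vec.map (λ _ → 0#) vs)
      zeros [] = []
      zeros (v ∷ vs) = In-0 ∷ zeros vs
      all : (vs : Vec (Vec Carrier 0) n) → VAll (λ v → dot [] v ≈ 0#) vs
      all [] = []
      all ([] ∷ vs) = refl ∷ all vs
    dependent (suc κ) (s≤s lt) vs hs with pivot vs hs
    ... | none zs = let (ds , hds , nz , z) = dependent κ (ℕₚ.m<n⇒m<1+n lt) (Vec.map Vec.tail vs) (tails hs) in
        ds , hds , nz , λ { (x ∷ b) → begin
          comb ds (dot (x ∷ b)) vs ≈⟨ comb-cong ds (λ { (y ∷ v) → +-comm (x * y) _ }) vs ⟩
          comb ds (λ v → dot b (Vec.tail v) + x * Vec.head v) vs ≈⟨ comb-cong ds (λ v → +-congˡ (*-comm x _)) vs ⟩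
          comb ds (λ v → dot b (Vec.tail v) + Vec.head v * x) vs ≈⟨ comb-linear ds _ Vec.head x vs ⟩
          comb ds (λ v → dot b (Vec.tail v)) vs + comb ds Vec.head vs * x
            ≈⟨ 0+0≈0 (trans (sym (comb-map ds (dot b) Vec.tail vs)) (z b)) (0*x≈0 (comb-zero ds vs zs)) ⟩
          0# ∎ }
      where
      tails : {vs : Vec (Vec Carrier (suc κ)) n} → VAll InV vs → VAll InV (Vec.map Vec.tail vs)
      tails [] = []
      tails {vs = (x ∷ v) ∷ vs} ((_ ∷ h) ∷ hs) = h ∷ tails hs
    ... | at {v = y ∷ v} j ws ny (hy ∷ hv) hws = insert d₀ j ds , insert-all j ds hd₀ hds , insert-any j nz , vanish
      where
      u = proj₁ (inverse y ny)
      yu : y * u ≈ 1#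
      yu = proj₂ (inverse y ny)
      hu : In u
      hu = In-inv hy yu
      eliminate : Vec Carrier (suc κ) → Vec Carrier κ
      eliminate w = Vec.zipWith (λ p q → p + q * (- (Vec.head w * u))) (Vec.tail w) v
      zip-In : ∀ {s} {p q : Vec Carrier n} → In s → InV p → InV q → InV (Vec.zipWith (λ p q → p + q * s) p q)
      zip-In hs [] [] = []
      zip-In hs (h ∷ hp) (h′ ∷ hq) = In-+ h (In-* h′ hs) ∷ zip-In hs hp hq
      eliminated : {ws : Vec (Vec Carrier (suc κ)) n} → VAll InV ws → VAll InV (Vec.map eliminate ws)
      eliminated [] = []
      eliminated {ws = (x ∷ w) ∷ ws} ((h ∷ hw) ∷ hws) = zip-In (In-neg (In-* h hu)) hw hv ∷ eliminated hws
      dep = dependent κ lt (Vec.map eliminate ws) (eliminated hws)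
      ds = proj₁ dep
      hds = proj₁ (proj₂ dep)
      nz = proj₁ (proj₂ (proj₂ dep))
      z = proj₂ (proj₂ (proj₂ dep))
      H = comb ds Vec.head ws
      -- The multiple of the pivot row that cancels the first entry `H` left by the relation among
      -- the other rows.
      d₀ = - (H * u)
      heads : ∀ {n} {ws : Vec (Vec Carrier (suc κ)) n} → VAll InV ws → VAll (λ w → In (Vec.head w)) ws
      heads [] = []
      heads {ws = (x ∷ w) ∷ ws} ((h ∷ _) ∷ hs) = h ∷ heads hs
      hd₀ : In d₀
      hd₀ = In-neg (In-* (In-comb hds (heads hws)) hu)
      vanish : ∀ b → comb (insert d₀ j ds) (dot b) (insert (y ∷ v) j ws) ≈ 0#
      vanish (x ∷ b) = begin
        comb (insert d₀ j ds) (dot (x ∷ b)) (insert (y ∷ v) j ws) ≈⟨ comb-insert d₀ ds (dot (x ∷ b)) j (y ∷ v) ws ⟩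
        d₀ * (x * y + Δ) + comb ds (dot (x ∷ b)) ws
          ≈⟨ +-congˡ (trans (comb-cong ds (λ { (p ∷ w) → trans (+-comm (x * p) _) (+-congˡ (*-comm x p)) }) ws) (comb-linear ds _ Vec.head x ws)) ⟩
        d₀ * (x * y + Δ) + (T + H * x)
          ≈⟨ solve 6 (λ h u x y d t → :- (h :* u) :* (x :* y :+ d) :+ (t :+ h :* x) :=
               (t :+ h :* (:- (u :* d))) :+ (h :* x :- (h :* x) :* (y :* u))) refl H u x y Δ T ⟩
        (T + H * (- (u * Δ))) + (H * x + - ((H * x) * (y * u)))
          ≈⟨ +-cong (sym (comb-linear ds _ Vec.head _ ws)) (trans (+-congˡ (-‿cong (trans (*-congˡ yu) (*-identityʳ _)))) (-‿inverseʳ _)) ⟩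
        comb ds (λ w → dot b (Vec.tail w) + Vec.head w * (- (u * Δ))) ws + 0#
          ≈⟨ +-identityʳ _ ⟩
        comb ds (λ w → dot b (Vec.tail w) + Vec.head w * (- (u * Δ))) ws
          ≈⟨ comb-cong ds (λ w → trans (+-congˡ (solve 3 (λ h u d → h :* (:- (u :* d)) := d :* (:- (h :* u))) refl (Vec.head w) u Δ))
               (sym (dot-sub b (Vec.tail w) v _))) ws ⟩
        comb ds (λ w → dot b (eliminate w)) ws ≈⟨ sym (comb-map ds (dot b) eliminate ws) ⟩
        comb ds (dot b) (Vec.map eliminate ws) ≈⟨ z b ⟩
        0# ∎
        where
        Δ = dot b v
        T = comb ds (λ w → dot b (Vec.tail w)) ws

    -- Algebraic elements

    Span : List Carrier → Carrier → Set (c ⊔ ℓ)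
    Span [] z = z ≈ 0# × ⊤ {c}
    Span (b ∷ bs) z = ∃ λ a → In a × ∃ λ w → Span bs w × z ≈ a * b + w

    Span-resp : ∀ bs {z w} → z ≈ w → Span bs z → Span bs w
    Span-resp [] e (h , _) = trans (sym e) h , tt
    Span-resp (b ∷ bs) e (a , ha , w , hw , eq) = a , ha , w , hw , trans (sym e) eq

    Span-0 : ∀ bs → Span bs 0#
    Span-0 [] = refl , tt
    Span-0 (b ∷ bs) = 0# , In-0 , 0# , Span-0 bs , sym (0+0≈0 (zeroˡ b) refl)

    Span-+ : ∀ bs {z w} → Span bs z → Span bs w → Span bs (z + w)
    Span-+ [] (h , _) (h′ , _) = 0+0≈0 h h′ , tt
    Span-+ (b ∷ bs) (a , ha , w , hw , eq) (a′ , ha′ , w′ , hw′ , eq′) = a + a′ , In-+ ha ha′ , w + w′ , Span-+ bs hw hw′ ,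
      trans (+-cong eq eq′) (solve 5 (λ a a′ b w w′ → (a :* b :+ w) :+ (a′ :* b :+ w′) := (a :+ a′) :* b :+ (w :+ w′)) refl a a′ b w w′)

    Span-* : ∀ bs {s z} → In s → Span bs z → Span bs (s * z)
    Span-* [] hs (h , _) = x*0≈0 h , tt
    Span-* (b ∷ bs) {s} hs (a , ha , w , hw , eq) = s * a , In-* hs ha , s * w , Span-* bs hs hw ,
      trans (*-congˡ eq) (solve 4 (λ s a b w → s :* (a :* b :+ w) := (s :* a) :* b :+ s :* w) refl s a b w)

    Span-neg : ∀ bs {z} → Span bs z → Span bs (- z)
    Span-neg bs {z} h = Span-resp bs (trans (sym (-‿distribˡ-* 1# z)) (-‿cong (*-identityˡ z))) (Span-* bs (In-neg In-1) h)

    Span-++ˡ : ∀ bs bs′ {z} → Span bs z → Span (bs ++ bs′) z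
    Span-++ˡ [] bs′ (h , _) = Span-resp bs′ (sym h) (Span-0 bs′)
    Span-++ˡ (b ∷ bs) bs′ (a , ha , w , hw , eq) = a , ha , w , Span-++ˡ bs bs′ hw , eq

    Span-++ʳ : ∀ bs bs′ {z} → Span bs′ z → Span (bs ++ bs′) z
    Span-++ʳ [] bs′ h = h
    Span-++ʳ (b ∷ bs) bs′ {z} h = 0# , In-0 , z , Span-++ʳ bs bs′ h , sym (trans (+-congʳ (zeroˡ b)) (+-identityˡ z))

    Span-++⁻ : ∀ bs bs′ {z} → Span (bs ++ bs′) z → ∃ λ v → ∃ λ w → Span bs v × Span bs′ w × z ≈ v + w
    Span-++⁻ [] bs′ {z} h = 0# , z , (refl , tt) , h , sym (+-identityˡ z)
    Span-++⁻ (b ∷ bs) bs′ (a , ha , w , hw , eq) = let (u , v , hu , hv , eq′) = Span-++⁻ bs bs′ hw in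
      a * b + u , v , (a , ha , u , hu , refl) , hv , trans eq (trans (+-congˡ eq′) (sym (+-assoc _ _ _)))

    Span-map : ∀ t bs {z} → Span bs z → Span (L.map (t *_) bs) (t * z)
    Span-map t [] (h , _) = x*0≈0 h , tt
    Span-map t (b ∷ bs) (a , ha , w , hw , eq) = a , ha , t * w , Span-map t bs hw ,
      trans (*-congˡ eq) (solve 4 (λ t a b w → t :* (a :* b :+ w) := a :* (t :* b) :+ t :* w) refl t a b w)

    Span-map⁻ : ∀ t bs {z} → Span (L.map (t *_) bs) z → ∃ λ w → Span bs w × z ≈ t * w
    Span-map⁻ t [] (h , _) = 0# , (refl , tt) , trans h (sym (zeroʳ t))
    Span-map⁻ t (b ∷ bs) (a , ha , w , hw , eq) = let (v , hv , eq′) = Span-map⁻ t bs hw in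
      a * b + v , (a , ha , v , hv , refl) ,
      trans eq (trans (+-congˡ eq′) (solve 4 (λ t a b w → a :* (t :* b) :+ t :* w := t :* (a :* b :+ w)) refl t a b v))

    infixl 7 _⊗_
    _⊗_ : List Carrier → List Carrier → List Carrier
    [] ⊗ bs′ = []
    (b ∷ bs) ⊗ bs′ = L.map (b *_) bs′ ++ bs ⊗ bs′

    Span-⊗ : ∀ bs bs′ {z z′} → Span bs z → Span bs′ z′ → Span (bs ⊗ bs′) (z * z′)
    Span-⊗ [] bs′ (h , _) h′ = 0*x≈0 h , tt
    Span-⊗ (b ∷ bs) bs′ {z′ = z′} (a , ha , w , hw , eq) h′ =
      Span-resp (L.map (b *_) bs′ ++ bs ⊗ bs′) (sym (trans (*-congʳ eq)
          (solve 4 (λ a b w z → (a :* b :+ w) :* z := b :* (a :* z) :+ w :* z) refl a b w z′)))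
        (Span-+ (L.map (b *_) bs′ ++ bs ⊗ bs′)
          (Span-++ˡ (L.map (b *_) bs′) (bs ⊗ bs′) (Span-map b bs′ (Span-* bs′ ha h′)))
          (Span-++ʳ (L.map (b *_) bs′) (bs ⊗ bs′) (Span-⊗ bs bs′ hw h′)))

    Stable : List Carrier → Carrier → Set (c ⊔ ℓ)
    Stable bs x = ∀ z → Span bs z → Span bs (x * z)

    Stable-⊗ˡ : ∀ bs bs′ {x} → Stable bs x → Stable (bs ⊗ bs′) x
    Stable-⊗ʳ : ∀ bs bs′ {x} → Stable bs′ x → Stable (bs ⊗ bs′) x
    ⊗-ind : ∀ bs bs′ {p} (P : Carrier → Set p) → (∀ {z w} → z ≈ w → P z → P w) → P 0# → (∀ {z w} → P z → P w → P (z + w)) →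
      (∀ {v w} → Span bs v → Span bs′ w → P (v * w)) → ∀ {z} → Span (bs ⊗ bs′) z → P z
    ⊗-ind [] bs′ P rs p0 p+ p* (h , _) = rs (sym h) p0
    ⊗-ind (b ∷ bs) bs′ P rs p0 p+ p* h =
      let (u , v , hu , hv , eq) = Span-++⁻ (L.map (b *_) bs′) (bs ⊗ bs′) h
          (w , hw , eq′) = Span-map⁻ b bs′ hu
      in rs (sym (trans eq (+-congʳ eq′))) (p+
           (p* (1# , In-1 , 0# , Span-0 bs , sym (trans (+-identityʳ _) (*-identityˡ b))) hw)
           (⊗-ind bs bs′ P rs p0 p+ (λ {v} hv hw → p* (0# , In-0 , v , hv , sym (trans (+-congʳ (zeroˡ b)) (+-identityˡ v))) hw) hv))
    Stable-⊗ˡ bs bs′ {x} st z = ⊗-ind bs bs′ (λ z → Span (bs ⊗ bs′) (x * z))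
      (λ e → Span-resp (bs ⊗ bs′) (*-congˡ e)) (Span-resp (bs ⊗ bs′) (sym (zeroʳ x)) (Span-0 (bs ⊗ bs′)))
      (λ p q → Span-resp (bs ⊗ bs′) (sym (distribˡ x _ _)) (Span-+ (bs ⊗ bs′) p q))
      (λ {v} {w} hv hw → Span-resp (bs ⊗ bs′) (*-assoc x v w) (Span-⊗ bs bs′ (st v hv) hw))
    Stable-⊗ʳ bs bs′ {x} st z = ⊗-ind bs bs′ (λ z → Span (bs ⊗ bs′) (x * z))
      (λ e → Span-resp (bs ⊗ bs′) (*-congˡ e)) (Span-resp (bs ⊗ bs′) (sym (zeroʳ x)) (Span-0 (bs ⊗ bs′)))
      (λ p q → Span-resp (bs ⊗ bs′) (sym (distribˡ x _ _)) (Span-+ (bs ⊗ bs′) p q))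
      (λ {v} {w} hv hw → Span-resp (bs ⊗ bs′) (solve 3 (λ x v w → v :* (x :* w) := x :* (v :* w)) refl x v w) (Span-⊗ bs bs′ hv (st w hw)))

    -- In this form of algebraicity, closure under the ring operations needs no minimal polynomials.
    Algebraic : Carrier → Set (c ⊔ ℓ)
    Algebraic x = ∃ λ bs → Span bs 1# × Stable bs x

    Span-1⊗1 : ∀ bs bs′ → Span bs 1# → Span bs′ 1# → Span (bs ⊗ bs′) 1#
    Span-1⊗1 bs bs′ h h′ = Span-resp (bs ⊗ bs′) (*-identityˡ 1#) (Span-⊗ bs bs′ h h′)

    algebraics : Subring
    algebraics = record
      { In = Algebraic
      ; resp = λ { e (bs , h1 , st) → bs , h1 , λ z hz → Span-resp bs (*-congʳ e) (st z hz) }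
      ; In-1 = 1# ∷ [] , one′ , λ z → Span-resp (1# ∷ []) (sym (*-identityˡ z))
      ; In-+ = λ { (bs , h , st) (bs′ , h′ , st′) → bs ⊗ bs′ , Span-1⊗1 bs bs′ h h′ , λ z hz →
          Span-resp (bs ⊗ bs′) (sym (distribʳ z _ _)) (Span-+ (bs ⊗ bs′) (Stable-⊗ˡ bs bs′ st z hz) (Stable-⊗ʳ bs bs′ st′ z hz)) }
      ; In-* = λ { (bs , h , st) (bs′ , h′ , st′) → bs ⊗ bs′ , Span-1⊗1 bs bs′ h h′ , λ z hz →
          Span-resp (bs ⊗ bs′) (sym (*-assoc _ _ z)) (Stable-⊗ˡ bs bs′ st _ (Stable-⊗ʳ bs bs′ st′ z hz)) }
      ; In-neg = λ { {x} (bs , h , st) → bs , h , λ z hz → Span-resp bs (-‿distribˡ-* x z) (Span-neg bs (st z hz)) }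
      }
      where
      one′ : Span (1# ∷ []) 1#
      one′ = 1# , In-1 , 0# , (refl , tt) , sym (trans (+-identityʳ _) (*-identityˡ 1#))

    module Ω = Subring algebraics

    In⇒Algebraic : ∀ {x} → In x → Algebraic x
    In⇒Algebraic h = 1# ∷ [] , (1# , In-1 , 0# , (refl , tt) , sym (trans (+-identityʳ _) (*-identityˡ 1#))) , λ z → Span-* (1# ∷ []) h

    jointly : (xs : Vec Carrier n) → VAll Algebraic xs → ∃ λ bs → Span bs 1# × VAll (Stable bs) xs
    jointly [] [] = let (bs , h , _) = Ω.In-1 in bs , h , []
    jointly (x ∷ xs) ((bs , h , st) ∷ hs) = let (bs′ , h′ , sts) = jointly xs hs in
      bs ⊗ bs′ , Span-1⊗1 bs bs′ h h′ , Stable-⊗ˡ bs bs′ st ∷ VAll.map (Stable-⊗ʳ bs bs′) sts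

    coords : ∀ bs {z} → Span bs z → ∃ λ (v : Vec Carrier (L.length bs)) → InV v × z ≈ dot (Vec.fromList bs) v
    coords [] (h , _) = [] , [] , h
    coords (b ∷ bs) (a , ha , w , hw , eq) = let (v , hv , eq′) = coords bs hw in
      a ∷ v , ha ∷ hv , trans eq (+-cong (*-comm a b) eq′)

    evU : Vec Carrier n → Carrier → Carrier
    evU = evalUni K

    -- The vectors are the coordinates of `z`, `x z`, `x² z` and so on; a linear relation among them
    -- is a polynomial in `x` annihilating `z`.
    krylov : ∀ bs {x z} n → Stable bs x → Span bs z → ∃ λ (vs : Vec (Vec Carrier (L.length bs)) n) →
      VAll InV vs × (∀ ds → evU ds x * z ≈ comb ds (dot (Vec.fromList bs)) vs)
    krylov bs zero st hz = [] , [] , λ { [] → zeroˡ _ }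
    krylov bs {x} {z} (suc n) st hz =
      let (v , hv , eq) = coords bs hz
          (vs , hvs , eqs) = krylov bs n st (st z hz)
      in v ∷ vs , hv ∷ hvs , λ { (d ∷ ds) → trans
           (solve 4 (λ d x e z → (d :+ x :* e) :* z := d :* z :+ e :* (x :* z)) refl d x (evU ds x) z)
           (+-cong (*-congˡ eq) (eqs ds)) }

    evU-alg : ∀ {x} → Algebraic x → (ds : Vec Carrier n) → InV ds → Algebraic (evU ds x)
    evU-alg hx [] [] = Ω.In-0
    evU-alg hx (d ∷ ds) (h ∷ hs) = Ω.In-+ (In⇒Algebraic h) (Ω.In-* hx (evU-alg hx ds hs))

    -- The lowest non-zero coefficient can be found because the coefficients are decidable, although
    -- `x` is not.
    lowTerm : ∀ {x} → Algebraic x → (ds : Vec Carrier n) → InV ds → VAny (λ d → ¬ d ≈ 0#) ds →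
      ∃ λ j → ∃ λ r → ∃ λ h → In r × ¬ r ≈ 0# × Algebraic h × evU ds x ≈ x ^ j * (r + x * h)
    lowTerm {x = x} hx (d ∷ ds) (h ∷ hs) nz with dec h
    ... | no nd = 0 , d , evU ds x , h , nd , evU-alg hx ds hs , sym (*-identityˡ _)
    ... | yes zd with nz
    ...   | here nd = ⊥-elim (nd zd)
    ...   | there nz′ = let (j , r , u , hr , nr , hu , eq) = lowTerm hx ds hs nz′ in
        suc j , r , u , hr , nr , hu , trans (+-congʳ zd) (trans (+-identityˡ _) (trans (*-congˡ eq) (sym (*-assoc _ _ _))))

    -- More than `length bs` powers of `x` are dependent, and the lowest term of the relation
    -- exhibits `x^j` as a multiple of `x^(j+1)`. This holds uniformly, without deciding whether `x`
    -- is zero.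
    descends : ∀ {x} → Algebraic x → ∃ λ j → ∃ λ y → Algebraic y × x ^ j * (1# + - (x * y)) ≈ 0#
    descends {x} hx@(bs , h1 , st) =
      let (vs , hvs , eqs) = krylov bs (suc (L.length bs)) st h1
          (ds , hds , nz , z) = dependent (L.length bs) ℕₚ.≤-refl vs hvs
          (j , r , h , hr , nr , hh , eq) = lowTerm hx ds hds nz
          (u , ru) = inverse r nr
          z′ : x ^ j * (r + x * h) ≈ 0#
          z′ = trans (sym eq) (trans (sym (*-identityʳ _)) (trans (eqs ds) (z (Vec.fromList bs))))
      in j , - (h * u) , Ω.In-neg (Ω.In-* hh (In⇒Algebraic (In-inv hr ru))) , (begin
        x ^ j * (1# + - (x * - (h * u))) ≈⟨ *-congˡ (+-congʳ (sym ru)) ⟩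
        x ^ j * (r * u + - (x * - (h * u)))
          ≈⟨ solve 5 (λ p r u x h → p :* (r :* u :- x :* (:- (h :* u))) := (p :* (r :+ x :* h)) :* u) refl (x ^ j) r u x h ⟩
        (x ^ j * (r + x * h)) * u ≈⟨ 0*x≈0 z′ ⟩
        0# ∎)

    Algebraic-inv : ∀ {x y} → Algebraic x → x * y ≈ 1# → Algebraic y
    Algebraic-inv {x} {y} hx xy =
      let (j , w , hw , z) = descends hx
          xw : 1# ≈ x * w
          xw = x-y≈0 (cancel≉ (^-≉0 j (unit≉0 xy)) z)
      in Ω.resp (begin
        w ≈⟨ sym (*-identityˡ w) ⟩
        1# * w ≈⟨ *-congʳ (sym xy) ⟩
        (x * y) * w ≈⟨ solve 3 (λ x y w → (x :* y) :* w := y :* (x :* w)) refl x y w ⟩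
        y * (x * w) ≈⟨ *-congˡ (sym xw) ⟩
        y * 1# ≈⟨ *-identityʳ y ⟩
        y ∎) hw

    tower : Carrier → List Carrier → ℕ → List Carrier
    tower t bs zero = []
    tower t bs (suc n) = bs ++ L.map (t *_) (tower t bs n)

    evMonic : Carrier → Vec Carrier n → Carrier
    evMonic t [] = 1#
    evMonic t (a ∷ as) = a + t * evMonic t as

    module _ (t : Carrier) (bs : List Carrier) where
      W : ℕ → Carrier → Set (c ⊔ ℓ)
      W n = Span (tower t bs n)

      W-cons : ∀ n {v w} → Span bs v → W n w → W (suc n) (v + t * w)
      W-cons n hv hw = Span-+ (tower t bs (suc n)) (Span-++ˡ bs _ hv) (Span-++ʳ bs _ (Span-map t (tower t bs n) hw))

      W-uncons : ∀ n {z} → W (suc n) z → ∃ λ v → ∃ λ w → Span bs v × W n w × z ≈ v + t * w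
      W-uncons n hz = let (v , w , hv , hw , eq) = Span-++⁻ bs _ hz
                          (u , hu , eq′) = Span-map⁻ t (tower t bs n) hw
                      in v , u , hv , hu , trans eq (+-congˡ eq′)

      W-base : ∀ n {v} → Span bs v → W (suc n) v
      W-base n hv = Span-++ˡ bs _ hv

      W-shift : ∀ n {z} → W n z → ∃ λ w → ∃ λ v → W n w × Span bs v × t * z ≈ w + t ^ n * v
      W-shift zero (h , _) = 0# , 0# , (refl , tt) , Span-0 bs , trans (x*0≈0 h) (sym (0+0≈0 refl (zeroʳ _)))
      W-shift (suc zero) hz = let (v , w , hv , (hw , _) , eq) = W-uncons 0 hz in
        0# , v , Span-0 (tower t bs 1) , hv ,
        trans (*-congˡ (trans eq (trans (+-congˡ (x*0≈0 hw)) (+-identityʳ v))))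
          (sym (trans (+-identityˡ _) (*-congʳ (*-identityʳ t))))
      W-shift (suc (suc n)) hz =
        let (v , w , hv , hw , eq) = W-uncons (suc n) hz
            (u , v′ , hu , hv′ , eq′) = W-shift (suc n) hw
        in 0# + t * (v + u) , v′ , W-cons (suc n) (Span-0 bs) (Span-+ (tower t bs (suc n)) (W-base n hv) hu) , hv′ ,
           trans (*-congˡ (trans eq (+-congˡ eq′)))
             (trans (solve 4 (λ t v u q → t :* (v :+ (u :+ q)) := t :* (v :+ u) :+ t :* q) refl t v u (t ^ suc n * v′))
               (+-cong (sym (+-identityˡ _)) (sym (*-assoc t _ v′))))

      W-monic : (as : Vec Carrier n) → VAll (Stable bs) as → ∀ {v} → Span bs v →
        ∃ λ u → W n u × evMonic t as * v ≈ u + t ^ n * v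
      W-monic [] [] hv = 0# , (refl , tt) , sym (+-identityˡ _)
      W-monic {n = suc n} (a ∷ as) (st ∷ sts) {v} hv = let (u , hu , eq) = W-monic as sts hv in
        a * v + t * u , W-cons n (st v hv) hu ,
        trans (solve 4 (λ a t m v → (a :+ t :* m) :* v := a :* v :+ t :* (m :* v)) refl a t (evMonic t as) v)
          (trans (+-congˡ (*-congˡ eq))
            (solve 5 (λ x t u p v → x :+ t :* (u :+ p :* v) := (x :+ t :* u) :+ (t :* p) :* v) refl (a * v) t u (t ^ n) v))

      -- Multiplication by `t` leaves the span only through the power `t^(n+1)`, which the monic
      -- equation expresses by lower ones.
      W-stable : (as : Vec Carrier (suc n)) → VAll (Stable bs) as → evMonic t as ≈ 0# → Stable (tower t bs (suc n)) t
      W-stable {n} as sts z x hx =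
        let (w , v , hw , hv , eq) = W-shift (suc n) hx
            (u , hu , eq′) = W-monic as sts hv
        in Span-resp (tower t bs (suc n)) (sym (trans eq (+-congˡ (x-y≈0 (begin
             t ^ suc n * v + - - u ≈⟨ +-congˡ (-‿involutive u) ⟩
             t ^ suc n * v + u ≈⟨ +-comm _ _ ⟩
             u + t ^ suc n * v ≈⟨ sym eq′ ⟩
             evMonic t as * v ≈⟨ 0*x≈0 z ⟩
             0# ∎)))))
           (Span-+ (tower t bs (suc n)) hw (Span-neg (tower t bs (suc n)) hu))

    monic-root : ∀ {t} (as : Vec Carrier (suc n)) → VAll Algebraic as → evMonic t as ≈ 0# → Algebraic t
    monic-root {n = n} {t} as hs z = let (bs , h1 , sts) = jointly as hs in
      tower t bs (suc n) , W-base t bs n h1 , W-stable t bs as sts z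

    open Coefficients algebraics public using () renaming (CoefM to AlgM; CoefV to AlgV; Coef to Alg; CoefP to AlgP; Coef-ev to Alg-ev)

    algebraic-root : ∀ {i e} (g : MP i (suc e)) x → AlgM g → AlgP x → ¬ ev (lead g) x ≈ 0# → ∀ {t} → VanM g t x → Algebraic t
    algebraic-root {i} g x (has , hl) hx nl {t} v = monic-root (normalise (proj₁ g)) (normal-alg (proj₁ g) has)
        (trans (normal-eq (proj₁ g)) (0*x≈0 v))
      where
      u = proj₁ (inverse _ nl)
      lu : ev (lead g) x * u ≈ 1#
      lu = proj₂ (inverse _ nl)
      normalise : Vec (NP i) n → Vec Carrier n
      normalise [] = []
      normalise (a ∷ as) = ev a x * u ∷ normalise as
      normal-alg : (as : Vec (NP i) n) → AlgV as → VAll Algebraic (normalise as)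
      normal-alg [] _ = []
      normal-alg (a ∷ as) (h , hs) = Ω.In-* (Alg-ev a h x hx) (Algebraic-inv (Alg-ev (lead g) hl x hx) lu) ∷ normal-alg as hs
      normal-eq : (as : Vec (NP i) n) → evMonic t (normalise as) ≈ evM (as , lead g) t x * u
      normal-eq [] = sym lu
      normal-eq (a ∷ as) = trans (+-congˡ (*-congˡ (normal-eq as)))
        (solve 4 (λ a u t m → a :* u :+ t :* (m :* u) := (a :+ t :* m) :* u) refl (ev a x) u t (evM (as , lead g) t x))

    -- Linear maps with algebraic entries

    Nilpotent : Carrier → Set ℓ
    Nilpotent z = ∃ λ n → z ^ n ≈ 0#

    nilpotent≈0 : ∀ {z} → Nilpotent z → ¬ ¬ z ≈ 0#
    nilpotent≈0 (n , zn) nz = ^-≉0 n nz zn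

    -- By `descends`, multiplication by `q = x y` fixes `x^j`, hence also `q^j`, which is therefore
    -- idempotent and fixes `x^j` in turn; so its complement times `x` is nilpotent.
    support : ∀ {x} → Algebraic x → ∃ λ s → Algebraic s × (s * x) * (s * x) ≈ s * x × Nilpotent ((1# + - (s * x)) * x)
    support {x} hx =
      let (j , y , hy , z) = descends hx
          p = x ^ j
          q = x * y
          r = q ^ j
          pq : p * q ≈ p
          pq = sym (x-y≈0 (trans (trans (+-congʳ (sym (*-identityʳ p)))
                 (solve 3 (λ p q o → p :* o :- p :* q := p :* (o :- q)) refl p q 1#)) z))
          pr : ∀ n → p * q ^ n ≈ p
          pr n = powers p q pq n
          rq : r * q ≈ r
          rq = trans (*-congʳ (^-* x y j)) (trans (solve 3 (λ p u q → (p :* u) :* q := (p :* q) :* u) refl p (y ^ j) q)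
                 (trans (*-congʳ pq) (sym (^-* x y j))))
          f = r * q
          ff : f * f ≈ f
          ff = trans (*-congʳ rq) (trans (sym (*-assoc r r q)) (*-congʳ (powers r q rq j)))
          s = r * y
          sx : s * x ≈ f
          sx = solve 3 (λ r y x → (r :* y) :* x := r :* (x :* y)) refl r y x
      in s , Ω.In-* (alg-^ (Ω.In-* hx hy) j) hy
       , trans (*-cong sx sx) (trans ff (sym sx))
       , (suc j , (begin
           ((1# + - (s * x)) * x) * ((1# + - (s * x)) * x) ^ j ≈⟨ *-congˡ (^-* _ x j) ⟩
           ((1# + - (s * x)) * x) * ((1# + - (s * x)) ^ j * p)
             ≈⟨ solve 4 (λ a x b p → (a :* x) :* (b :* p) := (p :* a) :* (x :* b)) refl _ x _ p ⟩
           (p * (1# + - (s * x))) * (x * (1# + - (s * x)) ^ j)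
             ≈⟨ 0*x≈0 (begin
                 p * (1# + - (s * x)) ≈⟨ *-congˡ (+-congˡ (-‿cong (trans sx rq))) ⟩
                 p * (1# + - r) ≈⟨ solve 3 (λ p o r → p :* (o :- r) := p :* o :- p :* r) refl p 1# r ⟩
                 p * 1# + - (p * r) ≈⟨ +-cong (*-identityʳ p) (-‿cong (pr j)) ⟩
                 p + - p ≈⟨ -‿inverseʳ p ⟩
                 0# ∎) ⟩
           0# ∎))
      where
      powers : ∀ p q → p * q ≈ p → ∀ n → p * q ^ n ≈ p
      powers p q e zero = *-identityʳ p
      powers p q e (suc n) = trans (sym (*-assoc p q _)) (trans (*-congʳ e) (powers p q e n))
      alg-^ : ∀ {z} → Algebraic z → ∀ n → Algebraic (z ^ n)
      alg-^ hz zero = Ω.In-1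
      alg-^ hz (suc n) = Ω.In-* hz (alg-^ hz n)

    Kernel : List (Vec Carrier n) → Vec Carrier n → Set (c ⊔ ℓ)
    Kernel rows v = All (λ r → dot r v ≈ 0#) rows

    addMul : Vec Carrier n → Vec Carrier n → Carrier → Vec Carrier n
    addMul u v s = Vec.zipWith (λ x y → x + y * s) u v

    dotˡ : ∀ (u v w : Vec Carrier n) s → dot (addMul u v s) w ≈ dot u w + dot v w * s
    dotˡ [] [] [] s = sym (trans (+-congˡ (zeroˡ s)) (+-identityʳ 0#))
    dotˡ (x ∷ u) (y ∷ v) (z ∷ w) s = trans (+-congˡ (dotˡ u v w s))
      (solve 6 (λ x y z s p q → (x :+ y :* s) :* z :+ (p :+ q :* s) := (x :* z :+ p) :+ (y :* z :+ q) :* s) refl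
         x y z s (dot u w) (dot v w))

    addMul-alg : ∀ {s} {u v : Vec Carrier n} → Algebraic s → VAll Algebraic u → VAll Algebraic v → VAll Algebraic (addMul u v s)
    addMul-alg hs [] [] = []
    addMul-alg hs (h ∷ hu) (h′ ∷ hv) = Ω.In-+ h (Ω.In-* h′ hs) ∷ addMul-alg hs hu hv

    -- `r ∷ row` stands for a combination of the rows; the idempotent `r` generates, up to
    -- nilpotents, the ideal of the first column.
    record Combined (rows : List (Vec Carrier (suc n))) : Set (c ⊔ ℓ) where
      field
        r      : Carrier
        row    : Vec Carrier n
        algs   : VAll Algebraic (r ∷ row)
        idem   : r * r ≈ r
        kernel : ∀ v → Kernel rows v → dot (r ∷ row) v ≈ 0#
        heads  : All (λ w → Nilpotent ((1# + - r) * Vec.head w)) rows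

    combine : (rows : List (Vec Carrier (suc n))) → All (VAll Algebraic) rows → Combined rows
    combine {n} [] [] = record { r = 0# ; row = zeros n ; algs = Ω.In-0 ∷ zeros-alg n ; idem = zeroˡ 0#
                           ; kernel = λ { (x ∷ v) _ → 0+0≈0 (zeroˡ x) (comb-zeros (λ y → y) v) } ; heads = [] }
      where
      zeros : ∀ n → Vec Carrier n
      zeros n = Vec.replicate n 0#
      zeros-alg : ∀ n → VAll Algebraic (zeros n)
      zeros-alg zero = []
      zeros-alg (suc n) = Ω.In-0 ∷ zeros-alg n
    combine ((x ∷ w) ∷ rows) ((hx ∷ hw) ∷ hs) = record
      -- `r + x t = r + f (1 - r)` is the join of the idempotents `r` and `f`; its complement is
      -- `(1 - r)(1 - f)`.
      { r = r + x * t ; row = addMul row w t ; algs = addMul-alg ht algs (hx ∷ hw)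
      ; idem = begin
          (r + x * t) * (r + x * t) ≈⟨ *-cong rf rf ⟩
          (r + f * ē) * (r + f * ē)
            ≈⟨ solve 3 (λ r ē f → (r :+ f :* ē) :* (r :+ f :* ē) := r :* r :+ (f :* (ē :* r) :+ f :* (ē :* r)) :+ (f :* f) :* (ē :* ē)) refl r ē f ⟩
          r * r + (f * (ē * r) + f * (ē * r)) + (f * f) * (ē * ē)
            ≈⟨ +-cong (+-cong idem (0+0≈0 (x*0≈0 er) (x*0≈0 er))) (*-cong ff ee) ⟩
          r + 0# + f * ē ≈⟨ +-congʳ (+-identityʳ r) ⟩
          r + f * ē ≈⟨ sym rf ⟩
          r + x * t ∎
      ; kernel = λ { v (z ∷ zs) → trans (dotˡ (r ∷ row) (x ∷ w) v t) (0+0≈0 (kernel v zs) (0*x≈0 z)) }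
      ; heads = nil-* ē nil (trans (*-congʳ split) (solve 3 (λ ē g x → (ē :* g) :* x := ē :* (g :* x)) refl ē g x))
              ∷ All.map (λ {v} nl → nil-* g nl (trans (*-congʳ split) (solve 3 (λ ē g x → (ē :* g) :* x := g :* (ē :* x)) refl ē g (Vec.head v)))) heads
      }
      where
      open Combined (combine rows hs)
      sp = support hx
      s = proj₁ sp
      f = s * x
      ff = proj₁ (proj₂ (proj₂ sp))
      nil = proj₂ (proj₂ (proj₂ sp))
      ē = 1# + - r
      g = 1# + - f
      t = s * ē
      hr : Algebraic r
      hr = VAll.head algs
      ht : Algebraic t
      ht = Ω.In-* (proj₁ (proj₂ sp)) (Ω.In-+ Ω.In-1 (Ω.In-neg hr))
      rf : r + x * t ≈ r + f * ē
      rf = +-congˡ (solve 3 (λ x s ē → x :* (s :* ē) := (s :* x) :* ē) refl x s ē)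
      er : ē * r ≈ 0#
      er = trans (solve 2 (λ o r → (o :- r) :* r := o :* r :- r :* r) refl 1# r)
             (trans (+-cong (*-identityˡ r) (-‿cong idem)) (-‿inverseʳ r))
      ee : ē * ē ≈ ē
      ee = trans (solve 3 (λ ē o r → ē :* (o :- r) := ē :* o :- ē :* r) refl ē 1# r)
             (trans (+-cong (*-identityʳ ē) (trans (-‿cong er) -0#≈0#)) (+-identityʳ ē))
      split : 1# + - (r + x * t) ≈ ē * g
      split = begin
        1# + - (r + x * t) ≈⟨ +-congˡ (-‿cong rf) ⟩
        1# + - (r + f * ē) ≈⟨ solve 4 (λ o r f ē → o :- (r :+ f :* ē) := (o :- r) :- ē :* f) refl 1# r f ē ⟩
        ē + - (ē * f) ≈⟨ +-congʳ (sym (*-identityʳ ē)) ⟩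
        ē * 1# + - (ē * f) ≈⟨ solve 3 (λ ē o f → ē :* o :- ē :* f := ē :* (o :- f)) refl ē 1# f ⟩
        ē * g ∎
      nil-* : ∀ {y z} a → Nilpotent z → y ≈ a * z → Nilpotent y
      nil-* {z = z} a (n , zn) eq = n , trans (^-cong n eq) (trans (^-* a z n) (x*0≈0 zn))

    -- Equality of algebraic elements is not decidable, so there is no pivot to choose.  But every
    -- algebraic element generates, up to nilpotents, the same ideal as an idempotent, and the join
    -- of the idempotents of a column is 1.
    injective : ∀ n (rows : List (Vec Carrier n)) → All (VAll Algebraic) rows →
      (∀ v → Kernel rows v → ¬ ¬ VAll (_≈ 0#) v) → ∀ v → Kernel rows v → VAll (_≈ 0#) v
    injective zero rows hs inj [] ker = []
    injective (suc n) rows hs inj (v₀ ∷ v) ker = trans v₀-eq (trans (-‿cong (dot-zero row v v≈0)) -0#≈0#) ∷ v≈0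
      where
      open Combined (combine rows hs)

      -- If `r` were 0, all first entries would be 0 up to `¬¬` and the first unit vector would lie
      -- in the kernel. So `r` is invertible, and an invertible idempotent is 1.
      r≈1 : r ≈ 1#
      r≈1 = sym (x-y≈0 (cancel≉ r≉0 (trans (solve 2 (λ o r → r :* (o :- r) := o :* r :- r :* r) refl 1# r)
              (trans (+-cong (*-identityˡ r) (-‿cong idem)) (-‿inverseʳ r)))))
        where
        dot-first : ∀ w x → dot (x ∷ w) (1# ∷ Vec.replicate n 0#) ≈ x
        dot-first w x = trans (+-cong (*-identityʳ x) (zeros w)) (+-identityʳ x)
          where
          zeros : ∀ {m} (w : Vec Carrier m) → dot w (Vec.replicate m 0#) ≈ 0#
          zeros [] = refl
          zeros (y ∷ w) = 0+0≈0 (zeroʳ y) (zeros w)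
        r≉0 : ¬ r ≈ 0#
        r≉0 z = allHeads rows heads λ hz → inj (1# ∷ Vec.replicate n 0#) hz λ { (e ∷ _) → 1≉0 e }
          where
          allHeads : ∀ rows → All (λ w → Nilpotent ((1# + - r) * Vec.head w)) rows → ¬ ¬ Kernel rows (1# ∷ Vec.replicate n 0#)
          allHeads [] [] = return []
          allHeads ((x ∷ w) ∷ rows) (nl ∷ nls) = do
            e ← nilpotent≈0 nl
            es ← allHeads rows nls
            return (trans (dot-first w x) (trans (sym (trans (*-congʳ (trans (+-congˡ (trans (-‿cong z) -0#≈0#)) (+-identityʳ 1#))) (*-identityˡ x))) e) ∷ es)

      reduceRow : Vec Carrier (suc n) → Vec Carrier n
      reduceRow w = addMul (Vec.tail w) row (- Vec.head w)

      reduced-alg : ∀ rows → All (VAll Algebraic) rows → All (VAll Algebraic) (L.map reduceRow rows)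
      reduced-alg [] [] = []
      reduced-alg ((x ∷ w) ∷ rows) ((hx ∷ hw) ∷ hs) = addMul-alg (Ω.In-neg hx) hw (VAll.tail algs) ∷ reduced-alg rows hs

      up : ∀ rows u → Kernel (L.map reduceRow rows) u → Kernel rows (- dot row u ∷ u)
      up [] u [] = []
      up ((x ∷ w) ∷ rows) u (z ∷ zs) = trans (solve 3 (λ x d q → x :* (:- d) :+ q := q :+ d :* (:- x)) refl x (dot row u) (dot w u))
        (trans (sym (dotˡ w row u (- x))) z) ∷ up rows u zs

      v₀-eq : v₀ ≈ - dot row v
      v₀-eq = x-y≈0 (trans (+-congˡ (-‿involutive _)) (trans (+-congʳ (trans (sym (*-identityˡ v₀)) (*-congʳ (sym r≈1)))) (kernel (v₀ ∷ v) ker)))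

      down : ∀ rows → Kernel rows (v₀ ∷ v) → Kernel (L.map reduceRow rows) v
      down [] [] = []
      down ((x ∷ w) ∷ rows) (z ∷ zs) = trans (dotˡ w row v (- x)) (trans
        (solve 3 (λ x d q → q :+ d :* (:- x) := x :* (:- d) :+ q) refl x (dot row v) (dot w v))
        (trans (+-congʳ (*-congˡ (sym v₀-eq))) z)) ∷ down rows zs

      v≈0 : VAll (_≈ 0#) v
      v≈0 = injective n (L.map reduceRow rows) (reduced-alg rows hs)
        (λ u ku → inj (- dot row u ∷ u) (up rows u ku) >>= λ { (_ ∷ zs) → return zs }) v (down rows ker)

  -- Synthetic division and root counting

  quotM : Carrier → MP i (suc e) → MP i e
  quotM s (a ∷ [] , l) = [] , l
  quotM s (a ∷ b ∷ as , l) = addLow ℕₚ.≤-refl (scaleV (cst s) (mpV (quotM s (b ∷ as , l)))) (b ∷ as) , l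

  lead-quotM : ∀ s (g : MP i (suc e)) → lead (quotM s g) ≡ lead g
  lead-quotM s (a ∷ [] , l) = ≡.refl
  lead-quotM s (a ∷ b ∷ as , l) = ≡.refl

  ev-quotM : ∀ s (g : MP i (suc e)) t x → evM g t x + - evM g s x ≈ (t + - s) * evM (quotM s g) t x
  ev-quotM s (a ∷ [] , l) t x =
    solve 4 (λ a l s t → (a :+ t :* l) :- (a :+ s :* l) := (t :- s) :* l) refl (ev a x) (ev l x) s t
  ev-quotM s (a ∷ b ∷ as , l) t x = begin
    (α + t * F t) + - (α + s * F s)
      ≈⟨ solve 5 (λ a s t f f′ → (a :+ t :* f) :- (a :+ s :* f′) := (t :- s) :* f :+ s :* (f :- f′)) refl α s t (F t) (F s) ⟩
    (t + - s) * F t + s * (F t + - F s) ≈⟨ +-congˡ (*-congˡ (ev-quotM s f t x)) ⟩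
    (t + - s) * F t + s * ((t + - s) * Q)
      ≈⟨ solve 4 (λ d s f q → d :* f :+ s :* (d :* q) := d :* (s :* q :+ f)) refl (t + - s) s (F t) Q ⟩
    (t + - s) * (s * Q + F t)
      ≈⟨ *-congˡ (sym (trans (ev-addLow ℕₚ.≤-refl (scaleV (cst s) (mpV (quotM s f))) (b ∷ as) l t x)
           (+-congʳ (trans (ev-scaleV (cst s) (mpV (quotM s f)) t x) (*-cong (ev-cst s x) (ev-mp (quotM s f) t x)))))) ⟩
    (t + - s) * evM (quotM s (a ∷ b ∷ as , l)) t x ∎
    where
    f = (b ∷ as , l)
    F = λ t → evM f t x
    α = ev a x
    Q = evM (quotM s f) t x

  Distinct : List Carrier → Set (c ⊔ ℓ)
  Distinct = AllPairs _≉_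

  Distinct-⊆ : ∀ {us ts} → us ⊆ ts → Distinct ts → Distinct us
  Distinct-⊆ [] [] = []
  Distinct-⊆ (_ ∷ʳˢ sub) (_ ∷ ds) = Distinct-⊆ sub ds
  Distinct-⊆ (≡.refl ∷ sub) (d ∷ ds) = Subₚ.All-resp-⊆ sub d ∷ Distinct-⊆ sub ds

  fewRoots : (g : MP i e) (x : Point i) → ¬ ev (lead g) x ≈ 0# → ∀ ts → Distinct ts → e < length ts →
    ¬ All (λ t → VanM g t x) ts
  fewRoots {e = zero} ([] , l) x nl (t ∷ ts) ds lt (z ∷ _) = nl z
  fewRoots {e = suc e} g x nl (s ∷ ts) (d ∷ ds) (s≤s lt) (z ∷ zs) =
    fewRoots (quotM s g) x (≡.subst (λ l → ¬ ev l x ≈ 0#) (≡.sym (lead-quotM s g)) nl) ts ds lt (rest ts d zs)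
    where
    rest : ∀ ts → All (s ≉_) ts → All (λ t → VanM g t x) ts → All (λ t → VanM (quotM s g) t x) ts
    rest [] [] [] = []
    rest (t ∷ ts) (n ∷ ns) (z′ ∷ zs′) =
      cancel≉ (λ e → n (sym (x-y≈0 e))) (trans (sym (ev-quotM s g t x)) (0+0≈0 z′ (trans (-‿cong z) -0#≈0#))) ∷ rest ts ns zs′

  VAll-unsnoc : ∀ {p} {P : NP i → Set p} (as : Vec (NP i) (suc n)) → VAll P (proj₁ (unsnoc as)) → P (lead (unsnoc as)) → VAll P as
  VAll-unsnoc (a ∷ []) [] h = h ∷ []
  VAll-unsnoc (a ∷ b ∷ as) (h ∷ hs) h′ = h ∷ VAll-unsnoc (b ∷ as) hs h′

  -- From the top down: a leading coefficient different from 0 would give more roots than the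
  -- degree.
  coefficients≈0 : ∀ n (as : Vec (NP i) n) x ts → Distinct ts → n ≤ length ts → All (λ t → Van as t x) ts →
    ¬ ¬ VAll (λ a → ev a x ≈ 0#) as
  coefficients≈0 zero [] x ts ds le zs = return []
  coefficients≈0 (suc n) as x ts ds le zs = do
    inj₁ z ← em (ev (lead (unsnoc as)) x ≈ 0#)
      where inj₂ nl → ⊥-elim (fewRoots (unsnoc as) x nl ts ds le (All.map (λ {t} z → trans (ev-unsnoc as t x) z) zs))
    hs ← coefficients≈0 n (proj₁ (unsnoc as)) x ts ds (ℕₚ.≤-trans (ℕₚ.n≤1+n n) le)
           (All.map (λ {t} z′ → trans (sym (evM'-0 (proj₁ (unsnoc as)) _ t x z)) (trans (ev-unsnoc as t x) z′)) zs)
    return (VAll-unsnoc as hs z)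

  Unisolvent : Tower i → ℕ → List (Point i) → Set (c ⊔ ℓ)
  Unisolvent τ n P = ∀ a → Bd n a → All (λ x → ev a x ≈ 0#) P → ¬ ¬ a ∈I τ

  ∈I-poly : (τ : Tower i) (g : MP i e) (as : Vec (NP i) n) → VAll (_∈I τ) as → poly as ∈I (τ ▹≠ g)
  ∈I-poly τ g [] [] (t ∷ x) px = refl
  ∈I-poly τ g (a ∷ as) (h ∷ hs) (t ∷ x) px = 0+0≈0 (h x (proj₁ px)) (x*0≈0 (∈I-poly τ g as hs (t ∷ x) px))

  ¬¬-All : ∀ {a p} {A : Set a} {P : A → Set p} {xs : List A} → All (λ x → ¬ ¬ P x) xs → ¬ ¬ All P xs
  ¬¬-All [] = return []
  ¬¬-All (h ∷ hs) = do
    x ← h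
    xs ← ¬¬-All hs
    return (x ∷ xs)

  split : ∀ {A : Set a} {P : A → Set p} {Q : A → Set q} (xs : List A) → All (λ x → P x ⊎ Q x) xs →
    ∃ λ ys → ∃ λ zs → ys ⊆ xs × zs ⊆ xs × All P ys × All Q zs × length ys ℕ.+ length zs ≡ length xs
  split [] [] = [] , [] , [] , [] , [] , [] , ≡.refl
  split (x ∷ xs) (s ∷ ss) with split xs ss
  split (x ∷ xs) (inj₁ h ∷ ss) | ys , zs , sy , sz , hy , hz , eq =
    x ∷ ys , zs , ≡.refl ∷ sy , x ∷ʳˢ sz , h ∷ hy , hz , ≡.cong suc eq
  split (x ∷ xs) (inj₂ h ∷ ss) | ys , zs , sy , sz , hy , hz , eq =
    ys , x ∷ zs , x ∷ʳˢ sy , ≡.refl ∷ sz , hy , h ∷ hz , ≡.trans (ℕₚ.+-suc _ _) (≡.cong suc eq)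

  -- Sampling a prime tower at algebraic points

  module Sampling (k : Subfield) where
    open LinearAlgebra k public

    AlgTower : Tower i → Set (c ⊔ ℓ)
    AlgTower (base E q) = ⊤
    AlgTower (τ ▹≠ g) = AlgTower τ × AlgM g
    AlgTower (τ ▹≈ g) = AlgTower τ × AlgM g

    private module C = Coefficients algebraics

    AlgV-snoc : (as : Vec (NP i) n) (l : NP i) → AlgV as → Alg l → AlgV (as ∷ʳ l)
    AlgV-snoc [] l h h′ = h′ , tt
    AlgV-snoc (a ∷ as) l (h , hs) h′ = h , AlgV-snoc as l hs h′

    AlgV-addLow : (le : n ≤ m) (as : Vec (NP i) n) (bs : Vec (NP i) m) → AlgV as → AlgV bs → AlgV (addLow le as bs)
    AlgV-addLow z≤n [] bs h h′ = h′
    AlgV-addLow (s≤s le) (a ∷ as) (b ∷ bs) (h , hs) (h′ , hs′) = C.Coef-add a b h h′ , AlgV-addLow le as bs hs hs′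

    AlgM-mulM : (f : MP i n) (g : MP i m) → AlgM f → AlgM g → AlgM (mulM f g)
    AlgM-mulM ([] , l) (bs , l′) (_ , h) (hs , h′) = C.CoefV-scale l bs h hs , C.Coef-mul l l′ h h′
    AlgM-mulM {i} {m = m} (a ∷ as , l) g@(bs , l′) ((h , hs) , hl) hg =
      let (hr , hl′) = AlgM-mulM (as , l) g (hs , hl) hg in
      AlgV-addLow (s≤s (ℕₚ.m≤n+m m _)) (scaleV a (bs ∷ʳ l′)) (zer ∷ proj₁ (mulM (as , l) g))
        (C.CoefV-scale a (bs ∷ʳ l′) h (AlgV-snoc bs l′ (proj₁ hg) (proj₂ hg))) (C.Coef-zer {i} , hr) , hl′

    nonroot-alg : (g : MP i e) (x : Point i) (nl : ¬ ev (lead g) x ≈ 0#) → AlgM g → AlgP x → Algebraic (proj₁ (nonroot g x nl))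
    nonroot-alg {e = zero} ([] , l) x nl hg hx = Ω.In-0
    nonroot-alg {i} {e = suc e} g@(a ∷ as , l) x nl ((ha , has) , hl) hx =
      algebraic-root (shift1 g) x ((C.Coef-add a (cst (- 1#)) ha (C.Coef-cst {i} (Ω.In-neg Ω.In-1)) , has) , hl) hx nl
        (proj₂ (root (shift1 g) x nl))

    Sample : (τ : Tower i) → ℕ → (Point i → Set (c ⊔ ℓ)) → Set (c ⊔ ℓ)
    Sample τ n Q = ∃ λ P → All (λ x → pts τ x × AlgP x × Q x) P × Unisolvent τ n P

    -- Algebraicity of the fibre points is conditional on that of `x`, because base points are
    -- coloured by a function on all of `τ`.
    FibrePts : (τ : Tower (suc i)) → ℕ → (Point (suc i) → Set (c ⊔ ℓ)) → Point i → Set (c ⊔ ℓ)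
    FibrePts τ n Q x = ∃ λ ts → n ≤ length ts × Distinct ts × All (λ t → pts τ (t ∷ x) × Q (t ∷ x)) ts
                         × (AlgP x → All Algebraic ts)

    gather : ∀ (τ⁺ : Tower (suc i)) (τ : Tower i) {n Q} P → All (λ x → pts τ x × AlgP x × FibrePts τ⁺ n Q x) P →
      ∃ λ P⁺ → All (λ x → pts τ⁺ x × AlgP x × Q x) P⁺ × (∀ a → All (λ x → ev a x ≈ 0#) P⁺ →
        All (λ x → ∃ λ ts → n ≤ length ts × Distinct ts × All (λ t → pts τ⁺ (t ∷ x) × ev a (t ∷ x) ≈ 0#) ts) P)
    gather τ⁺ τ [] [] = [] , [] , λ a _ → []
    gather τ⁺ τ {Q = Q} (x ∷ P) ((px , hx , ts , le , ds , qs , hts) ∷ hs) =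
      let (P⁺ , all⁺ , vs) = gather τ⁺ τ P hs in
      L.map (_∷ x) ts ++ P⁺ , Allₚ.++⁺ (Allₚ.map⁺ (All.zipWith (λ { ((pt , q) , h) → pt , (h , hx) , q }) (qs , hts hx))) all⁺ ,
      λ a z → (ts , le , ds , All.zipWith (λ { ((pt , _) , z′) → pt , z′ }) (qs , Allₚ.map⁻ (Allₚ.++⁻ˡ (L.map (_∷ x) ts) z)))
            ∷ vs a (Allₚ.++⁻ʳ (L.map (_∷ x) ts) z)

    majority : ∀ n {a b} → a ℕ.+ b ≡ n ℕ.+ n → n ≤ a ⊎ n ≤ b
    majority n {a} {b} eq with n ℕ.≤? a
    ... | yes le = inj₁ le
    ... | no nle = inj₂ (ℕₚ.≮⇒≥ λ lt → ℕₚ.<-irrefl eq (ℕₚ.+-mono-< (ℕₚ.≰⇒> nle) lt))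

    -- Euclid's argument: where g ∏ (T - tⱼ) takes the value 1, neither g nor any T - tⱼ vanishes.
    avoiding : MP i e → List Carrier → ∃ (MP i)
    avoiding g [] = _ , g
    avoiding g (t ∷ ts) = _ , mulM (linear t) (proj₂ (avoiding g ts))

    avoiding-lead : ∀ (g : MP i e) ts x → ¬ ev (lead g) x ≈ 0# → ¬ ev (lead (proj₂ (avoiding g ts))) x ≈ 0#
    avoiding-lead g [] x nl = nl
    avoiding-lead g (t ∷ ts) x nl = ≉-resp (sym (ev-mul (cst 1#) _ x)) (*≉0 (cst1≉0 x) (avoiding-lead g ts x nl))

    avoiding-alg : ∀ (g : MP i e) ts → AlgM g → All Algebraic ts → AlgM (proj₂ (avoiding g ts))
    avoiding-alg g [] hg [] = hg
    avoiding-alg {i} g (t ∷ ts) hg (h ∷ hs) = AlgM-mulM (linear t) (proj₂ (avoiding g ts))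
      ((C.Coef-cst {i} (Ω.In-neg h) , tt) , C.Coef-cst {i} Ω.In-1) (avoiding-alg g ts hg hs)

    avoiding-nv : ∀ (g : MP i e) ts x s → ¬ VanM (proj₂ (avoiding g ts)) s x → ¬ VanM g s x × All (s ≉_) ts
    avoiding-nv g [] x s nv = nv , []
    avoiding-nv g (t ∷ ts) x s nv =
      let nv′ = ≉-resp (ev-mulM (linear t) (proj₂ (avoiding g ts)) s x) nv
          (ng , ns) = avoiding-nv g ts x s (≉0-*ʳ nv′)
      in ng , (λ e → ≉0-*ˡ nv′ (trans (ev-linear t s x) (trans (+-congʳ e) (-‿inverseʳ t)))) ∷ ns

    fresh : (g : MP i e) (x : Point i) → ¬ ev (lead g) x ≈ 0# → AlgM g → ∀ m →
      ∃ λ ts → length ts ≡ m × Distinct ts × All (λ t → ¬ VanM g t x) ts × (AlgP x → All Algebraic ts)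
    fresh g x nl hg zero = [] , ≡.refl , [] , [] , λ _ → []
    fresh g x nl hg (suc m) =
      let (ts , len , ds , nvs , hts) = fresh g x nl hg m
          f = proj₂ (avoiding g ts)
          nf = avoiding-lead g ts x nl
          (t , nt) = nonroot f x nf
          (ng , ns) = avoiding-nv g ts x t nt
      in t ∷ ts , ≡.cong suc len , ns ∷ ds , ng ∷ nvs , λ hx → nonroot-alg f x nf (avoiding-alg g ts hg (hts hx)) hx ∷ hts hx

    -- A base point takes the colour of one root above it, or the majority colour among `2n` points
    -- of a free fibre; recursion then colours the base. For bound `n` upstairs the base has to be
    -- sampled with bound `β n` or `n` respectively.
    ramsey : (τ : Tower i) → Prime τ → AlgTower τ → ∀ n {A B : Point i → Set (c ⊔ ℓ)} →
      (∀ x → pts τ x → A x ⊎ B x) → Sample τ n A ⊎ Sample τ n B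
    ramsey (base E q) pr h n {A} {B} χ = Sum.map one-point one-point (χ [] pr)
      where
      one-point : ∀ {Q : Point 0 → Set (c ⊔ ℓ)} → Q [] → Sample (base E q) n Q
      one-point qx = [] ∷ [] , (pr , tt , qx) ∷ [] , λ { a b (z ∷ _) → return λ { [] _ → z } }
    ramsey (τ ▹≈ g) (pr , nl , β , sep) (hτ , hg) n {A} {B} χ =
      Sum.map (over {A}) (over {B}) (ramsey τ pr hτ (β n) λ x px → let (t , v) = root g x (nl x px) in
        Sum.map (single {A} x px t v) (single {B} x px t v) (χ (t ∷ x) (px , v)))
      where
      single : ∀ {Q : Point (suc _) → Set (c ⊔ ℓ)} x → pts τ x → ∀ t → VanM g t x → Q (t ∷ x) → FibrePts (τ ▹≈ g) 1 Q x
      single x px t v q = t ∷ [] , s≤s z≤n , [] ∷ [] , ((px , v) , q) ∷ [] , λ hx → algebraic-root g x hg hx (nl x px) v ∷ []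
      over : ∀ {Q} → Sample τ (β n) (FibrePts (τ ▹≈ g) 1 Q) → Sample (τ ▹≈ g) n Q
      over (P , hP , uni) = let (P⁺ , h⁺ , vs) = gather (τ ▹≈ g) τ P hP in P⁺ , h⁺ , λ a b z → do
        inj₂ (μ , bμ , nμ , wμ) ← sep n a b
          where inj₁ az → return az
        μz ← uni μ bμ (All.map (λ { {x} (t ∷ _ , _ , _ , ((px , v) , z′) ∷ _) → wμ t x px v z′ }) (vs a z))
        ⊥-elim (nμ μz)
    ramsey (τ ▹≠ g) (pr , nl) (hτ , hg) n {A} {B} χ =
      Sum.map (over {A}) (over {B}) (ramsey τ pr hτ n colour)
      where
      select : ∀ {Q : Point (suc _) → Set (c ⊔ ℓ)} x {ts us} → us ⊆ ts → n ≤ length us → Distinct ts →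
        All (λ t → pts (τ ▹≠ g) (t ∷ x) × Q (t ∷ x)) us → (AlgP x → All Algebraic ts) → FibrePts (τ ▹≠ g) n Q x
      select x {us = us} sub le ds hs hts = us , le , Distinct-⊆ sub ds , hs , λ hx → Subₚ.All-resp-⊆ sub (hts hx)
      colour : ∀ x → pts τ x → FibrePts (τ ▹≠ g) n A x ⊎ FibrePts (τ ▹≠ g) n B x
      colour x px with fresh g x (nl x px) hg (n ℕ.+ n)
      ... | ts , len , ds , nvs , hts with split {P = λ t → pts (τ ▹≠ g) (t ∷ x) × A (t ∷ x)} {Q = λ t → pts (τ ▹≠ g) (t ∷ x) × B (t ∷ x)} ts
               (All.map (λ {t} nv → Sum.map ((px , nv) ,_) ((px , nv) ,_) (χ (t ∷ x) (px , nv))) nvs)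
      ... | as , bs , sa , sb , ha , hb , eq with majority n (≡.trans eq len)
      ...   | inj₁ le = inj₁ (select {A} x sa le ds ha hts)
      ...   | inj₂ le = inj₂ (select {B} x sb le ds hb hts)
      over : ∀ {Q} → Sample τ n (FibrePts (τ ▹≠ g) n Q) → Sample (τ ▹≠ g) n Q
      over (P , hP , uni) = let (P⁺ , h⁺ , vs) = gather (τ ▹≠ g) τ P hP in P⁺ , h⁺ , λ { (poly {n = l} as) (le , b) z → do
        zs ← ¬¬-All (All.map (λ { {x} (ts , le′ , ds , h) →
               coefficients≈0 l as x ts ds (ℕₚ.≤-trans le le′) (All.map proj₂ h) }) (vs (poly as) z))
        hs ← each as b zs
        return (∈I-poly τ g as hs) }
        where
        each : ∀ {l} (as : Vec (NP _) l) → BdV n as → All (λ x → VAll (λ a → ev a x ≈ 0#) as) P → ¬ ¬ VAll (_∈I τ) as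
        each [] b zs = return []
        each (a ∷ as) (b , bs) zs = do
          h ← uni a b (All.map VAll.head zs)
          hs ← each as bs (All.map VAll.tail zs)
          return (h ∷ hs)

  -- Monomials

  Exp : ℕ → Set
  Exp = Vec ℕ

  infix 4 _≤*_ _≺_
  _≤*_ : Exp m → Exp m → Set
  _≤*_ = Pointwise _≤_

  data _≺_ : Exp m → Exp m → Set where
    here  : ∀ {a b} {α β : Exp m} → a < b → (a ∷ α) ≺ (b ∷ β)
    there : ∀ {a} {α β : Exp m} → α ≺ β → (a ∷ α) ≺ (a ∷ β)

  ≺-wf : WellFounded (_≺_ {m})
  ≺-wf {zero} [] = acc λ ()
  ≺-wf {suc m} (a ∷ α) = go (<-wellFounded a) (≺-wf {m} α)
    where
    go : ∀ {a} {α : Exp m} → Acc _<_ a → Acc _≺_ α → Acc _≺_ (a ∷ α)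
    step : ∀ {a} {α : Exp m} → Acc _<_ a → Acc _≺_ α → ∀ {β} → β ≺ (a ∷ α) → Acc _≺_ β
    go p q = acc (step p q)
    step (acc ra) q (here l) = go (ra l) (≺-wf {m} _)
    step p (acc rα) (there l) = go p (rα l)

  ≺-trans : {α β γ : Exp m} → α ≺ β → β ≺ γ → α ≺ γ
  ≺-trans (here p) (here q) = here (ℕₚ.<-trans p q)
  ≺-trans (here p) (there q) = here p
  ≺-trans (there p) (here q) = here q
  ≺-trans (there p) (there q) = there (≺-trans p q)

  data Cmp (α β : Exp m) : Set where
    less    : α ≺ β → Cmp α β
    equal   : α ≡ β → Cmp α β
    greater : β ≺ α → Cmp α β

  cmp : (α β : Exp m) → Cmp α β
  cmp [] [] = equal ≡.refl
  cmp (a ∷ α) (b ∷ β) with ℕₚ.<-cmp a b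
  ... | tri< p _ _ = less (here p)
  ... | tri> _ _ p = greater (here p)
  ... | tri≈ _ ≡.refl _ with cmp α β
  ...   | less p = less (there p)
  ...   | equal ≡.refl = equal ≡.refl
  ...   | greater p = greater (there p)

  infixl 6 _⊕_
  _⊕_ : Exp m → Exp m → Exp m
  _⊕_ = Vec.zipWith ℕ._+_

  ⊕-≺ : (β : Exp m) {γ α : Exp m} → γ ≺ α → (β ⊕ γ) ≺ (β ⊕ α)
  ⊕-≺ (b ∷ β) (here p) = here (ℕₚ.+-monoʳ-< b p)
  ⊕-≺ (b ∷ β) (there p) = there (⊕-≺ β p)

  ≤*-split : {α β : Exp m} → α ≤* β → ∃ λ γ → γ ⊕ α ≡ β
  ≤*-split [] = [] , ≡.refl
  ≤*-split {β = b ∷ _} (_∷_ {x = a} p ps) = let (γ , e) = ≤*-split ps in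
    (b ℕ.∸ a) ∷ γ , ≡.cong₂ _∷_ (ℕₚ.m∸n+n≡m p) e

  mon : Exp m → Point m → Carrier
  mon = evalMon K

  mon-⊕ : (β γ : Exp m) (x : Point m) → mon (β ⊕ γ) x ≈ mon β x * mon γ x
  mon-⊕ [] [] [] = sym (*-identityˡ 1#)
  mon-⊕ (b ∷ β) (g ∷ γ) (t ∷ x) = trans (*-cong (^-+ t b g) (mon-⊕ β γ x))
    (solve 4 (λ a b c d → (a :* b) :* (c :* d) := (a :* c) :* (b :* d)) refl (t ^ b) (t ^ g) (mon β x) (mon γ x))

  -- With the first exponent dropped, a finite dominating set exists by induction. Lifted, it
  -- dominates everything with first exponent at least `I`, the largest one used; the slices below
  -- `I` are finitely many and treated singly.
  dickson : ∀ m (L : Exp m → Set p) → ¬ ¬ (∃ λ F → All L F × (∀ α → L α → Any (_≤* α) F))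
  dickson zero L = do
    inj₁ h ← em (L [])
      where inj₂ nope → return ([] , [] , λ { [] h → ⊥-elim (nope h) })
    return ([] ∷ [] , h ∷ [] , λ { [] _ → here [] })
  dickson (suc m) L = do
    (F∞ , hF∞ , dom∞) ← dickson m (λ β → ∃ λ i → L (i ∷ β))
    let (I , G , hG , domG) = raise F∞ hF∞
    (H , hH , domH) ← slices I
    return (G ++ H , Allₚ.++⁺ hG hH , λ { (i ∷ β) h → dominate I G H domG domH i β h (dom∞ β (i , h)) (ℕₚ.<-≤-connex i I) })
    where
    raise : ∀ F → All (λ β → ∃ λ i → L (i ∷ β)) F →
      ∃ λ I → ∃ λ G → All L G × (∀ i β → I ≤ i → Any (_≤* β) F → Any (_≤* (i ∷ β)) G)
    raise [] [] = 0 , [] , [] , λ _ _ _ ()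
    raise (β ∷ F) ((i , h) ∷ hs) = let (I , G , hG , dom) = raise F hs in
      i ℕ.⊔ I , (i ∷ β) ∷ G , h ∷ hG , λ
        { j γ le (here b) → here (ℕₚ.m⊔n≤o⇒m≤o i I le ∷ b)
        ; j γ le (there b) → there (dom j γ (ℕₚ.m⊔n≤o⇒n≤o i I le) b) }
    slices : ∀ I → ¬ ¬ (∃ λ H → All L H × (∀ i β → i < I → L (i ∷ β) → Any (_≤* (i ∷ β)) H))
    slices zero = return ([] , [] , λ _ _ ())
    slices (suc I) = do
      (H , hH , dom) ← slices I
      (F , hF , domF) ← dickson m (λ β → L (I ∷ β))
      return (L.map (I ∷_) F ++ H , Allₚ.++⁺ (Allₚ.map⁺ hF) hH , λ i β lt h → pick H F dom domF i β h (ℕₚ.m≤n⇒m<n∨m≡n (ℕₚ.≤-pred lt)))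
      where
      pick : ∀ H F → (∀ i β → i < I → L (i ∷ β) → Any (_≤* (i ∷ β)) H) → (∀ α → L (I ∷ α) → Any (_≤* α) F) →
        ∀ i β → L (i ∷ β) → i < I ⊎ i ≡ I → Any (_≤* (i ∷ β)) (L.map (I ∷_) F ++ H)
      pick H F dom domF i β h (inj₁ lt) = Anyₚ.++⁺ʳ (L.map (I ∷_) F) (dom i β lt h)
      pick H F dom domF i β h (inj₂ ≡.refl) = Anyₚ.++⁺ˡ (Anyₚ.map⁺ (Any.map (ℕₚ.≤-refl ∷_) (domF β h)))
    dominate : ∀ I G H {F} → (∀ i β → I ≤ i → Any (_≤* β) F → Any (_≤* (i ∷ β)) G) →
      (∀ i β → i < I → L (i ∷ β) → Any (_≤* (i ∷ β)) H) → ∀ i β → L (i ∷ β) → Any (_≤* β) F → i < I ⊎ I ≤ i →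
      Any (_≤* (i ∷ β)) (G ++ H)
    dominate I G H domG domH i β h b (inj₁ lt) = Anyₚ.++⁺ʳ G (domH i β lt h)
    dominate I G H domG domH i β h b (inj₂ le) = Anyₚ.++⁺ˡ (domG i β le b)

  -- From lists of terms to nested polynomials, and sorting of terms

  monoV : ∀ e → NP i → Vec (NP i) (suc e)
  monoV zero a = a ∷ []
  monoV (suc e) a = zer ∷ monoV e a

  mono : Carrier → Exp m → NP m
  mono a [] = con₀ a
  mono a (e ∷ α) = poly (monoV e (mono a α))

  conv : Poly K m → NP m
  conv [] = zer
  conv ((a , α) ∷ p) = add (mono a α) (conv p)

  ev-monoV : ∀ e (a : NP i) t x → evV (monoV e a) t x ≈ t ^ e * ev a x
  ev-monoV zero a t x = trans (+-congˡ (zeroʳ t)) (trans (+-identityʳ _) (sym (*-identityˡ _)))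
  ev-monoV (suc e) a t x = trans (+-cong (ev-zer x) (*-congˡ (ev-monoV e a t x)))
    (trans (+-identityˡ _) (sym (*-assoc t _ _)))

  ev-mono : ∀ a (α : Exp m) x → ev (mono a α) x ≈ a * mon α x
  ev-mono a [] [] = sym (*-identityʳ a)
  ev-mono a (e ∷ α) (t ∷ x) = trans (ev-monoV e (mono a α) t x) (trans (*-congˡ (ev-mono a α x))
    (solve 3 (λ p a q → p :* (a :* q) := a :* (p :* q)) refl (t ^ e) a (mon α x)))

  ev-conv : ∀ (p : Poly K m) x → ev (conv p) x ≈ eval K p x
  ev-conv [] x = ev-zer x
  ev-conv ((a , α) ∷ p) x = trans (ev-add (mono a α) (conv p) x) (+-cong (ev-mono a α x) (ev-conv p x))

  BdV-monoV : ∀ e (a : NP i) → Bd N a → BdV N (monoV e a)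
  BdV-monoV zero a b = b , tt
  BdV-monoV (suc e) a b = Bd-zer , BdV-monoV e a b

  Bd-mono′ : ∀ a (α : Exp m) → totalDeg K α < N → Bd N (mono a α)
  Bd-mono′ a [] lt = tt
  Bd-mono′ a (e ∷ α) lt = ℕₚ.≤-trans (s≤s (ℕₚ.m≤m+n e _)) lt ,
    BdV-monoV e (mono a α) (Bd-mono′ a α (ℕₚ.≤-trans (s≤s (ℕₚ.m≤n+m _ e)) lt))

  Bd-conv : ∀ (p : Poly K m) → All (λ (a , α) → totalDeg K α < N) p → Bd N (conv p)
  Bd-conv [] [] = Bd-zer
  Bd-conv ((a , α) ∷ p) (h ∷ hs) = Bd-add (mono a α) (conv p) (Bd-mono′ a α h) (Bd-conv p hs)

  scaleP : Carrier → Poly K m → Poly K m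
  scaleP s = L.map λ (a , α) → s * a , α

  eval-scaleP : ∀ s (p : Poly K m) x → eval K (scaleP s p) x ≈ s * eval K p x
  eval-scaleP s [] x = sym (zeroʳ s)
  eval-scaleP s ((a , α) ∷ p) x = trans (+-congˡ (eval-scaleP s p x))
    (solve 4 (λ s a u r → (s :* a) :* u :+ s :* r := s :* (a :* u :+ r)) refl s a (mon α x) (eval K p x))

  eval-++ : ∀ (p q : Poly K m) x → eval K (p ++ q) x ≈ eval K p x + eval K q x
  eval-++ [] q x = sym (+-identityˡ _)
  eval-++ (t ∷ p) q x = trans (+-congˡ (eval-++ p q x)) (sym (+-assoc _ _ _))

  Monos : (Exp m → Set) → Poly K m → Set c
  Monos P = All λ t → P (proj₂ t)

  _·_ : Vec Carrier n → Vec (Exp m) n → Poly K m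
  [] · [] = []
  (a ∷ as) · (α ∷ αs) = (a , α) ∷ as · αs

  row : Vec (Exp m) n → Point m → Vec Carrier n
  row αs x = Vec.map (λ α → mon α x) αs

  eval-· : ∀ (as : Vec Carrier n) (αs : Vec (Exp m) n) x → eval K (as · αs) x ≈ dot (row αs x) as
  eval-· [] [] x = refl
  eval-· (a ∷ as) (α ∷ αs) x = +-cong (*-comm a _) (eval-· as αs x)

  Monos-· : ∀ {P : Exp m → Set} (as : Vec Carrier n) {αs : Vec (Exp m) n} → VAll P αs → Monos P (as · αs)
  Monos-· [] [] = []
  Monos-· (a ∷ as) (h ∷ hs) = h ∷ Monos-· as hs

  data Descending : Vec (Exp m) n → Set where
    []  : Descending {m} []
    _∷_ : ∀ {α} {αs : Vec (Exp m) n} → VAll (_≺ α) αs → Descending αs → Descending (α ∷ αs)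

  -- Equal exponents are merged, but zero coefficients remain, since they cannot be recognised.
  record Normal (P : Exp m → Set) (p : Poly K m) : Set (c ⊔ ℓ) where
    field
      {size} : ℕ
      cs     : Vec Carrier size
      αs     : Vec (Exp m) size
      desc   : Descending αs
      good   : VAll P αs
      same   : ∀ x → eval K p x ≈ eval K (cs · αs) x

  insertN : ∀ {P : Exp m → Set} a α → P α → (as : Vec Carrier n) (αs : Vec (Exp m) n) → Descending αs → VAll P αs →
    Σ (Normal P ((a , α) ∷ as · αs)) λ R → ∀ β → α ≺ β → VAll (_≺ β) αs → VAll (_≺ β) (Normal.αs R)
  insertN a α h [] [] ds hs =
    record { cs = a ∷ [] ; αs = α ∷ [] ; desc = [] ∷ [] ; good = h ∷ [] ; same = λ x → refl } , λ β l _ → l ∷ []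
  insertN a α h (b ∷ as) (β ∷ αs) (d ∷ ds) (h′ ∷ hs) with cmp α β
  ... | greater l = record { cs = a ∷ b ∷ as ; αs = α ∷ β ∷ αs ; desc = (l ∷ VAll.map (λ l′ → ≺-trans l′ l) d) ∷ (d ∷ ds)
                      ; good = h ∷ h′ ∷ hs ; same = λ x → refl } , λ γ l₁ ls → l₁ ∷ ls
  ... | equal ≡.refl = record { cs = a + b ∷ as ; αs = β ∷ αs ; desc = d ∷ ds ; good = h′ ∷ hs
                      ; same = λ x → solve 4 (λ a b u r → a :* u :+ (b :* u :+ r) := (a :+ b) :* u :+ r) refl a b (mon β x) (eval K (as · αs) x) }
                    , λ γ l₁ ls → ls
  ... | less l with insertN a α h as αs ds hs
  ...   | R , keeps = record { cs = b ∷ cs ; αs = β ∷ αs′ ; desc = keeps β l d ∷ desc ; good = h′ ∷ good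
                      ; same = λ x → trans (solve 3 (λ a b r → a :+ (b :+ r) := b :+ (a :+ r)) refl (a * mon α x) (b * mon β x) (eval K (as · αs) x))
                                 (+-congˡ (same x)) }
                    , λ { γ l₁ (l₂ ∷ ls) → l₂ ∷ keeps γ l₁ ls }
    where open Normal R renaming (αs to αs′)

  normal : ∀ {P : Exp m → Set} (p : Poly K m) → Monos P p → Normal P p
  normal [] [] = record { cs = [] ; αs = [] ; desc = [] ; good = [] ; same = λ x → refl }
  normal ((a , α) ∷ p) (h ∷ hs) = record { cs = N′.cs ; αs = N′.αs ; desc = N′.desc ; good = N′.good
      ; same = λ x → trans (+-congˡ (N.same x)) (N′.same x) }
    where
    module N = Normal (normal p hs)
    module N′ = Normal (proj₁ (insertN a α h N.cs N.αs N.desc N.good))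

  -- Irreducible closures and chains

  module Closure (τ : Tower m) (pr : Prime τ) where

    -- The exponents of leading monomials of the ideal of `τ`, normalised to coefficient 1 so that
    -- rewriting needs no division.
    Leading : Exp m → Set (c ⊔ ℓ)
    Leading α = ∃ λ p → Monos (_≺ α) p × PolyIn τ ((1# , α) ∷ p)

    module _ (F : List (Exp m)) (hF : All Leading F) (dom : ∀ α → Leading α → Any (_≤* α) F) where

      Std : Exp m → Set
      Std α = ¬ Any (_≤* α) F

      gens : ∀ {F} → All Leading F → List (Poly K m)
      gens [] = []
      gens {α ∷ _} ((p , _) ∷ hs) = ((1# , α) ∷ p) ∷ gens hs

      gens-van : ∀ {F} (hs : All Leading F) → All (PolyIn τ) (gens hs)
      gens-van [] = []
      gens-van ((p , _ , z) ∷ hs) = z ∷ gens-van hs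

      find : ∀ {F} (hs : All Leading F) {α} → Any (_≤* α) F → ∃ λ β → β ≤* α × ∃ λ p → Monos (_≺ β) p ×
        (∀ x → V K (gens hs) x → mon β x ≈ - eval K p x)
      find {β ∷ _} ((p , l , _) ∷ hs) (here le) = β , le , p , l , λ { x (z ∷ _) →
        x-y≈0 (trans (+-congˡ (-‿involutive _)) (trans (+-congʳ (sym (*-identityˡ _))) z)) }
      find (_ ∷ hs) (there a) = let (β , le , p , l , z) = find hs a in β , le , p , l , λ { x (_ ∷ zs) → z x zs }

      Reduced : Poly K m → Set (c ⊔ ℓ)
      Reduced p = ∃ λ R → Monos Std R × (∀ x → V K (gens hF) x → eval K p x ≈ eval K R x)

      -- Divisibility by an element of `F` is decidable, and a rewriting step replaces `γ ⊕ β` by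
      -- exponents `γ ⊕ δ` below it.
      reduceMon : ∀ α → Acc _≺_ α → ∃ λ R → Monos Std R × (∀ x → V K (gens hF) x → mon α x ≈ eval K R x)
      reduceMon α (acc rs) with Any.any? (λ β → PW.decidable ℕ._≤?_ β α) F
      ... | no std = (1# , α) ∷ [] , std ∷ [] , λ x _ → sym (trans (+-identityʳ _) (*-identityˡ _))
      ... | yes a with find hF a
      ...   | β , le , p , l , z with ≤*-split le
      ...     | γ , ≡.refl = let (R , hR , eqR) = terms p l in R , hR , λ x zs → begin
          mon (γ ⊕ β) x ≈⟨ mon-⊕ γ β x ⟩
          mon γ x * mon β x ≈⟨ *-congˡ (z x zs) ⟩
          mon γ x * (- eval K p x) ≈⟨ eqR x zs ⟩
          eval K R x ∎
        where
        terms : ∀ p → Monos (_≺ β) p → ∃ λ R → Monos Std R × (∀ x → V K (gens hF) x → mon γ x * (- eval K p x) ≈ eval K R x)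
        terms [] [] = [] , [] , λ x _ → x*0≈0 -0#≈0#
        terms ((a , δ) ∷ p) (l ∷ ls) =
          let (R , hR , eqR) = reduceMon (γ ⊕ δ) (rs (⊕-≺ γ l))
              (R′ , hR′ , eqR′) = terms p ls
          in scaleP (- a) R ++ R′ , Allₚ.++⁺ (Allₚ.map⁺ hR) hR′ , λ x zs → begin
            mon γ x * (- (a * mon δ x + eval K p x))
              ≈⟨ solve 4 (λ g a d r → g :* (:- (a :* d :+ r)) := (:- a) :* (g :* d) :+ g :* (:- r)) refl (mon γ x) a (mon δ x) (eval K p x) ⟩
            (- a) * (mon γ x * mon δ x) + mon γ x * (- eval K p x)
              ≈⟨ +-cong (*-congˡ (trans (sym (mon-⊕ γ δ x)) (eqR x zs))) (eqR′ x zs) ⟩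
            (- a) * eval K R x + eval K R′ x ≈⟨ +-congʳ (sym (eval-scaleP (- a) R x)) ⟩
            eval K (scaleP (- a) R) x + eval K R′ x ≈⟨ sym (eval-++ (scaleP (- a) R) R′ x) ⟩
            eval K (scaleP (- a) R ++ R′) x ∎

      reducePoly : ∀ p → Reduced p
      reducePoly [] = [] , [] , λ x _ → refl
      reducePoly ((a , α) ∷ p) =
        let (R , hR , eqR) = reduceMon α (≺-wf α)
            (R′ , hR′ , eqR′) = reducePoly p
        in scaleP a R ++ R′ , Allₚ.++⁺ (Allₚ.map⁺ hR) hR′ , λ x zs →
             trans (+-cong (trans (*-congˡ (eqR x zs)) (sym (eval-scaleP a R x))) (eqR′ x zs)) (sym (eval-++ (scaleP a R) R′ x))

      record NormalForm (p : Poly K m) : Set (c ⊔ ℓ) where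
        field
          {size} : ℕ
          cs     : Vec Carrier size
          αs     : Vec (Exp m) size
          desc   : Descending αs
          std    : VAll Std αs
          same   : ∀ x → V K (gens hF) x → eval K p x ≈ eval K (cs · αs) x

      normalForm : ∀ p → NormalForm p
      normalForm p = record { cs = N.cs ; αs = N.αs ; desc = N.desc ; std = N.good
                            ; same = λ x zs → trans (proj₂ (proj₂ R) x zs) (N.same x) }
        where
        R = reducePoly p
        module N = Normal (normal (proj₁ R) (proj₁ (proj₂ R)))

      -- The greatest exponent with a non-zero coefficient would, after division by it, be a leading
      -- one and hence dominated by `F`, unlike a standard exponent.
      independent : (as : Vec Carrier n) (αs : Vec (Exp m) n) → Descending αs → VAll Std αs → PolyIn τ (as · αs) →
        ¬ ¬ VAll (_≈ 0#) as
      independent [] [] _ _ _ = return []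
      independent (a ∷ as) (α ∷ αs) (d ∷ ds) (s ∷ ss) z = do
        inj₁ az ← em (a ≈ 0#)
          where inj₂ na → let (u , au) = inverse a na in
                  ⊥-elim (s (dom α (scaleP u (as · αs) , Allₚ.map⁺ (Monos-· as d) , λ x px → begin
                    1# * mon α x + eval K (scaleP u (as · αs)) x ≈⟨ +-cong (*-congʳ (sym au)) (eval-scaleP u (as · αs) x) ⟩
                    (a * u) * mon α x + u * eval K (as · αs) x
                      ≈⟨ solve 4 (λ a u p r → (a :* u) :* p :+ u :* r := u :* (a :* p :+ r)) refl a u (mon α x) (eval K (as · αs) x) ⟩
                    u * (a * mon α x + eval K (as · αs) x) ≈⟨ x*0≈0 (z x px) ⟩
                    0# ∎)))
        zs ← independent as αs ds ss λ x px → trans (sym (trans (+-congʳ (0*x≈0 az)) (+-identityˡ _))) (z x px)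
        return (az ∷ zs)

      degBound : Vec (Exp m) n → ℕ
      degBound [] = 0
      degBound (α ∷ αs) = suc (totalDeg K α) ℕ.⊔ degBound αs

      degBound-spec : (αs : Vec (Exp m) n) → degBound αs ≤ N → VAll (λ α → totalDeg K α < N) αs
      degBound-spec [] le = []
      degBound-spec (α ∷ αs) le = ℕₚ.m⊔n≤o⇒m≤o (suc (totalDeg K α)) (degBound αs) le
                                ∷ degBound-spec αs (ℕₚ.m⊔n≤o⇒n≤o (suc (totalDeg K α)) (degBound αs) le)

      -- Read off the normal forms, because lexicographic rewriting may raise the degree.
      listBound : List (Poly K m) → ℕ
      listBound [] = 0
      listBound (p ∷ ps) = degBound (NormalForm.αs (normalForm p)) ℕ.⊔ listBound ps

      module _ (k : Subfield) (hτ : Sampling.AlgTower k τ) where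
        open Sampling k

        row-alg : ∀ (αs : Vec (Exp m) n) x → AlgP x → VAll Algebraic (row αs x)
        row-alg αs x hx = rows αs
          where
          pow-alg : ∀ {t} e → Algebraic t → Algebraic (t ^ e)
          pow-alg zero h = Ω.In-1
          pow-alg (suc e) h = Ω.In-* h (pow-alg e h)
          mon-alg : ∀ {m} (α : Exp m) x → AlgP x → Algebraic (mon α x)
          mon-alg [] [] h = Ω.In-1
          mon-alg (e ∷ α) (t ∷ x) (ht , hx) = Ω.In-* (pow-alg e ht) (mon-alg α x hx)
          rows : ∀ {n} (αs : Vec (Exp m) n) → VAll Algebraic (row αs x)
          rows [] = []
          rows (α ∷ αs) = mon-alg α x hx ∷ rows αs

        -- Appending `E`, which vanishes on `τ`, loses no point of `τ` and makes the inclusion in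
        -- the zero set of `E` immediate.
        Z : List (Poly K m) → List (Poly K m)
        Z E = gens hF ++ E

        pts⊆Z : ∀ E → All (PolyIn τ) E → ∀ x → pts τ x → V K (Z E) x
        pts⊆Z E hE x px = All.map (λ h → h x px) (Allₚ.++⁺ (gens-van hF) hE)

        -- The coefficients of the normal form solve the homogeneous system of monomial values at
        -- the sample points. Unisolvence and independence of standard monomials make every solution
        -- zero up to `¬¬`; `injective` makes this one zero outright.
        spread : ∀ {n} (P : List (Point m)) → All (λ x → pts τ x × AlgP x) P → Unisolvent τ n P →
          ∀ p → degBound (NormalForm.αs (normalForm p)) ≤ n → All (λ x → eval K p x ≈ 0#) P →
          ∀ x → V K (gens hF) x → eval K p x ≈ 0#
        spread {n} P hP uni p le z x zx = trans (same x zx) (trans (eval-· cs αs x) (dot-zero (row αs x) cs cs≈0))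
          where
          open NormalForm (normalForm p)
          kernel⇒ : ∀ v → Kernel (L.map (row αs) P) v → All (λ x → ev (conv (v · αs)) x ≈ 0#) P
          kernel⇒ v ker = All.map (λ {y} e → trans (ev-conv (v · αs) y) (trans (eval-· v αs y) e)) (Allₚ.map⁻ ker)
          cs≈0 : VAll (_≈ 0#) cs
          cs≈0 = injective size (L.map (row αs) P) (Allₚ.map⁺ (All.map (λ {y} (_ , hy) → row-alg αs y hy) hP))
            (λ v ker → do
              z′ ← uni (conv (v · αs)) (Bd-conv (v · αs) (Monos-· v (degBound-spec αs le))) (kernel⇒ v ker)
              independent v αs desc std λ y py → trans (sym (ev-conv (v · αs) y)) (z′ y py))
            cs (Allₚ.map⁺ (All.zipWith (λ { {y} ((py , _) , zy) → trans (sym (eval-· cs αs y))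
                 (trans (sym (same y (All.map (λ h → h y py) (gens-van hF)))) zy) }) (hP , z)))

        spreads : ∀ {n} E A → listBound A ≤ n → Sample τ n (V K A) → _⊆V_ K (Z E) A
        spreads E A le (P , hP , uni) x zx = go A le (All.map (λ (_ , _ , v) → v) hP)
          where
          go : ∀ A → listBound A ≤ _ → All (V K A) P → V K A x
          go [] le vs = []
          go (p ∷ A) le vs = spread P (All.map (λ (px , hx , _) → px , hx) hP) uni p (ℕₚ.m⊔n≤o⇒m≤o _ _ le)
                               (All.map All.head vs) x (Allₚ.++⁻ˡ (gens hF) zx)
                           ∷ go A (ℕₚ.m⊔n≤o⇒n≤o _ (listBound A) le) (All.map All.tail vs)

        irreducible : ∀ E → All (PolyIn τ) E → Irreducible K (Z E)
        irreducible E hE = (proj₁ (point τ pr) , pts⊆Z E hE _ (proj₂ (point τ pr))) , λ A B cover →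
          Sum.map (spreads E A (ℕₚ.m≤m⊔n (listBound A) (listBound B))) (spreads E B (ℕₚ.m≤n⊔m (listBound A) (listBound B)))
            (ramsey τ pr hτ (listBound A ℕ.⊔ listBound B) {V K A} {V K B} λ x px → cover x (pts⊆Z E hE x px))

  coefs  : NP i → List Carrier
  coefsV : Vec (NP i) n → List Carrier
  coefs (con₀ a) = a ∷ []
  coefs (poly as) = coefsV as
  coefsV [] = []
  coefsV (a ∷ as) = coefs a ++ coefsV as

  coefsT : Tower i → List Carrier
  coefsT (base E q) = []
  coefsT (τ ▹≠ (as , l)) = coefsT τ ++ coefsV as ++ coefs l
  coefsT (τ ▹≈ (as , l)) = coefsT τ ++ coefsV as ++ coefs l

  module _ (k : Subfield) where
    open Subfield k using (In)
    open Sampling k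

    coefs-alg  : (p : NP i) → All In (coefs p) → Alg p
    coefsV-alg : (as : Vec (NP i) n) → All In (coefsV as) → AlgV as
    coefs-alg (con₀ a) (h ∷ []) = In⇒Algebraic h
    coefs-alg (poly as) h = coefsV-alg as h
    coefsV-alg [] h = tt
    coefsV-alg (a ∷ as) h = coefs-alg a (Allₚ.++⁻ˡ (coefs a) h) , coefsV-alg as (Allₚ.++⁻ʳ (coefs a) h)

    coefsT-alg : (τ : Tower i) → All In (coefsT τ) → AlgTower τ
    coefsT-alg (base E q) h = tt
    coefsT-alg (τ ▹≠ (as , l)) h = let h′ = Allₚ.++⁻ʳ (coefsT τ) h in
      coefsT-alg τ (Allₚ.++⁻ˡ (coefsT τ) h) , coefsV-alg as (Allₚ.++⁻ˡ (coefsV as) h′) , coefs-alg l (Allₚ.++⁻ʳ (coefsV as) h′)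
    coefsT-alg (τ ▹≈ (as , l)) h = let h′ = Allₚ.++⁻ʳ (coefsT τ) h in
      coefsT-alg τ (Allₚ.++⁻ˡ (coefsT τ) h) , coefsV-alg as (Allₚ.++⁻ˡ (coefsV as) h′) , coefs-alg l (Allₚ.++⁻ʳ (coefsV as) h′)

  record Closed (τ : Tower m) (E : List (Poly K m)) : Set (c ⊔ ℓ) where
    constructor closed
    field
      Z     : List (Poly K m)
      irred : Irreducible K Z
      ⊆E    : _⊆V_ K Z E
      pts⊆  : ∀ x → pts τ x → V K Z x

  -- The leading exponents and the subfield are chosen before any cover is given, which is why
  -- irreducibility itself holds without `¬¬`.
  closure : (τ : Tower m) → Prime τ → ∀ E → All (PolyIn τ) E → ¬ ¬ Closed τ E
  closure τ pr E hE = do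
    (F , hF , dom) ← dickson _ (Closure.Leading τ pr)
    (k , hk) ← subfieldOver (coefsT τ)
    let module C = Closure τ pr
        hτ = coefsT-alg k τ hk
    return (closed (C.Z F hF dom k hτ E) (C.irreducible F hF dom k hτ E hE)
      (λ x zx → Allₚ.++⁻ʳ (C.gens F hF dom hF) zx) (C.pts⊆Z F hF dom k hτ E hE))

  PolyIn-dense : ∀ {S : Point m → Set (c ⊔ ℓ)} (σ : Tower m) → Dense S σ → ∀ p → (∀ x → S x → eval K p x ≈ 0#) → ¬ ¬ PolyIn σ p
  PolyIn-dense σ dense p z = do
    z′ ← dense (conv p) λ x s _ → return (trans (ev-conv p x) (z x s))
    return λ x px → trans (sym (ev-conv p x)) (z′ x px)

  prepend : ∀ {G : List (Poly K m)} {e} (C : Chain K G e) Z → Irreducible K Z →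
    _⊂V_ K Z (Chain.Z C Fin.zero) → Chain K G (suc e)
  prepend C Z ir (sub , x , zx) = record
    { Z = λ { Fin.zero → Z ; (Fin.suc i) → Chain.Z C i }
    ; irred = λ { Fin.zero → ir ; (Fin.suc i) → Chain.irred C i }
    ; inX = λ { Fin.zero x z → Chain.inX C Fin.zero x (sub x z) ; (Fin.suc i) → Chain.inX C i }
    ; strict = λ { Fin.zero → sub , x , zx ; (Fin.suc i) → Chain.strict C i } }

  -- The equations of the least member of the chain pass to the section by density; a point of `τ`
  -- off the cutting equation shows the inclusion of the new closure to be strict.
  descend : ∀ {G : List (Poly K m)} r (τ : Tower m) → Prime τ → dim τ ≡ r → ∀ {e} (C : Chain K G e) →
    (∀ x → pts τ x → V K (Chain.Z C Fin.zero) x) → ¬ ¬ Chain K G (r ℕ.+ e)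
  descend zero τ pr d≡ C sub = return C
  descend {G = G} (suc r) τ pr d≡ {e} C sub = do
    slice (denseIn σ prσ d≡σ dense) p p∈ p∉ ← cut τ pr d≡
    Z₀∈ ← ¬¬-All (All.tabulate λ {q} q∈ → PolyIn-dense σ dense q λ x px → All.lookup (sub x px) q∈)
    closed Z ir ⊆E pts⊆ ← closure σ prσ (p ∷ Chain.Z C Fin.zero) (p∈ ∷ Z₀∈)
    s ← shrink τ pr (conv p) λ z → p∉ λ x px → trans (sym (ev-conv p x)) (z x px)
    let (x , px) = point (Shrunk.σ s) (Shrunk.isPr s)
        (pτ , nx) = Shrunk.sub s x px
        C′ = prepend C Z ir ((λ y zy → All.tail (⊆E y zy)) , x , sub x pτ , λ zx → nx (trans (ev-conv p x) (All.head (⊆E x zx))))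
    C″ ← descend r σ prσ d≡σ C′ pts⊆
    return (≡.subst (Chain K G) (ℕₚ.+-suc r e) C″)

  chain : ∀ {G : List (Poly K m)} (τ : Tower m) → Regular τ → (∀ x → pts τ x → V K G x) → ∀ {x} → pts τ x →
    ¬ ¬ Chain K G (dim τ)
  chain {G = G} τ reg inG px = do
    denseIn σ pr d≡ dense ← component τ reg px
    G∈ ← ¬¬-All (All.tabulate λ {q} q∈ → PolyIn-dense σ dense q λ x px → All.lookup (inG x px) q∈)
    closed Z ir ⊆E pts⊆ ← closure σ pr G G∈
    C ← descend (dim τ) σ pr d≡ record
          { Z = λ _ → Z ; irred = λ _ → ir ; inX = λ _ → ⊆E ; strict = λ () } pts⊆
    return (≡.subst (Chain K G) (ℕₚ.+-identityʳ (dim τ)) C)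

  -- Counting patterns

  comb-++ : ∀ {k} (cs : Vec Carrier n) (ds : Vec Carrier k) (f : A → Carrier) vs ws →
    comb (cs Vec.++ ds) f (vs Vec.++ ws) ≈ comb cs f vs + comb ds f ws
  comb-++ [] ds f [] ws = sym (+-identityˡ _)
  comb-++ (c′ ∷ cs) ds f (v ∷ vs) ws = trans (+-congˡ (comb-++ cs ds f vs ws)) (sym (+-assoc _ _ _))

  comb-scale : ∀ (cs : Vec Carrier n) (f : A → Carrier) s vs → comb cs (λ v → s * f v) vs ≈ s * comb cs f vs
  comb-scale [] f s [] = sym (zeroʳ s)
  comb-scale (a ∷ cs) f s (v ∷ vs) = trans (+-congˡ (comb-scale cs f s vs))
    (solve 4 (λ a s u r → a :* (s :* u) :+ s :* r := s :* (a :* u :+ r)) refl a s (f v) (comb cs f vs))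

  -- The unit J collects the leading coefficients by which pseudo-division multiplies.
  record Spanned (τ : Tower i) (n : ℕ) : Set (c ⊔ ℓ) where
    field
      size  : ℕ
      J     : NP i
      fs    : Vec (NP i) size
      unit  : ∀ x → pts τ x → ¬ ev J x ≈ 0#
      spans : ∀ a → Bd n a → ∃ λ cs → ∀ x → pts τ x → ev J x * ev a x ≈ comb cs (λ f → ev f x) fs

  powers : ∀ n → Vec (NP i) m → Vec (NP (suc i)) (n ℕ.* m)
  powers zero fs = []
  powers (suc n) fs = Vec.map liftP fs Vec.++ Vec.map shift (powers n fs)

  powers-span : ∀ {τ : Tower i} (S : Spanned τ n) {l} k (as : Vec (NP i) l) → l ≤ k → BdV n as →
    ∃ λ cs → ∀ t x → pts τ x → ev (Spanned.J S) x * evV as t x ≈ comb cs (λ f → ev f (t ∷ x)) (powers k (Spanned.fs S))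
  powers-span S k [] le b = Vec.replicate _ 0# , λ t x px → trans (zeroʳ _) (sym (comb-zeros _ (powers k (Spanned.fs S))))
  powers-span S (suc k) (a ∷ as) (s≤s le) (b , bs) =
    let (cs , eq) = spans a b
        (ds , eq′) = powers-span S k as le bs
    in cs Vec.++ ds , λ t x px → begin
      ev J x * (ev a x + t * evV as t x)
        ≈⟨ solve 4 (λ j a t r → j :* (a :+ t :* r) := j :* a :+ t :* (j :* r)) refl (ev J x) (ev a x) t (evV as t x) ⟩
      ev J x * ev a x + t * (ev J x * evV as t x)
        ≈⟨ +-cong (trans (eq x px) (trans (comb-cong cs (λ f → sym (ev-liftP f t x)) fs) (sym (comb-map cs _ liftP fs))))
            (trans (*-congˡ (eq′ t x px)) (trans (sym (comb-scale ds _ t (powers k fs)))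
              (trans (comb-cong ds (λ f → sym (ev-shift f t x)) (powers k fs)) (sym (comb-map ds _ shift (powers k fs)))))) ⟩
      comb cs (λ f → ev f (t ∷ x)) (Vec.map liftP fs) + comb ds (λ f → ev f (t ∷ x)) (Vec.map shift (powers k fs))
        ≈⟨ sym (comb-++ cs ds _ (Vec.map liftP fs) _) ⟩
      comb (cs Vec.++ ds) (λ f → ev f (t ∷ x)) (powers (suc k) fs) ∎
    where open Spanned S

  -- From the remainder bound `n + (n + 1)(2 + B)` and `n + 1 ≤ 2 n`.
  growth : MP i e → ℕ
  growth g = 1 ℕ.+ 2 ℕ.* (2 ℕ.+ boundM g)

  growth-spec : ∀ (g : MP i e) n → 1 ≤ n → premBd (boundM g) n n ≤ growth g ℕ.* n
  growth-spec g n le = ℕₚ.≤-trans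
    (ℕₚ.+-monoʳ-≤ n (ℕₚ.*-monoˡ-≤ (2 ℕ.+ boundM g) (ℕₚ.+-monoˡ-≤ n le)))
    (ℕₚ.≤-reflexive (ℕS.solve 2 (λ n b → n ℕS.:+ (n ℕS.:+ n) ℕS.:* (ℕS.con 2 ℕS.:+ b)
       ℕS.:= (ℕS.con 1 ℕS.:+ ℕS.con 2 ℕS.:* (ℕS.con 2 ℕS.:+ b)) ℕS.:* n) ≡.refl n (boundM g)))

  ^-distrib-* : ∀ a b k → (a ℕ.* b) ℕ.^ k ≡ a ℕ.^ k ℕ.* b ℕ.^ k
  ^-distrib-* a b zero = ≡.refl
  ^-distrib-* a b (suc k) = ≡.trans (≡.cong (a ℕ.* b ℕ.*_) (^-distrib-* a b k)) (ℕₚ.[m*n]*[o*p]≡[m*o]*[n*p] a b (a ℕ.^ k) (b ℕ.^ k))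

  -- Reduction modulo `g` leaves `suc e` coefficients of bound `growth g * n` over `τ`; hence the
  -- power `dim τ` of `growth g`.
  factor : Tower i → ℕ
  factor (base E q) = 1
  factor (τ ▹≠ g) = factor τ
  factor (_▹≈_ {e = e} τ g) = suc e ℕ.* (factor τ ℕ.* growth g ℕ.^ dim τ)

  spanned : (τ : Tower i) → Regular τ → ∀ n → 1 ≤ n → Σ (Spanned τ n) λ S → Spanned.size S ≤ factor τ ℕ.* n ℕ.^ dim τ
  spanned (base E q) reg n le = record
    { size = 1 ; J = cst 1# ; fs = cst 1# ∷ [] ; unit = λ x _ → 1≉0
    ; spans = λ { (con₀ a) _ → a ∷ [] , λ x _ → trans (*-comm 1# a) (sym (+-identityʳ _)) } } , s≤s z≤n
  spanned (τ ▹≠ g) (reg , _) n le = record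
    { size = n ℕ.* size ; J = liftP J ; fs = powers n fs
    ; unit = λ { (t ∷ x) (px , _) → ≉-resp (sym (ev-liftP J t x)) (unit x px) }
    ; spans = λ { (poly as) (l , b) → let (cs , eq) = powers-span S n as l b in
        cs , λ { (t ∷ x) (px , _) → trans (*-congʳ (ev-liftP J t x)) (eq t x px) } } }
    , ℕₚ.≤-trans (ℕₚ.*-monoʳ-≤ n (proj₂ ih)) (ℕₚ.≤-reflexive (rearrange n (factor τ) (n ℕ.^ dim τ)))
    where
    ih = spanned τ reg n le
    S = proj₁ ih
    open Spanned S
    rearrange : ∀ n f p → n ℕ.* (f ℕ.* p) ≡ f ℕ.* (n ℕ.* p)
    rearrange = ℕS.solve 3 (λ n f p → n ℕS.:* (f ℕS.:* p) ℕS.:= f ℕS.:* (n ℕS.:* p)) ≡.refl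
  spanned (_▹≈_ {e = e} τ g) (reg , nl) n le = record
    { size = suc e ℕ.* size ; J = liftP (mul J (powP (lead g) n)) ; fs = powers (suc e) fs
    ; unit = λ { (t ∷ x) (px , _) → ≉-resp (sym (trans (ev-liftP (mul J (powP (lead g) n)) t x) (trans (ev-mul J (powP (lead g) n) x) (*-congˡ (ev-powP (lead g) n x)))))
                   (*≉0 (unit x px) (^-≉0 n (nl x px))) }
    ; spans = λ { (poly as) (l , b) →
        -- Padding to exactly `n` coefficients makes the multiplier `lead g ^ n`, and with it `J`,
        -- the same for every polynomial.
        let as′ = castV (ℕₚ.m+[n∸m]≡n l) (padR _ as)
            b′ = castV-Bd (ℕₚ.m+[n∸m]≡n l) (padR _ as) (BdV-pad _ as b)
            r = proj₂ (prem n (padR (suc e) as′) g)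
            br = BdV-mono (growth-spec g n le) r (Bd-prem n (padR (suc e) as′) g (BdV-pad (suc e) as′ b′) (BdM-bound g))
            (cs , eq) = powers-span S (suc e) r ℕₚ.≤-refl br
        in cs , λ { (t ∷ x) (px , v) → begin
             ev (liftP (mul J (powP (lead g) n))) (t ∷ x) * evV as t x
               ≈⟨ *-cong (trans (ev-liftP (mul J (powP (lead g) n)) t x) (trans (ev-mul J (powP (lead g) n) x) (*-congˡ (ev-powP (lead g) n x))))
                   (sym (trans (ev-padR (suc e) as′ t x) (trans (ev-castV (ℕₚ.m+[n∸m]≡n l) (padR _ as) t x) (ev-padR _ as t x)))) ⟩
             (ev J x * ev (lead g) x ^ n) * evV (padR (suc e) as′) t x ≈⟨ *-assoc _ _ _ ⟩
             ev J x * (ev (lead g) x ^ n * evV (padR (suc e) as′) t x) ≈⟨ *-congˡ (ev-prem n (padR (suc e) as′) g t x) ⟩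
             ev J x * (_ + evV r t x) ≈⟨ *-congˡ (trans (+-congʳ (x*0≈0 v)) (+-identityˡ _)) ⟩
             ev J x * evV r t x ≈⟨ eq t x px ⟩
             comb cs (λ f → ev f (t ∷ x)) (powers (suc e) fs) ∎ } } }
    , ℕₚ.≤-trans (ℕₚ.*-monoʳ-≤ (suc e) (proj₂ ih)) (ℕₚ.≤-reflexive (≡.trans
        (≡.cong (λ z → suc e ℕ.* (factor τ ℕ.* z)) (^-distrib-* (growth g) n (dim τ)))
        (rearrange (suc e) (factor τ) (growth g ℕ.^ dim τ) (n ℕ.^ dim τ))))
    where
    ih = spanned τ reg (growth g ℕ.* n) (ℕₚ.≤-trans le (ℕₚ.m≤n*m n (growth g)))
    S = proj₁ ih
    open Spanned S
    rearrange : ∀ s f b p → s ℕ.* (f ℕ.* (b ℕ.* p)) ≡ s ℕ.* (f ℕ.* b) ℕ.* p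
    rearrange = ℕS.solve 4 (λ s f b p → s ℕS.:* (f ℕS.:* (b ℕS.:* p))
                  ℕS.:= s ℕS.:* (f ℕS.:* b) ℕS.:* p) ≡.refl

  -- Patterns and their separating polynomials

  Pattern : ℕ → Set
  Pattern N = Fin N → Bool

  falses : Pattern N → ℕ
  falses {zero} σ = 0
  falses {suc N} σ with σ Fin.zero
  ... | true = falses (σ ∘ Fin.suc)
  ... | false = suc (falses (σ ∘ Fin.suc))

  -- Makes the number of false places a measure for the triangular elimination.
  falses-⊆ : (σ ρ : Pattern N) → (∀ i → ρ i ≡ false → σ i ≡ false) → (∀ i → ρ i ≡ σ i) ⊎ falses ρ < falses σ
  falses-⊆ {zero} σ ρ h = inj₁ λ ()
  falses-⊆ {suc N} σ ρ h with falses-⊆ (σ ∘ Fin.suc) (ρ ∘ Fin.suc) (h ∘ Fin.suc)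
  ... | ih with σ Fin.zero in σ₀ | ρ Fin.zero in ρ₀
  falses-⊆ {suc N} σ ρ h | inj₁ e | true | true = inj₁ λ { Fin.zero → ≡.trans ρ₀ (≡.sym σ₀) ; (Fin.suc i) → e i }
  falses-⊆ {suc N} σ ρ h | inj₂ l | true | true = inj₂ l
  falses-⊆ {suc N} σ ρ h | inj₁ e | false | false = inj₁ λ { Fin.zero → ≡.trans ρ₀ (≡.sym σ₀) ; (Fin.suc i) → e i }
  falses-⊆ {suc N} σ ρ h | inj₂ l | false | false = inj₂ (s≤s l)
  falses-⊆ {suc N} σ ρ h | inj₁ e | false | true = inj₂ (s≤s (ℕₚ.≤-reflexive (same _ _ e)))
    where
    same : ∀ {N} (σ ρ : Pattern N) → (∀ i → ρ i ≡ σ i) → falses ρ ≡ falses σ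
    same {zero} σ ρ e = ≡.refl
    same {suc N} σ ρ e with σ Fin.zero | ρ Fin.zero | e Fin.zero
    ... | true | .true | ≡.refl = same (σ ∘ Fin.suc) (ρ ∘ Fin.suc) (e ∘ Fin.suc)
    ... | false | .false | ≡.refl = ≡.cong suc (same (σ ∘ Fin.suc) (ρ ∘ Fin.suc) (e ∘ Fin.suc))
  falses-⊆ {suc N} σ ρ h | inj₂ l | false | true = inj₂ (ℕₚ.m<n⇒m<1+n l)
  falses-⊆ {suc N} σ ρ h | _ | true | false with ≡.trans (≡.sym σ₀) (h Fin.zero ρ₀)
  ... | ()

  -- At a point realizing `ρ` this product is non-zero exactly if every false place of `σ` is a
  -- false place of `ρ`.
  separator : (Fin N → Poly K m) → Pattern N → NP m
  separator {zero} F σ = cst 1#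
  separator {suc N} F σ with σ Fin.zero
  ... | true = separator (F ∘ Fin.suc) (σ ∘ Fin.suc)
  ... | false = mul (conv (F Fin.zero)) (separator (F ∘ Fin.suc) (σ ∘ Fin.suc))

  -- Degree at most `D` allows `suc D` coefficients per factor; the summand 1 comes from the empty
  -- product.
  Bd-separator : (F : Fin N → Poly K m) → (∀ i → DegLe K (F i) D) → ∀ σ → Bd (N ℕ.* suc D ℕ.+ 1) (separator F σ)
  Bd-separator {zero} F h σ = Bd-cst 1# ℕₚ.≤-refl
  Bd-separator {suc N} {D = D} F h σ with σ Fin.zero
  ... | true = Bd-mono (ℕₚ.+-monoˡ-≤ 1 (ℕₚ.m≤n+m (N ℕ.* suc D) (suc D))) (separator (F ∘ Fin.suc) (σ ∘ Fin.suc)) (Bd-separator (F ∘ Fin.suc) (h ∘ Fin.suc) (σ ∘ Fin.suc))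
  ... | false = Bd-mono (ℕₚ.≤-reflexive (≡.sym (ℕₚ.+-assoc (suc D) _ 1))) (mul (conv (F Fin.zero)) _)
                  (Bd-mul (conv (F Fin.zero)) _ (Bd-conv (F Fin.zero) (All.map s≤s (h Fin.zero)))
                    (Bd-separator (F ∘ Fin.suc) (h ∘ Fin.suc) (σ ∘ Fin.suc)))

  separator≉0 : ∀ (F : Fin N → Poly K m) σ x → (∀ i → σ i ≡ false → ¬ eval K (F i) x ≈ 0#) → ¬ ev (separator F σ) x ≈ 0#
  separator≉0 {zero} F σ x h = cst1≉0 x
  separator≉0 {suc N} F σ x h with σ Fin.zero in σ₀
  ... | true = separator≉0 (F ∘ Fin.suc) (σ ∘ Fin.suc) x (h ∘ Fin.suc)
  ... | false = ≉-resp (sym (ev-mul (conv (F Fin.zero)) _ x))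
      (*≉0 (≉-resp (sym (ev-conv (F Fin.zero) x)) (h Fin.zero σ₀)) (separator≉0 (F ∘ Fin.suc) (σ ∘ Fin.suc) x (h ∘ Fin.suc)))

  separator≉0⁻ : ∀ (F : Fin N → Poly K m) σ x → ¬ ev (separator F σ) x ≈ 0# → ∀ i → σ i ≡ false → ¬ eval K (F i) x ≈ 0#
  separator≉0⁻ {suc N} F σ x n i e z with σ Fin.zero in σ₀
  separator≉0⁻ {suc N} F σ x n Fin.zero e z | true with ≡.trans (≡.sym σ₀) e
  ... | ()
  separator≉0⁻ {suc N} F σ x n (Fin.suc i) e z | true = separator≉0⁻ (F ∘ Fin.suc) (σ ∘ Fin.suc) x n i e z
  separator≉0⁻ {suc N} F σ x n Fin.zero e z | false =
    ≉0-*ˡ (≉-resp (ev-mul (conv (F Fin.zero)) _ x) n) (trans (ev-conv (F Fin.zero) x) z)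
  separator≉0⁻ {suc N} F σ x n (Fin.suc i) e z | false =
    separator≉0⁻ (F ∘ Fin.suc) (σ ∘ Fin.suc) x (≉0-*ʳ (≉-resp (ev-mul (conv (F Fin.zero)) _ x) n)) i e z

  distinct-lookup : ∀ {σs : List (Pattern N)} → PairwiseDistinct σs → ∀ i j → ¬ i ≡ j →
    DistinctPat (L.lookup σs i) (L.lookup σs j)
  distinct-lookup (d ∷ ds) Fin.zero Fin.zero ne = ⊥-elim (ne ≡.refl)
  distinct-lookup (d ∷ ds) Fin.zero (Fin.suc j) ne = lookup d j
    where
    lookup : ∀ {P : Pattern N → Set} {xs} → All P xs → ∀ j → P (L.lookup xs j)
    lookup (h ∷ hs) Fin.zero = h
    lookup (h ∷ hs) (Fin.suc j) = lookup hs j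
  distinct-lookup (d ∷ ds) (Fin.suc i) Fin.zero ne e = distinct-lookup (d ∷ ds) Fin.zero (Fin.suc i) (λ ()) (λ k → ≡.sym (e k))
  distinct-lookup (d ∷ ds) (Fin.suc i) (Fin.suc j) ne = distinct-lookup ds i j (ne ∘ ≡.cong Fin.suc)

  comb-single : ∀ {M} (ds : Vec Carrier M) (f : A → Carrier) (g : Fin M → A) j →
    (∀ k → ¬ k ≡ j → Vec.lookup ds k * f (g k) ≈ 0#) → comb ds f (Vec.tabulate g) ≈ Vec.lookup ds j * f (g j)
  comb-single (d ∷ ds) f g Fin.zero h = trans (+-congˡ (all-zero ds (g ∘ Fin.suc) λ k → h (Fin.suc k) λ ())) (+-identityʳ _)
    where
    all-zero : ∀ {M} (ds : Vec Carrier M) (g : Fin M → _) → (∀ k → Vec.lookup ds k * f (g k) ≈ 0#) → comb ds f (Vec.tabulate g) ≈ 0#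
    all-zero [] g h = refl
    all-zero (d ∷ ds) g h = 0+0≈0 (h Fin.zero) (all-zero ds (g ∘ Fin.suc) (h ∘ Fin.suc))
  comb-single (d ∷ ds) f g (Fin.suc j) h = trans (+-congʳ (h Fin.zero λ ())) (trans (+-identityˡ _)
    (comb-single ds f (g ∘ Fin.suc) j λ k ne → h (Fin.suc k) (ne ∘ Finₚ.suc-injective)))

  Realized : List (Poly K m) → (Fin N → Poly K m) → (Point m → Set (c ⊔ ℓ)) → Pattern N → Set (c ⊔ ℓ)
  Realized G F Q σ = ∃ λ x → InR K G F σ x × Q x

  -- The separators are linearly independent on the realizing points, being triangular with respect
  -- to inclusion of the sets σ i = false.
  patterns-on-tower : ∀ (G : List (Poly K m)) (F : Fin N → Poly K m) {M} (τ : Tower m) (S : Spanned τ M) →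
    (∀ σ → Bd M (separator F σ)) → ∀ σs → PairwiseDistinct σs → All (Realized G F (pts τ)) σs →
    ¬ ¬ length σs ≤ Spanned.size S
  patterns-on-tower {m} {N} G F τ S bd σs ds real nle = subfieldOver entries λ (k , hk) → contradiction k hk
    where
    open Spanned S
    σ : Fin (length σs) → Pattern N
    σ = L.lookup σs
    realized : ∀ j → Realized G F (pts τ) (σ j)
    realized j = All.lookup real (∈-lookup j)
    x : Fin (length σs) → Point m
    x j = proj₁ (realized j)
    P : Fin (length σs) → NP m
    P j = separator F (σ j)
    cs : Fin (length σs) → Vec Carrier size
    cs j = proj₁ (spans (P j) (bd (σ j)))
    -- The decidable subfield is built from the coordinates of the separators; the realizing points
    -- enter only through the vectors `b`, which are arbitrary.
    entries : List Carrier
    entries = L.concat (L.tabulate (Vec.toList ∘ cs))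

    σ-false : ∀ j i → σ j i ≡ false → ¬ eval K (F i) (x j) ≈ 0#
    σ-false j i e z with ≡.trans (≡.sym e) (proj₁ (proj₂ (proj₁ (proj₂ (realized j))) i) (proj₁ (proj₁ (proj₂ (realized j))) , z))
    ... | ()

    false-σ : ∀ j i → ¬ eval K (F i) (x j) ≈ 0# → σ j i ≡ false
    false-σ j i n with σ j i in e
    ... | false = ≡.refl
    ... | true = ⊥-elim (n (proj₂ (proj₂ (proj₂ (proj₁ (proj₂ (realized j))) i) e)))

    module _ (k : Subfield) (hk : All (Subfield.In k) entries) where
      open Subfield k using (In; dec)
      open LinearAlgebra k

      rows : Vec (Vec Carrier size) (length σs)
      rows = Vec.tabulate cs

      rows-In : VAll InV rows
      rows-In = VAllₚ.tabulate⁺ λ j → fromList (cs j) (Allₚ.tabulate⁻ (Allₚ.concat⁻ hk′) j)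
        where
        hk′ = hk
        fromList : ∀ {n} (v : Vec Carrier n) → All In (Vec.toList v) → InV v
        fromList [] [] = []
        fromList (a ∷ v) (h ∷ hs) = h ∷ fromList v hs

      relation = dependent size (ℕₚ.≰⇒> nle) rows rows-In
      δ = proj₁ relation
      vanish = proj₂ (proj₂ (proj₂ relation))

      value : ∀ j l → dot (Vec.map (λ f → ev f (x j)) fs) (cs l) ≈ ev J (x j) * ev (P l) (x j)
      value j l = trans (flip (cs l) fs) (sym (proj₂ (spans (P l) (bd (σ l))) (x j) (proj₂ (proj₂ (realized j)))))
        where
        flip : ∀ {n} (as : Vec Carrier n) (fs : Vec (NP m) n) → dot (Vec.map (λ f → ev f (x j)) fs) as ≈ comb as (λ f → ev f (x j)) fs
        flip [] [] = refl
        flip (a ∷ as) (f ∷ fs) = +-cong (*-comm _ a) (flip as fs)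

      δ-In : ∀ {n} {v : Vec Carrier n} → InV v → ∀ j → In (Vec.lookup v j)
      δ-In (h ∷ hs) Fin.zero = h
      δ-In (h ∷ hs) (Fin.suc j) = δ-In hs j

      -- Evaluation at `x j` retains patterns whose false places are among those of `σ j`. All but
      -- `σ j` have coefficient 0 by induction, so `δ` at `j` times a non-zero factor is 0;
      -- decidability in the subfield removes the double negation.
      δ≈0 : ∀ j → Acc _<_ (falses (σ j)) → Vec.lookup δ j ≈ 0#
      δ≈0 j (acc rs) = decidable-stable (dec (δ-In (proj₁ (proj₂ relation)) j)) λ n →
        others λ h → *≉0 n (≉-resp (sym (value j j)) (*≉0 (unit (x j) (proj₂ (proj₂ (realized j))))
                         (separator≉0 F (σ j) (x j) (σ-false j))))
          (trans (sym (comb-single δ (dot b₀) cs j h)) (vanish b₀))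
        where
        b₀ = Vec.map (λ f → ev f (x j)) fs
        term : ∀ l → ¬ l ≡ j → ¬ ¬ Vec.lookup δ l * dot b₀ (cs l) ≈ 0#
        term l ne = do
          inj₂ nP ← em (ev (P l) (x j) ≈ 0#)
            where inj₁ z → return (x*0≈0 (trans (value j l) (x*0≈0 z)))
          smaller (falses-⊆ (σ j) (σ l) λ i e → false-σ j i (separator≉0⁻ F (σ l) (x j) nP i e))
          where
          smaller : (∀ i → σ l i ≡ σ j i) ⊎ falses (σ l) < falses (σ j) → ¬ ¬ Vec.lookup δ l * dot b₀ (cs l) ≈ 0#
          smaller (inj₁ e) = ⊥-elim (distinct-lookup ds l j ne e)
          smaller (inj₂ lt) = return (0*x≈0 (δ≈0 l (rs lt)))
        others : ¬ ¬ (∀ l → ¬ l ≡ j → Vec.lookup δ l * dot b₀ (cs l) ≈ 0#)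
        others = do
          h ← ¬¬-All {P = λ l → ¬ l ≡ j → Vec.lookup δ l * dot b₀ (cs l) ≈ 0#} {xs = L.allFin (length σs)}
                (All.tabulate λ {l} _ → case l)
          return λ l → All.lookup h (∈-allFin l)
          where
          case : ∀ l → ¬ ¬ (¬ l ≡ j → Vec.lookup δ l * dot b₀ (cs l) ≈ 0#)
          case l with l Fin.≟ j
          ... | yes e = return λ ne → ⊥-elim (ne e)
          ... | no ne = term l ne >>= λ z → return λ _ → z

      contradiction : ⊥
      contradiction = nontrivial (proj₁ (proj₂ (proj₂ relation))) λ j → δ≈0 j (<-wellFounded _)
        where
        nontrivial : ∀ {n} {v : Vec Carrier n} → VAny (λ d → ¬ d ≈ 0#) v → ¬ (∀ j → Vec.lookup v j ≈ 0#)
        nontrivial (here n) h = n (h Fin.zero)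
        nontrivial (there a) h = nontrivial a (h ∘ Fin.suc)

  distinct-⊆ : {σs ρs : List (Pattern N)} → σs ⊆ ρs → PairwiseDistinct ρs → PairwiseDistinct σs
  distinct-⊆ [] [] = []
  distinct-⊆ (_ ∷ʳˢ sub) (_ ∷ ds) = distinct-⊆ sub ds
  distinct-⊆ (≡.refl ∷ sub) (d ∷ ds) = Subₚ.All-resp-⊆ sub d ∷ distinct-⊆ sub ds

  -- The final count

  module Count (G : List (Poly K m)) (D d : ℕ) (isDim : IsDim K G d) where

    -- All separators have bound `N * (D + 2)`; the power of `D + 2` is what `spanned` contributes
    -- besides that of `N`.
    constant : List (Tower m) → ℕ
    constant [] = 0
    constant (τ ∷ τs) = factor τ ℕ.* suc (suc D) ℕ.^ dim τ ℕ.+ constant τs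

    X-cells : List (Tower m)
    X-cells = cells m (L.map conv G) (cst 1#)

    -- The successor keeps `C` positive when there are no cells.
    C : ℕ
    C = suc (constant X-cells)

    inG : ∀ (x : Point m) → Holds (L.map conv G) (cst 1#) x → V K G x
    inG x (zs , _) = All.map (λ {g} z → trans (sym (ev-conv g x)) z) (Allₚ.map⁻ zs)

    Gin : ∀ (x : Point m) → V K G x → Holds (L.map conv G) (cst 1#) x
    Gin x zs = Allₚ.map⁺ (All.map (λ {g} z → trans (ev-conv g x) z) zs) , cst1≉0 x

    module _ {N} (N≥1 : 0 < N) (F : Fin N → Poly K m) (deg : ∀ i → DegLe K (F i) D) where

      -- A pattern provides a point of the cell, hence a chain of length `dim τ`, and the exponent
      -- may be raised to `d`. For a cell without patterns no such comparison is available, and the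
      -- bound is trivial.
      on-cell : ∀ τ → Cell (L.map conv G) (cst 1#) τ → ∀ σs → PairwiseDistinct σs → All (Realized G F (pts τ)) σs →
        length σs ≤ factor τ ℕ.* suc (suc D) ℕ.^ dim τ ℕ.* N ℕ.^ d
      on-cell τ _ [] _ _ = z≤n
      on-cell τ (reg , sub) σs@(_ ∷ _) ds real@((x , _ , px) ∷ _) = ℕₚ.≤-trans
        (decidable-stable (_ ℕ.≤? _) (patterns-on-tower G F τ (proj₁ S)
          (λ σ → Bd-mono bound≤ (separator F σ) (Bd-separator F deg σ)) σs ds real))
        (ℕₚ.≤-trans (proj₂ S) (ℕₚ.≤-trans
          (ℕₚ.≤-reflexive (≡.trans (≡.cong (factor τ ℕ.*_) (^-distrib-* N (suc (suc D)) (dim τ)))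
            (rearrange (factor τ) (N ℕ.^ dim τ) (suc (suc D) ℕ.^ dim τ))))
          (ℕₚ.*-monoʳ-≤ (factor τ ℕ.* suc (suc D) ℕ.^ dim τ) (ℕₚ.^-monoʳ-≤ N {{ℕ.>-nonZero N≥1}} dim≤d))))
        where
        S = spanned τ reg (N ℕ.* suc (suc D)) (ℕₚ.*-mono-≤ N≥1 (s≤s z≤n))
        dim≤d : dim τ ≤ d
        dim≤d = decidable-stable (_ ℕ.≤? _) (chain τ reg (λ y py → inG y (sub y py)) px >>= λ ch → return (proj₂ isDim (dim τ) ch))
        -- Here `N ≥ 1` absorbs the summand 1 of the empty product.
        bound≤ : N ℕ.* suc D ℕ.+ 1 ≤ N ℕ.* suc (suc D)
        bound≤ = ℕₚ.≤-trans (ℕₚ.+-monoʳ-≤ _ N≥1) (ℕₚ.≤-reflexive (≡.trans (ℕₚ.+-comm _ N) (≡.sym (ℕₚ.*-suc N (suc D)))))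
        rearrange : ∀ f n b → f ℕ.* (n ℕ.* b) ≡ f ℕ.* b ℕ.* n
        rearrange = ℕS.solve 3 (λ f n b → f ℕS.:* (n ℕS.:* b) ℕS.:= f ℕS.:* b ℕS.:* n) ≡.refl

      on-cells : ∀ τs → All (Cell (L.map conv G) (cst 1#)) τs → ∀ σs → PairwiseDistinct σs →
        All (Realized G F (λ x → Any (λ τ → pts τ x) τs)) σs → length σs ≤ constant τs ℕ.* N ℕ.^ d
      on-cells [] [] [] ds [] = z≤n
      on-cells (τ ∷ τs) (h ∷ hs) σs ds real with split σs (All.map (λ
          { (x , r , here p) → inj₁ (x , r , p) ; (x , r , there a) → inj₂ (x , r , a) }) real)
      ... | ρs , ρs′ , s , s′ , hρ , hρ′ , eq = ≡.subst (_≤ _) eq (ℕₚ.≤-trans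
            (ℕₚ.+-mono-≤ (on-cell τ h ρs (distinct-⊆ s ds) hρ) (on-cells τs hs ρs′ (distinct-⊆ s′ ds) hρ′))
            (ℕₚ.≤-reflexive (≡.sym (ℕₚ.*-distribʳ-+ (N ℕ.^ d) (factor τ ℕ.* suc (suc D) ℕ.^ dim τ) (constant τs)))))

      count : ∀ σs → PairwiseDistinct σs → All (Realizable K G F) σs →
        length σs ≤ C ℕ.* N ℕ.^ d
      count σs ds real = decidable-stable (length σs ℕ.≤? C ℕ.* N ℕ.^ d) do
        real′ ← ¬¬-All (All.map (λ { (x , r) → cells-complete m (L.map conv G) (cst 1#) x (Gin x (proj₁ r)) >>= λ a → return (x , r , a) }) real)
        return (ℕₚ.≤-trans (on-cells X-cells (cells-sound m (L.map conv G) (cst 1#)) σs ds real′) (ℕₚ.m≤n+m (constant X-cells ℕ.* N ℕ.^ d) (N ℕ.^ d)))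

open import Data.Nat using (_*_; _^_)

theorem3p3 : ∀ {c ℓ : Level} (K : Field c ℓ) → AlgClosed K →
    ∀ (m : ℕ) (G : List (Poly K m)) (D d : ℕ) → IsDim K G d →
    Σ ℕ λ C → (0 < C) ×
    (∀ (N : ℕ) → 0 < N → (F : Fin N → Poly K m) → (∀ i → DegLe K (F i) D) →
    ∀ (σs : List (Fin N → Bool)) → PairwiseDistinct σs →
    All (Realizable K G F) σs → length σs ≤ C * N ^ d)
theorem3p3 K ac m G D d isDim = C , s≤s z≤n , λ N N≥1 F deg → count N≥1 F deg
  where open Patterns.Count K ac G D d isDim
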